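{- Let $\sigma$ be a connected skew Young diagram whose topmost row is row $1$. Then, as formal power series in $\mathbf{x}=(x_1,x_2,\ldots)$, $$G_\sigma \;=\; \sum_{\mu\supseteq \sigma} (-1)^{|B(\mu/\sigma)|}\, a_{\sigma,\mu}\, s_\mu ,$$ where the sum is over all skew Young diagrams $\mu\supseteq\sigma$ (in the sense of the containment convention below), $s_\mu$ is the skew Schur function of $\mu$, and $a_{\sigma,\mu}$ is the nonnegative integer equal to the product of (1) the number of row-weakly-bounded semistandard tableaux of shape $A(\mu/\sigma)$, and (2) the number of row-bounded, reverse row-strict tableaux of shape $B(\mu/\sigma)$.
   Context: Boxes are pairs $(i,j)$ of positive integers, $i$ the row index (increasing downward) and $j$ the column index (increasing to the right); $(i,j)\preceq(i',j')$ iff $i\le i'$ and $j\le j'$. A skew Young diagram (skew shape) is a finite set $\sigma$ of boxes closed under intervals: if $a,c\in\sigma$ and $a\preceq b\preceq c$ then $b\in\sigma$. It is connected if its Hasse diagram under $\preceq$ is connected. $|\sigma|$ is its number of boxes. Rows are numbered so that the top row of $\sigma$ is row $1$. Containment convention: for skew shapes $\mu,\sigma$, $\mu\supseteq\sigma$ means every box of $\sigma$ is in $\mu$ and every box of $\mu$ lies in the same column as some box of $\sigma$. For connected $\sigma$, $\mu\setminus\sigma$ then splits into $A(\mu/\sigma)$, the boxes of $\mu\setminus\sigma$ lying above boxes of $\sigma$ in their column, and $B(\mu/\sigma)$, those lying below; both are skew shapes. A tableau of shape $\mu$ assigns a positive integer $T(i,j)$ to each box. It is semistandard if rows weakly increase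 left to right and columns strictly increase top to bottom. It is reverse row-strict if rows strictly decrease left to right and columns weakly decrease top to bottom. It is row-bounded if $T(i,j)<i$ for every box $(i,j)$, and row-weakly-bounded if $T(i,j)\le i$ for every box. A set-valued tableau assigns a nonempty finite set of positive integers to each box; for sets write $S\le T$ if $\max S\le\min T$ and $S<T$ if $\max S<\min T$; it is semistandard if rows weakly increase and columns strictly increase in this sense. The content $c(T)=(c_1,c_2,\dots)$ has $c_i$ = number of occurrences of label $i$, and $|T|=\sum c_i$; $\mathbf{x}^{c}=\prod x_i^{c_i}$. Skew Schur function: $s_\mu=\sum_T \mathbf{x}^{c(T)}$ over semistandard (ordinary) tableaux $T$ of shape $\mu$. Skew stable Grothendieck polynomial: $G_\sigma=\sum_T(-1)^{|T|-|\sigma|}\mathbf{x}^{c(T)}$ over semistandard set-valued tableaux $T$ of shape $\sigma$. -}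

module Defs where

open import Data.Nat using (ℕ; zero; suc; _+_; _*_; _∸_; _≤_; _<_; _⊔_; _⊓_; _≤ᵇ_; _<ᵇ_; _≡ᵇ_)
open import Data.Bool using (Bool; true; false; _∧_; _∨_; not)
open import Data.List using (List; []; _∷_; [_]; length; map; foldr; concat; concatMap; applyUpTo; zip; _++_; filterᵇ)
open import Data.Bool.ListAction using (all; any)
open import Data.Nat.ListAction using (sum)
open import Data.Product using (_×_; _,_; proj₁; proj₂; ∃-syntax)
open import Data.Sum using (_⊎_)
open import Data.Integer using (ℤ; +_; -1ℤ) renaming (_+_ to _+ℤ_; _*_ to _*ℤ_; _^_ to _^ℤ_)
open import Data.List.Membership.Propositional using (_∈_)
open import Data.List.Relation.Unary.Linked using (Linked)
open import Relation.Binary.PropositionalEquality using (_≡_; _≢_)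

-- Boxes (i , j) : i = row (increasing downward), j = column.

Box : Set
Box = ℕ × ℕ

row : Box → ℕ
row = proj₁

col : Box → ℕ
col = proj₂

_≼_ : Box → Box → Set
a ≼ b = (row a ≤ row b) × (col a ≤ col b)

-- strict lexicographic order, used only to give every finite set of
-- boxes a unique (sorted, duplicate-free) list representation
_<ᴸ_ : Box → Box → Set
a <ᴸ b = (row a < row b) ⊎ ((row a ≡ row b) × (col a < col b))

-- A finite set of boxes is represented canonically by the strictly
-- lexicographically increasing list of its elements.
Shape : Set
Shape = List Box

IsSkewShape : Shape → Set
IsSkewShape μ =
  Linked _<ᴸ_ μ ×
  (∀ b → b ∈ μ → (1 ≤ row b) × (1 ≤ col b)) ×
  (∀ a b c → a ∈ μ → c ∈ μ → a ≼ b → b ≼ c → b ∈ μ)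

Covers : Shape → Box → Box → Set
Covers σ a b =
  a ∈ σ × b ∈ σ × a ≼ b × a ≢ b ×
  (∀ c → c ∈ σ → a ≼ c → c ≼ b → (c ≡ a) ⊎ (c ≡ b))

data HassePath (σ : Shape) : Box → Box → Set where
  here : ∀ {a} → HassePath σ a a
  up   : ∀ {a b c} → Covers σ a b → HassePath σ b c → HassePath σ a c
  down : ∀ {a b c} → Covers σ b a → HassePath σ b c → HassePath σ a c

Connected : Shape → Set
Connected σ = ∀ a b → a ∈ σ → b ∈ σ → HassePath σ a b

-- the topmost row of σ is row 1 (σ has a box in row 1; all boxes have
-- row ≥ 1 already by IsSkewShape)
TopRowIsOne : Shape → Set
TopRowIsOne σ = ∃[ b ] (b ∈ σ × row b ≡ 1)

_⊇ˢ_ : Shape → Shape → Set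
μ ⊇ˢ σ = (∀ b → b ∈ σ → b ∈ μ) × (∀ b → b ∈ μ → ∃[ b' ] (b' ∈ σ × col b' ≡ col b))

_⇒ᵇ_ : Bool → Bool → Bool
p ⇒ᵇ q = not p ∨ q

_==ᴮ_ : Box → Box → Bool
a ==ᴮ b = (row a ≡ᵇ row b) ∧ (col a ≡ᵇ col b)

elemᴮ : Box → List Box → Bool
elemᴮ b bs = any (λ b' → b ==ᴮ b') bs

Apart : Shape → Shape → Shape
Apart μ σ = filterᵇ (λ b → not (elemᴮ b σ) ∧
                           any (λ b' → (col b' ≡ᵇ col b) ∧ (row b <ᵇ row b')) σ) μ

Bpart : Shape → Shape → Shape
Bpart μ σ = filterᵇ (λ b → not (elemᴮ b σ) ∧
                           any (λ b' → (col b' ≡ᵇ col b) ∧ (row b' <ᵇ row b)) σ) μ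

allPairs : {A : Set} → (A → A → Bool) → List A → Bool
allPairs p xs = all (λ x → all (λ y → p x y) xs) xs

sameRowLeft : Box → Box → Bool
sameRowLeft a b = (row a ≡ᵇ row b) ∧ (col a <ᵇ col b)

sameColAbove : Box → Box → Bool
sameColAbove a b = (col a ≡ᵇ col b) ∧ (row a <ᵇ row b)

-- A tableau of shape μ is given by the list of its entries, listed in the
-- order of the boxes of μ; zip μ T is the list of (box , entry) pairs.

isSSYT : List (Box × ℕ) → Bool
isSSYT = allPairs (λ { (a , u) (b , v) →
  (sameRowLeft a b ⇒ᵇ (u ≤ᵇ v)) ∧ (sameColAbove a b ⇒ᵇ (u <ᵇ v)) })

isReverseRowStrict : List (Box × ℕ) → Bool
isReverseRowStrict = allPairs (λ { (a , u) (b , v) →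
  (sameRowLeft a b ⇒ᵇ (v <ᵇ u)) ∧ (sameColAbove a b ⇒ᵇ (v ≤ᵇ u)) })

isRowBounded : List (Box × ℕ) → Bool
isRowBounded = all (λ { (a , u) → u <ᵇ row a })

isRowWeaklyBounded : List (Box × ℕ) → Bool
isRowWeaklyBounded = all (λ { (a , u) → u ≤ᵇ row a })

range1 : ℕ → List ℕ
range1 m = applyUpTo suc m

fillingsFrom : {V : Set} → List V → List Box → List (List V)
fillingsFrom vs []       = [ [] ]
fillingsFrom vs (_ ∷ bs) = concatMap (λ v → map (v ∷_) (fillingsFrom vs bs)) vs

maxRow : Shape → ℕ
maxRow = foldr (λ b m → row b ⊔ m) 0

-- Any row-(weakly-)bounded tableau of shape λ has entries in [1 .. maxRow λ].

#rwbSSYT : Shape → ℕ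
#rwbSSYT λs = length (filterᵇ (λ T → isSSYT (zip λs T) ∧ isRowWeaklyBounded (zip λs T))
                              (fillingsFrom (range1 (maxRow λs)) λs))

#rbRRS : Shape → ℕ
#rbRRS λs = length (filterᵇ (λ T → isReverseRowStrict (zip λs T) ∧ isRowBounded (zip λs T))
                            (fillingsFrom (range1 (maxRow λs)) λs))

aCoef : Shape → Shape → ℕ
aCoef σ μ = #rwbSSYT (Apart μ σ) * #rbRRS (Bpart μ σ)

-- Monomials and coefficients.
-- A content vector c = (c₁ , … , cₙ) (followed by zeros) is a List ℕ;
-- the monomial x^c = x₁^c₁ ⋯ xₙ^cₙ.

occurrences : ℕ → List ℕ → ℕ
occurrences k es = length (filterᵇ (λ e → k ≡ᵇ e) es)

-- the multiset of labels es has content exactly c (labels are assumed ≤ length c)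
hasContentFrom : ℕ → List ℕ → List ℕ → Bool
hasContentFrom k []       es = true
hasContentFrom k (c ∷ cs) es = (occurrences k es ≡ᵇ c) ∧ hasContentFrom (suc k) cs es

hasContent : List ℕ → List ℕ → Bool
hasContent c es = hasContentFrom 1 c es

-- coefficient of x^c in s_μ : number of SSYT of shape μ with content c
-- (such tableaux have entries in [1 .. length c])
schurCoeff : Shape → List ℕ → ℕ
schurCoeff μ c = length (filterᵇ (λ T → isSSYT (zip μ T) ∧ hasContent c T)
                                 (fillingsFrom (range1 (length c)) μ))

-- all subsets of a list, each as a sublist (so subsets of [1..n] are
-- represented uniquely as increasing lists)
sublists : List ℕ → List (List ℕ)
sublists []       = [ [] ]
sublists (x ∷ xs) = map (x ∷_) (sublists xs) ++ sublists xs

nonempty : List ℕ → Bool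
nonempty [] = false
nonempty (_ ∷ _) = true

nonemptySubsets : ℕ → List (List ℕ)
nonemptySubsets n = filterᵇ nonempty (sublists (range1 n))

maxL : List ℕ → ℕ
maxL = foldr _⊔_ 0

minL : List ℕ → ℕ
minL []       = 0
minL (x ∷ xs) = foldr _⊓_ x xs

-- semistandard set-valued tableau (all sets nonempty by construction)
isSetValuedSSYT : List (Box × List ℕ) → Bool
isSetValuedSSYT = allPairs (λ { (a , S) (b , U) →
  (sameRowLeft a b ⇒ᵇ (maxL S ≤ᵇ minL U)) ∧ (sameColAbove a b ⇒ᵇ (maxL S <ᵇ minL U)) })

sumℤ : List ℤ → ℤ
sumℤ = foldr _+ℤ_ (+ 0)

sign : ℕ → ℤ
sign k = -1ℤ ^ℤ k

sizeSV : List (List ℕ) → ℕ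
sizeSV T = sum (map length T)

grothCoeff : Shape → List ℕ → ℤ
grothCoeff σ c =
  sumℤ (map (λ T → sign (sizeSV T ∸ length σ))
            (filterᵇ (λ T → isSetValuedSSYT (zip σ T) ∧ hasContent c (concat T))
                     (fillingsFrom (nonemptySubsets (length c)) σ)))

rhsCoeff : Shape → List Shape → List ℕ → ℤ
rhsCoeff σ Ms c =
  sumℤ (map (λ μ → sign (length (Bpart μ σ)) *ℤ (+ (aCoef σ μ * schurCoeff μ c))) Ms)

module Submission where

-- A skew shape is encoded by the vectors q and p of its right and left row ends. Removing the largest
-- label x turns every generating function into a product of transfer matrices on such vectors: a
-- horizontal strip H for semistandard tableaux, and for set-valued ones a variant G in which each corner
-- of the remaining shape may carry x as well, which contributes a factor 1 - x. The reverse row-strict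
-- tableaux give C = V_k ... V_1, where V_k adds a signed vertical strip in the rows after the first k, and
-- the row-weakly-bounded semistandard tableaux give E = H_0 ... H_(k-1), where H_k adds a horizontal strip
-- in those rows. Let G_k allow the factor 1 - x in the first k rows only. Then G_k V_k = V_k G_(k-1)
-- is a product of one identity for each row, so G C = C H. Moreover C E = Z, the zeta matrix of containment,
-- because V_k is inverse to H_k. Hence C H ... H E = G ... G Z. Finally, multiplying by Z sums over all
-- inner boundaries inside p; the sum telescopes in each row and replaces G by the weight that counts only
-- the corners of the skew shape itself.

open import Defs
open import Data.Nat
  using (ℕ; _≤_; zero; suc; _+_; _*_; _∸_; _<_; _⊔_; _⊓_; _≤ᵇ_; _<ᵇ_; _≡ᵇ_; z≤n; s≤s; pred; >-nonZero)
open import Data.List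
  using (List; length; []; _∷_; map; foldr; concat; concatMap; upTo; zip; _++_; filterᵇ;
    cartesianProductWith; reverse; cartesianProduct)
open import Data.Nat.ListAction using (sum)
open import Data.List.Membership.Propositional using (_∈_; find; lose)
open import Data.List.Relation.Unary.Unique.Propositional using (Unique)
open import Data.Product using (_×_; _,_; proj₁; proj₂; ∃-syntax)
open import Function.Bundles using (_⇔_; module Equivalence)
open import Relation.Binary.PropositionalEquality
  using (_≡_; _≢_; refl; sym; trans; cong; cong₂; subst; subst₂)
open import Data.Nat.Properties
  using (≤ᵇ⇒≤; ≤⇒≤ᵇ; <ᵇ⇒<; <⇒<ᵇ; ≡ᵇ⇒≡; ≡⇒≡ᵇ; ≤-refl; ≤-trans; ≤-reflexive; ≤-antisym; <⇒≤; ≤-pred; n<1+n;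
    n≤1+n; m≤n⇒m<n∨m≡n; <-≤-trans; ≤-<-trans; <-cmp; ≤-<-connex; n∸n≡0; +-identityʳ; +-suc; +-comm;
    +-∸-assoc; _≟_; m≤m+n; m∸n+n≡m; m≤n+m∸n; m≤n⇒m∸n≡0; m+n∸m≡n; +-monoʳ-<; +-cancelˡ-≡; +-cancelˡ-<;
    +-cancelˡ-≤; *-zeroʳ; *-identityʳ; *-comm; n≤0⇒n≡0; m+[n∸m]≡n; n≮n; <-asym; suc-injective; +-assoc;
    ≤-total; m≤n⇒m⊓n≡m; m≥n⇒m⊓n≡n; m≤n⇒m⊔n≡n; m≥n⇒m⊔n≡m; ⊔-lub; m≤m⊔n; m≤n⊔m; ⊓-glb; m⊓n≤m; m⊓n≤n;
    m+n≤o⇒m≤o∸n; m≤n+m; ⊔-identityʳ; m≤n+o⇒m∸n≤o; <-trans; +-monoʳ-≤; <-≤-connex; ⊓-sel; ⊔-sel; +-mono-≤;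
    suc-pred)
open import Data.Bool using (Bool; true; false; _∧_; _∨_; not; T; if_then_else_)
open import Data.List.Properties
  using (map-++; applyUpTo-∷ʳ; ++-assoc; length-map; length-++; unfold-reverse; length-reverse; foldr-++;
    reverse-involutive)
open import Data.Sum as Sum using (_⊎_; inj₁; inj₂)
open import Data.Empty using (⊥; ⊥-elim)
open import Data.Unit using (tt)
open import Data.Integer using (ℤ; +_; -1ℤ; 0ℤ; 1ℤ) renaming (_+_ to _+ℤ_; _*_ to _*ℤ_; _^_ to _^ℤ_)
open import Data.Integer.Tactic.RingSolver using (solve-∀)
open import Data.List.Relation.Unary.Any using (here; there)
open import Data.List.Relation.Unary.All as All using (All; []; _∷_)
open import Data.List.Relation.Unary.AllPairs using ([]; _∷_)
open import Function using (_∘_)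
open import Relation.Nullary using (¬_; yes; no; does)
open import Data.Bool.Properties using (T-∧; T-∨; T?; ∧-zeroʳ; ∧-identityʳ; ∧-assoc)
open import Relation.Binary.Definitions using (Tri; tri<; tri≈; tri>; DecidableEquality)
open import Data.Vec using (Vec; []; _∷_)
open import Data.List.Membership.Propositional.Properties
  using (∈-applyUpTo⁻; ∈-cartesianProductWith⁺; ∈-cartesianProductWith⁻; ∈-upTo⁺; ∈-upTo⁻; ∈-++⁻; ∈-++⁺ˡ;
    ∈-++⁺ʳ; ∈-map⁻; ∈-map⁺; ∈-filter⁻; ∈-concat⁻′; ∈-filter⁺; ∈-cartesianProduct⁺)
open import Data.List.Relation.Binary.Permutation.Propositional as Perm
  using (_↭_; ↭-sym; ↭-prep; ↭-refl; ↭-trans)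
open import Data.Bool.ListAction using (all; any)
open import Data.List.Relation.Unary.All.Properties using () renaming (all⁺ to T-all⁻; all⁻ to T-all⁺)
open import Data.Bool.Solver using (module ∨-∧-Solver)
open import Data.List.Relation.Unary.Linked.Properties using (AllPairs⇒Linked; Linked⇒AllPairs)
open import Data.List.Relation.Unary.Any.Properties using (any⁺; any⁻)
open import Data.Nat.ListAction.Properties using (sum-↭)
import Data.Integer.Properties as ℤₚ
import Data.List.Relation.Unary.Unique.Propositional.Properties as Uniqueₚ
import Data.List.Relation.Binary.Permutation.Propositional.Properties as Permₚ
import Data.List.Relation.Unary.AllPairs as AllPairs
import Data.List.Relation.Unary.AllPairs.Properties as AllPairsₚ
import Data.List.Properties as Listₚ
import Data.Product.Properties as Productₚ
open AllPairs using (AllPairs)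

-- The relation between `G` and `V` rests on a factor `1 - x` that moves down one row at a time.
-- After a signed vertical strip a row ends at `q` or, with the opposite sign and one more box
-- labelled `x`, at `q + 1`; the two choices combine to the factor of the row above. On the other
-- side the row end `r` comes from `r` or, with opposite sign and one more `x`, from `r - 1`; this
-- gives the factor of the row itself. So the relation closes by induction on rows, except at the
-- bottom, because a vector of length `n` has no row `n + 1` to receive boxes. Therefore `n` exceeds
-- the number of rows of the shape plus the number of variables, and every intermediate shape that
-- contributes has an empty last row.
--
-- The matrices are indexed by all vectors with bounded entries rather than by partitions, so that
-- sums factor over rows. Monotonicity and similar side conditions come back through alternatives of
-- the form "the entry is `0ℤ` or the condition holds".
--
-- Empty rows could make the vectors of a shape ambiguous. Connectedness removes this: every column
-- in range meets the given shape, and this determines both vectors of any shape around it.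

private
  variable
    A B D : Set

-- Finite sums of integers and Boolean indicators.

infixl 6 _⊕_
infixl 7 _·_

-- Opaque copies of the ring operations of ℤ: with neutral arguments the originals unfold,
-- which blocks the inference of implicit arguments.
opaque
  _⊕_ _·_ : ℤ → ℤ → ℤ
  _⊕_ = _+ℤ_
  _·_ = _*ℤ_

opaque
  unfolding _⊕_ _·_

  ⊕-comm : ∀ x y → x ⊕ y ≡ y ⊕ x
  ⊕-comm = ℤₚ.+-comm

  ⊕-assoc : ∀ x y z → (x ⊕ y) ⊕ z ≡ x ⊕ (y ⊕ z)
  ⊕-assoc = ℤₚ.+-assoc

  ⊕-identityˡ : ∀ x → 0ℤ ⊕ x ≡ x
  ⊕-identityˡ = ℤₚ.+-identityˡ

  ⊕-identityʳ : ∀ x → x ⊕ 0ℤ ≡ x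
  ⊕-identityʳ = ℤₚ.+-identityʳ

  ·-comm : ∀ x y → x · y ≡ y · x
  ·-comm = ℤₚ.*-comm

  ·-assoc : ∀ x y z → (x · y) · z ≡ x · (y · z)
  ·-assoc = ℤₚ.*-assoc

  ·-identityˡ : ∀ x → 1ℤ · x ≡ x
  ·-identityˡ = ℤₚ.*-identityˡ

  ·-identityʳ : ∀ x → x · 1ℤ ≡ x
  ·-identityʳ = ℤₚ.*-identityʳ

  ·-zeroˡ : ∀ x → 0ℤ · x ≡ 0ℤ
  ·-zeroˡ = ℤₚ.*-zeroˡ

  ·-zeroʳ : ∀ x → x · 0ℤ ≡ 0ℤ
  ·-zeroʳ = ℤₚ.*-zeroʳ

  ·-distribˡ : ∀ x y z → x · (y ⊕ z) ≡ x · y ⊕ x · z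
  ·-distribˡ = ℤₚ.*-distribˡ-+

  ·-distribʳ : ∀ x y z → (y ⊕ z) · x ≡ y · x ⊕ z · x
  ·-distribʳ = ℤₚ.*-distribʳ-+

  ⊕-inverseʳ : ∀ x → x ⊕ -1ℤ · x ≡ 0ℤ
  ⊕-inverseʳ = inverse
    where
    inverse : ∀ x → x +ℤ -1ℤ *ℤ x ≡ 0ℤ
    inverse = solve-∀

  ⊕-interchange : ∀ a b c d → (a ⊕ b) ⊕ (c ⊕ d) ≡ (a ⊕ c) ⊕ (b ⊕ d)
  ⊕-interchange = interchange
    where
    interchange : ∀ a b c d → (a +ℤ b) +ℤ (c +ℤ d) ≡ (a +ℤ c) +ℤ (b +ℤ d)
    interchange = solve-∀

·-swap : ∀ x y z → x · (y · z) ≡ y · (x · z)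
·-swap x y z = trans (sym (·-assoc x y z)) (trans (cong (_· z) (·-comm x y)) (·-assoc y x z))

opaque
  ∑ : List A → (A → ℤ) → ℤ
  ∑ xs f = sumℤ (map f xs)

opaque
  unfolding ∑ _⊕_

  ∑-def : ∀ (xs : List A) f → ∑ xs f ≡ sumℤ (map f xs)
  ∑-def xs f = refl

  ∑-[] : ∀ (f : A → ℤ) → ∑ [] f ≡ 0ℤ
  ∑-[] f = refl

  ∑-∷ : ∀ (x : A) xs f → ∑ (x ∷ xs) f ≡ f x ⊕ ∑ xs f
  ∑-∷ x xs f = refl

  ∑-[_] : ∀ (x : A) f → ∑ (x ∷ []) f ≡ f x
  ∑-[_] x f = ⊕-identityʳ (f x)

  ∑-cong∈ : ∀ (xs : List A) {f g : A → ℤ} → (∀ x → x ∈ xs → f x ≡ g x) → ∑ xs f ≡ ∑ xs g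
  ∑-cong∈ []       h = refl
  ∑-cong∈ (x ∷ xs) h = cong₂ _⊕_ (h x (here refl)) (∑-cong∈ xs (λ y y∈ → h y (there y∈)))

  ∑-cong : ∀ (xs : List A) {f g : A → ℤ} → (∀ x → f x ≡ g x) → ∑ xs f ≡ ∑ xs g
  ∑-cong xs h = ∑-cong∈ xs (λ x _ → h x)

  ∑-0 : ∀ (xs : List A) → ∑ xs (λ _ → 0ℤ) ≡ 0ℤ
  ∑-0 []       = refl
  ∑-0 (x ∷ xs) = trans (⊕-identityˡ _) (∑-0 xs)

  ∑-zero : ∀ (xs : List A) {f : A → ℤ} → (∀ x → x ∈ xs → f x ≡ 0ℤ) → ∑ xs f ≡ 0ℤ
  ∑-zero xs h = trans (∑-cong∈ xs h) (∑-0 xs)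

  ∑-++ : ∀ (xs ys : List A) (f : A → ℤ) → ∑ (xs ++ ys) f ≡ ∑ xs f ⊕ ∑ ys f
  ∑-++ []       ys f = sym (⊕-identityˡ _)
  ∑-++ (x ∷ xs) ys f = trans (cong (f x ⊕_) (∑-++ xs ys f)) (sym (⊕-assoc (f x) _ _))

  ∑-map : ∀ (xs : List A) (h : A → B) (f : B → ℤ) → ∑ (map h xs) f ≡ ∑ xs (f ∘ h)
  ∑-map []       h f = refl
  ∑-map (x ∷ xs) h f = cong (f (h x) ⊕_) (∑-map xs h f)

  ∑-concatMap : ∀ (xs : List A) (h : A → List B) (f : B → ℤ) →
                ∑ (concatMap h xs) f ≡ ∑ xs (λ x → ∑ (h x) f)
  ∑-concatMap []       h f = refl
  ∑-concatMap (x ∷ xs) h f =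
    trans (∑-++ (h x) (concatMap h xs) f) (cong (∑ (h x) f ⊕_) (∑-concatMap xs h f))

  ∑-+ : ∀ (xs : List A) (f g : A → ℤ) → ∑ xs (λ x → f x ⊕ g x) ≡ ∑ xs f ⊕ ∑ xs g
  ∑-+ []       f g = refl
  ∑-+ (x ∷ xs) f g =
    trans (cong ((f x ⊕ g x) ⊕_) (∑-+ xs f g)) (⊕-interchange (f x) (g x) (∑ xs f) (∑ xs g))

  ∑-*ˡ : ∀ (xs : List A) k (f : A → ℤ) → ∑ xs (λ x → k · f x) ≡ k · ∑ xs f
  ∑-*ˡ []       k f = sym (·-zeroʳ k)
  ∑-*ˡ (x ∷ xs) k f =
    trans (cong (k · f x ⊕_) (∑-*ˡ xs k f)) (sym (·-distribˡ k (f x) (∑ xs f)))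

  ∑-*ʳ : ∀ (xs : List A) k (f : A → ℤ) → ∑ xs (λ x → f x · k) ≡ ∑ xs f · k
  ∑-*ʳ xs k f = trans (∑-cong xs (λ x → ·-comm (f x) k))
                      (trans (∑-*ˡ xs k f) (·-comm k _))

  ∑-swap : ∀ (xs : List A) (ys : List B) (f : A → B → ℤ) →
           ∑ xs (λ x → ∑ ys (f x)) ≡ ∑ ys (λ y → ∑ xs (λ x → f x y))
  ∑-swap []       ys f = sym (∑-0 ys)
  ∑-swap (x ∷ xs) ys f =
    trans (cong (∑ ys (f x) ⊕_) (∑-swap xs ys f)) (sym (∑-+ ys (f x) _))

  ∑-single : ∀ {xs : List A} {a : A} (h : A → ℤ) → Unique xs → a ∈ xs →
             (∀ x → x ∈ xs → x ≢ a → h x ≡ 0ℤ) → ∑ xs h ≡ h a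
  ∑-single {xs = x ∷ xs} h (x≢ ∷ u) (here refl) z =
    trans (cong (h x ⊕_) (∑-zero xs (λ y y∈ → z y (there y∈) (λ y≡x → All.lookup x≢ y∈ (sym y≡x)))))
          (⊕-identityʳ _)
  ∑-single {xs = x ∷ xs} h (x≢ ∷ u) (there a∈) z =
    trans (cong₂ _⊕_ (z x (here refl) (All.lookup x≢ a∈)) (∑-single h u a∈ (λ y y∈ → z y (there y∈))))
          (⊕-identityˡ _)

⟦_⟧ : Bool → ℤ
⟦ true ⟧  = 1ℤ
⟦ false ⟧ = 0ℤ

⟦∧⟧ : ∀ a b → ⟦ a ∧ b ⟧ ≡ ⟦ a ⟧ · ⟦ b ⟧
⟦∧⟧ true  b = sym (·-identityˡ _)
⟦∧⟧ false b = sym (·-zeroˡ _)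

opaque
  unfolding ∑ _⊕_ _·_

  ∑-filter : ∀ (p : A → Bool) (xs : List A) (f : A → ℤ) →
             ∑ (filterᵇ p xs) f ≡ ∑ xs (λ x → ⟦ p x ⟧ · f x)
  ∑-filter p []       f = refl
  ∑-filter p (x ∷ xs) f with p x
  ... | true  = cong₂ _⊕_ (sym (·-identityˡ (f x))) (∑-filter p xs f)
  ... | false = trans (∑-filter p xs f) (sym (⊕-identityˡ _))

  length-filter : ∀ (p : A → Bool) (xs : List A) → + length (filterᵇ p xs) ≡ ∑ xs (λ x → ⟦ p x ⟧)
  length-filter p []       = refl
  length-filter p (x ∷ xs) with p x
  ... | true  = cong (1ℤ ⊕_) (length-filter p xs)
  ... | false = trans (length-filter p xs) (sym (⊕-identityˡ _))

T⇒≡ : ∀ {b} → T b → b ≡ true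
T⇒≡ {true} _ = refl

≡⇒T : ∀ {b} → b ≡ true → T b
≡⇒T refl = tt

¬T⇒≡ : ∀ {b} → ¬ T b → b ≡ false
¬T⇒≡ {true}  h = ⊥-elim (h tt)
¬T⇒≡ {false} _ = refl

T⇔⇒≡ : ∀ {a b} → (T a → T b) → (T b → T a) → a ≡ b
T⇔⇒≡ {true}  {true}  f g = refl
T⇔⇒≡ {true}  {false} f g = ⊥-elim (f tt)
T⇔⇒≡ {false} {true}  f g = ⊥-elim (g tt)
T⇔⇒≡ {false} {false} f g = refl

⟦T⟧ : ∀ {b} → T b → ⟦ b ⟧ ≡ 1ℤ
⟦T⟧ t = cong ⟦_⟧ (T⇒≡ t)

⟦¬T⟧ : ∀ {b} → ¬ T b → ⟦ b ⟧ ≡ 0ℤ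
⟦¬T⟧ t = cong ⟦_⟧ (¬T⇒≡ t)

⟦⟧-cond : ∀ b {x y} → (T b → x ≡ y) → ⟦ b ⟧ · x ≡ ⟦ b ⟧ · y
⟦⟧-cond true  h = cong (1ℤ ·_) (h tt)
⟦⟧-cond false h = trans (·-zeroˡ _) (sym (·-zeroˡ _))

⟦true⟧· : ∀ {b} x → b ≡ true → ⟦ b ⟧ · x ≡ x
⟦true⟧· x refl = ·-identityˡ x

⟦false⟧· : ∀ {b} x → b ≡ false → ⟦ b ⟧ · x ≡ 0ℤ
⟦false⟧· x refl = ·-zeroˡ x

·-lin : ∀ k x y → k · (x ⊕ -1ℤ · y) ≡ k · x ⊕ -1ℤ · (k · y)
·-lin k x y = trans (·-distribˡ k x (-1ℤ · y)) (cong (k · x ⊕_) (·-swap k -1ℤ y))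

·-linʳ : ∀ x y z → (x ⊕ -1ℤ · y) · z ≡ x · z ⊕ -1ℤ · (y · z)
·-linʳ x y z = trans (·-distribʳ z x (-1ℤ · y)) (cong (x · z ⊕_) (·-assoc -1ℤ y z))

x⊕-0 : ∀ x {y} → y ≡ 0ℤ → x ⊕ -1ℤ · y ≡ x
x⊕-0 x refl = trans (cong (x ⊕_) (·-zeroʳ -1ℤ)) (⊕-identityʳ x)

0⊕- : ∀ {x} y → x ≡ 0ℤ → x ⊕ -1ℤ · y ≡ -1ℤ · y
0⊕- y refl = ⊕-identityˡ _

opaque
  unfolding _·_

  ·-interchange : ∀ a b c d → (a · b) · (c · d) ≡ (a · c) · (b · d)
  ·-interchange = interchange
    where
    interchange : ∀ a b c d → (a *ℤ b) *ℤ (c *ℤ d) ≡ (a *ℤ c) *ℤ (b *ℤ d)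
    interchange = solve-∀

open Equivalence using (to; from)

∧-intro : ∀ {a b} → T a → T b → T (a ∧ b)
∧-intro x y = from T-∧ (x , y)

∧-left : ∀ {a b} → T (a ∧ b) → T a
∧-left h = proj₁ (to T-∧ h)

∧-right : ∀ {a b} → T (a ∧ b) → T b
∧-right h = proj₂ (to T-∧ h)

≤ᵇ-true : ∀ {a b} → a ≤ b → (a ≤ᵇ b) ≡ true
≤ᵇ-true h = T⇒≡ (≤⇒≤ᵇ h)

≤ᵇ-false : ∀ {a b} → b < a → (a ≤ᵇ b) ≡ false
≤ᵇ-false {a} {b} h = ¬T⇒≡ (λ t → n≮n b (<-≤-trans h (≤ᵇ⇒≤ a b t)))

<ᵇ-true : ∀ {a b} → a < b → (a <ᵇ b) ≡ true
<ᵇ-true h = T⇒≡ (<⇒<ᵇ h)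

<ᵇ-false : ∀ {a b} → b ≤ a → (a <ᵇ b) ≡ false
<ᵇ-false {a} {b} h = ¬T⇒≡ (λ t → n≮n a (<-≤-trans (<ᵇ⇒< a b t) h))

≡ᵇ-refl : ∀ a → (a ≡ᵇ a) ≡ true
≡ᵇ-refl a = T⇒≡ (≡⇒≡ᵇ a a refl)

≡ᵇ-false : ∀ {a b} → a ≢ b → (a ≡ᵇ b) ≡ false
≡ᵇ-false {a} {b} h = ¬T⇒≡ (λ t → h (≡ᵇ⇒≡ a b t))

-- Bounded vectors, the index set of the matrices.

vals : ℕ → List ℕ
vals m = upTo (suc m)

vals-unique : ∀ m → Unique (vals m)
vals-unique m = Uniqueₚ.upTo⁺ (suc m)

∈-vals⁺ : ∀ {m v} → v ≤ m → v ∈ vals m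
∈-vals⁺ h = ∈-upTo⁺ (s≤s h)

∈-vals⁻ : ∀ {m v} → v ∈ vals m → v ≤ m
∈-vals⁻ h = ≤-pred (∈-upTo⁻ h)

vecs : ℕ → (n : ℕ) → List (Vec ℕ n)
vecs m zero    = [] ∷ []
vecs m (suc n) = cartesianProductWith _∷_ (vals m) (vecs m n)

∷-inj : ∀ {n} {x y : ℕ} {xs ys : Vec ℕ n} → _≡_ {A = Vec ℕ (suc n)} (x ∷ xs) (y ∷ ys) → x ≡ y × xs ≡ ys
∷-inj refl = refl , refl

vecs-unique : ∀ m n → Unique (vecs m n)
vecs-unique m zero    = [] ∷ []
vecs-unique m (suc n) = Uniqueₚ.cartesianProductWith⁺ _∷_ ∷-inj (vals-unique m) (vecs-unique m n)

∈-vecs⁺ : ∀ {m n v} {vs : Vec ℕ n} → v ≤ m → vs ∈ vecs m n → (v ∷ vs) ∈ vecs m (suc n)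
∈-vecs⁺ v≤ vs∈ = ∈-cartesianProductWith⁺ _∷_ (∈-vals⁺ v≤) vs∈

∈-vecs⁻ : ∀ {m n v} {vs : Vec ℕ n} → (v ∷ vs) ∈ vecs m (suc n) → v ≤ m × vs ∈ vecs m n
∈-vecs⁻ {m} {n} h with ∈-cartesianProductWith⁻ _∷_ (vals m) (vecs m n) h
... | _ , _ , x∈ , y∈ , refl = ∈-vals⁻ x∈ , y∈

∑-cartesian : ∀ (xs : List A) (ys : List B) (h : A → B → D) (f : D → ℤ) →
              ∑ (cartesianProductWith h xs ys) f ≡ ∑ xs (λ x → ∑ ys (λ y → f (h x y)))
∑-cartesian []       ys h f = trans (∑-[] f) (sym (∑-[] _))
∑-cartesian (x ∷ xs) ys h f =
  trans (∑-++ (map (h x) ys) _ f)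
  (trans (cong₂ _⊕_ (∑-map ys (h x) f) (∑-cartesian xs ys h f)) (sym (∑-∷ x xs _)))

∑-vecs : ∀ m n (f : Vec ℕ (suc n) → ℤ) →
         ∑ (vecs m (suc n)) f ≡ ∑ (vals m) (λ v → ∑ (vecs m n) (λ vs → f (v ∷ vs)))
∑-vecs m n f = ∑-cartesian (vals m) (vecs m n) _∷_ f

∑-δ : ∀ {m a} (f : ℕ → ℤ) → a ≤ m → ∑ (vals m) (λ v → ⟦ v ≡ᵇ a ⟧ · f v) ≡ f a
∑-δ {m} {a} f a≤m =
  trans (∑-single _ (vals-unique m) (∈-vals⁺ a≤m)
          (λ v _ v≢a → ⟦false⟧· (f v) (≡ᵇ-false v≢a)))
        (⟦true⟧· (f a) (≡ᵇ-refl a))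

≡ᵇ-sym : ∀ a b → (a ≡ᵇ b) ≡ (b ≡ᵇ a)
≡ᵇ-sym a b = T⇔⇒≡ (λ t → ≡⇒≡ᵇ b a (sym (≡ᵇ⇒≡ a b t))) (λ t → ≡⇒≡ᵇ a b (sym (≡ᵇ⇒≡ b a t)))

∑-δ′ : ∀ {m a} (f : ℕ → ℤ) → a ≤ m → ∑ (vals m) (λ v → ⟦ a ≡ᵇ v ⟧ · f v) ≡ f a
∑-δ′ {m} {a} f a≤m =
  trans (∑-cong (vals m) (λ v → cong (λ b → ⟦ b ⟧ · f v) (≡ᵇ-sym a v))) (∑-δ f a≤m)

∑-δ-out : ∀ {m a} (f : ℕ → ℤ) → m < a → ∑ (vals m) (λ v → ⟦ v ≡ᵇ a ⟧ · f v) ≡ 0ℤ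
∑-δ-out {m} {a} f m<a = ∑-zero (vals m) (λ v v∈ → ⟦false⟧· (f v)
  (≡ᵇ-false (λ v≡a → n≮n m (<-≤-trans m<a (subst (_≤ m) v≡a (∈-vals⁻ v∈))))))

-- The default `0` stands for an empty row below the last one, so that interlacing conditions need
-- no special case at the bottom.
hd0 : ∀ {n} → Vec ℕ n → ℕ
hd0 []      = 0
hd0 (x ∷ _) = x

dec : ∀ {n} → Vec ℕ n → Bool
dec []       = true
dec (x ∷ xs) = (hd0 xs ≤ᵇ x) ∧ dec xs

-- The price of working with finitely many rows: the commutation relation is only available when the
-- last row is empty, since a vertical strip cannot continue into a row below it.
lastZ : ∀ {n} → Vec ℕ n → Bool
lastZ []           = true
lastZ (x ∷ [])     = x ≡ᵇ 0
lastZ (x ∷ y ∷ ys) = lastZ (y ∷ ys)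

lastZ-tail : ∀ {n} x (xs : Vec ℕ n) → T (lastZ (x ∷ xs)) → T (lastZ xs)
lastZ-tail x []       h = tt
lastZ-tail x (y ∷ ys) h = h

-- Signed vertical strips and weights of horizontal strips.

sg : ℕ → ℕ → ℤ
sg a b = ⟦ a ≡ᵇ b ⟧ ⊕ -1ℤ · ⟦ suc a ≡ᵇ b ⟧

-- Signed indicator that q′ / q is a vertical strip in the rows after the first k.
vsgn : ∀ {n} → ℕ → Vec ℕ n → Vec ℕ n → ℤ
vsgn k       []       []         = 1ℤ
vsgn zero    (q ∷ qs) (q′ ∷ qs′) = sg q q′ · vsgn 0 qs qs′
vsgn (suc k) (q ∷ qs) (q′ ∷ qs′) = ⟦ q ≡ᵇ q′ ⟧ · vsgn k qs qs′

-- `vsgn (suc k)` vanishes unless the first entries agree. The row above sees the rows below only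
-- through their first entry, so its weight can be evaluated at either vector.
vsgn-hd : ∀ {n} k (qs qs′ : Vec ℕ n) (φ : ℕ → ℤ) →
          vsgn (suc k) qs qs′ · φ (hd0 qs′) ≡ vsgn (suc k) qs qs′ · φ (hd0 qs)
vsgn-hd k []       []         φ = refl
vsgn-hd k (q ∷ qs) (q′ ∷ qs′) φ with q ≟ q′
... | yes refl = refl
... | no q≢q′ rewrite ≡ᵇ-false q≢q′ =
  trans (cong (_· φ q′) (·-zeroˡ (vsgn k qs qs′)))
        (trans (·-zeroˡ (φ q′))
               (sym (trans (cong (_· φ q) (·-zeroˡ (vsgn k qs qs′))) (·-zeroˡ (φ q)))))

∑-sgˡ-zero : ∀ {m} (f : ℕ → ℤ) → ∑ (vals m) (λ v → sg v 0 · f v) ≡ f 0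
∑-sgˡ-zero {m} f =
  trans (∑-cong (vals m) (λ v → cong (_· f v) (x⊕-0 ⟦ v ≡ᵇ 0 ⟧ refl))) (∑-δ f z≤n)

∑-sg : ∀ {m} (c d : ℕ → Bool) (f : ℕ → ℤ) →
       ∑ (vals m) (λ v → (⟦ c v ⟧ ⊕ -1ℤ · ⟦ d v ⟧) · f v)
       ≡ ∑ (vals m) (λ v → ⟦ c v ⟧ · f v) ⊕ -1ℤ · ∑ (vals m) (λ v → ⟦ d v ⟧ · f v)
∑-sg {m} c d f =
  trans (∑-cong (vals m) (λ v → ·-linʳ ⟦ c v ⟧ ⟦ d v ⟧ (f v)))
  (trans (∑-+ (vals m) _ _) (cong (∑ (vals m) (λ v → ⟦ c v ⟧ · f v) ⊕_) (∑-*ˡ (vals m) -1ℤ _)))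

∑-sgˡ-suc : ∀ {m b} (f : ℕ → ℤ) → suc b ≤ m →
            ∑ (vals m) (λ v → sg v (suc b) · f v) ≡ f (suc b) ⊕ -1ℤ · f b
∑-sgˡ-suc {m} {b} f h =
  trans (∑-sg (_≡ᵇ suc b) (_≡ᵇ b) f)
        (cong₂ (λ x y → x ⊕ -1ℤ · y) (∑-δ f h) (∑-δ f (<⇒≤ h)))

∑-sgʳ : ∀ {m a} (f : ℕ → ℤ) → suc a ≤ m →
        ∑ (vals m) (λ v → sg a v · f v) ≡ f a ⊕ -1ℤ · f (suc a)
∑-sgʳ {m} {a} f h =
  trans (∑-sg (a ≡ᵇ_) (suc a ≡ᵇ_) f)
        (cong₂ (λ x y → x ⊕ -1ℤ · y) (∑-δ′ f (<⇒≤ h)) (∑-δ′ f h))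

-- The end `a + 1` is either outside the summation range or killed by `f`; in both cases only the
-- end `a` survives.
∑-sgʳ-top : ∀ {m a} (f : ℕ → ℤ) → a ≤ m → (suc a ≤ m → f (suc a) ≡ 0ℤ) →
            ∑ (vals m) (λ v → sg a v · f v) ≡ f a
∑-sgʳ-top {m} {a} f a≤m z with ≤-<-connex (suc a) m
... | inj₁ h = trans (∑-sgʳ f h) (x⊕-0 (f a) (z h))
... | inj₂ h =
  trans (∑-sg (a ≡ᵇ_) (suc a ≡ᵇ_) f)
  (trans (x⊕-0 _ (trans (∑-cong (vals m) (λ v → cong (λ b → ⟦ b ⟧ · f v) (≡ᵇ-sym (suc a) v))) (∑-δ-out f h)))
         (∑-δ′ f a≤m))

-- "F is a multiple of x ^ a * (1 - x) ^ b": the only property of these weights that is used.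
Law : (ℕ → ℕ → ℤ) → Set
Law F = ∀ a b → F a (suc b) ≡ F a b ⊕ -1ℤ · F (suc a) b

Law-∑ : ∀ (xs : List A) {F : A → ℕ → ℕ → ℤ} → (∀ x → Law (F x)) → Law (λ a b → ∑ xs (λ x → F x a b))
Law-∑ xs {F} l a b =
  trans (∑-cong xs (λ x → l x a b))
  (trans (∑-+ xs _ _) (cong (∑ xs (λ x → F x a b) ⊕_) (∑-*ˡ xs -1ℤ _)))

Law-· : ∀ k {F} → Law F → Law (λ a b → k · F a b)
Law-· k {F} l a b = trans (cong (k ·_) (l a b)) (·-lin k (F a b) (F (suc a) b))

Law-·ʳ : ∀ k {F} → Law F → Law (λ a b → F a b · k)
Law-·ʳ k {F} l a b =
  trans (·-comm _ k) (trans (Law-· k l a b)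
    (cong₂ (λ x y → x ⊕ -1ℤ · y) (·-comm k _) (·-comm k _)))

-- Here `h` is the end of the next row of the outer shape. The test `h < r` says that the outer
-- shape has no box below the last box of the row `r`; `k = 0` marks a row that is not eligible for
-- the factor.
bump : ℕ → ℕ → ℕ → ℕ → ℕ
bump zero    h r b = b
bump (suc k) h r b = if h <ᵇ r then suc b else b

bump-suc : ∀ k h r b → bump k h r (suc b) ≡ suc (bump k h r b)
bump-suc zero    h r b = refl
bump-suc (suc k) h r b with h <ᵇ r
... | true  = refl
... | false = refl

-- Weight of adding the horizontal strip q / r with one label x: a factor x per box and, in each of
-- the first k rows, a factor 1 - x if the last box of r in that row may also receive the label.
g : (ℕ → ℕ → ℤ) → ∀ {n} → ℕ → Vec ℕ n → Vec ℕ n → ℕ → ℕ → ℤ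
g w k []       []       a b = w a b
g w k (q ∷ qs) (r ∷ rs) a b =
  ⟦ (hd0 qs ≤ᵇ r) ∧ (r ≤ᵇ q) ⟧ · g w (pred k) qs rs (a + (q ∸ r)) (bump k (hd0 qs) r b)

g-law : ∀ {w} → Law w → ∀ {n} k (q r : Vec ℕ n) → Law (g w k q r)
g-law l k []       []       a b = l a b
g-law {w} l k (q ∷ qs) (r ∷ rs) a b =
  trans (cong (λ b′ → c · g w (pred k) qs rs a′ b′) (bump-suc k (hd0 qs) r b))
        (Law-· c (g-law l (pred k) qs rs) a′ (bump k (hd0 qs) r b))
  where
  c = ⟦ (hd0 qs ≤ᵇ r) ∧ (r ≤ᵇ q) ⟧
  a′ = a + (q ∸ r)

dec-hd : ∀ {n} x (xs : Vec ℕ n) → T (dec (x ∷ xs)) → hd0 xs ≤ x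
dec-hd x xs h = ≤ᵇ⇒≤ (hd0 xs) x (∧-left h)

dec-tail : ∀ {n} x (xs : Vec ℕ n) → T (dec (x ∷ xs)) → T (dec xs)
dec-tail x xs h = ∧-right {hd0 xs ≤ᵇ x} h

dec-∷ : ∀ {n} x (xs : Vec ℕ n) → hd0 xs ≤ x → T (dec xs) → T (dec (x ∷ xs))
dec-∷ x xs h d = ∧-intro (≤⇒≤ᵇ h) d

opaque
  unfolding _·_

  ·-shuffle : ∀ i x s y → (i · x) · (s · y) ≡ s · (i · (x · y))
  ·-shuffle = shuffle
    where
    shuffle : ∀ i x s y → (i *ℤ x) *ℤ (s *ℤ y) ≡ s *ℤ (i *ℤ (x *ℤ y))
    shuffle = solve-∀

  ·-shuffle′ : ∀ s y h i x → (s · y) · (h · (i · x)) ≡ s · (h · (y · (i · x)))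
  ·-shuffle′ = shuffle
    where
    shuffle : ∀ s y h i x → (s *ℤ y) *ℤ (h *ℤ (i *ℤ x)) ≡ s *ℤ (h *ℤ (y *ℤ (i *ℤ x)))
    shuffle = solve-∀

∑-·ˡ² : ∀ (xs : List A) k l (f : A → ℤ) → ∑ xs (λ x → k · (l · f x)) ≡ k · (l · ∑ xs f)
∑-·ˡ² xs k l f = trans (∑-*ˡ xs k _) (cong (k ·_) (∑-*ˡ xs l f))

+-suc-∸ : ∀ a {q r} → suc r ≤ q → a + (q ∸ r) ≡ suc (a + (q ∸ suc r))
+-suc-∸ a {suc q} {zero}  h       = +-suc a q
+-suc-∸ a {suc q} {suc r} (s≤s h) = +-suc-∸ a h

+-∸-suc : ∀ a {q r} → r ≤ q → a + (suc q ∸ r) ≡ suc (a + (q ∸ r))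
+-∸-suc a {q} {r} h = trans (cong (λ z → a + z) (+-∸-assoc 1 h)) (+-suc a (q ∸ r))

a+n∸n : ∀ a n → a + (n ∸ n) ≡ a
a+n∸n a n = trans (cong (λ z → a + z) (n∸n≡0 n)) (+-identityʳ a)

-- Commuting a signed vertical strip past a horizontal strip.

module Intertwine (m : ℕ) (w : ℕ → ℕ → ℤ) (w-law : Law w) where

  -- The two sides of the intertwining relation below row k + 1: a signed vertical strip is removed
  -- before (upper), respectively added after (lower), a horizontal strip. The first row of the
  -- lower shape is bounded by s, the row above it.
  upper : ∀ {n} → Vec ℕ n → Vec ℕ n → ℕ → ℕ → ℤ
  upper {n} q r a b = ∑ (vecs m n) (λ r′ → g w 0 q r′ a b · vsgn 0 r′ r)

  lower : ∀ {n} → ℕ → Vec ℕ n → Vec ℕ n → ℕ → ℕ → ℤ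
  lower {n} s q r a b = ∑ (vecs m n) (λ q′ → vsgn 0 q q′ · (⟦ hd0 q′ ≤ᵇ s ⟧ · g w 0 q′ r a b))

  upper-law : ∀ {n} (q r : Vec ℕ n) → Law (upper q r)
  upper-law {n} q r = Law-∑ (vecs m n) {λ r′ a b → g w 0 q r′ a b · vsgn 0 r′ r}
    (λ r′ → Law-·ʳ (vsgn 0 r′ r) (g-law w-law 0 q r′))

  lower-law : ∀ {n} s (q r : Vec ℕ n) → Law (lower s q r)
  lower-law {n} s q r = Law-∑ (vecs m n) {λ q′ a b → vsgn 0 q q′ · (⟦ hd0 q′ ≤ᵇ s ⟧ · g w 0 q′ r a b)}
    (λ q′ → Law-· (vsgn 0 q q′) {λ a b → ⟦ hd0 q′ ≤ᵇ s ⟧ · g w 0 q′ r a b}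
              (Law-· ⟦ hd0 q′ ≤ᵇ s ⟧ {g w 0 q′ r} (g-law w-law 0 q′ r)))

  upperRow : ∀ {n} → ℕ → Vec ℕ n → Vec ℕ n → ℕ → ℕ → ℕ → ℤ
  upperRow q qs rs a b v = ⟦ (hd0 qs ≤ᵇ v) ∧ (v ≤ᵇ q) ⟧ · upper qs rs (a + (q ∸ v)) b

  upper-∷ : ∀ {n} q r (qs rs : Vec ℕ n) a b →
            upper (q ∷ qs) (r ∷ rs) a b ≡ ∑ (vals m) (λ v → sg v r · upperRow q qs rs a b v)
  upper-∷ {n} q r qs rs a b =
    trans (∑-vecs m n _) (∑-cong (vals m) λ v →
      trans (∑-cong (vecs m n) (λ vs → ·-shuffle _ _ (sg v r) (vsgn 0 vs rs)))
            (∑-·ˡ² (vecs m n) (sg v r) _ _))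

  lower-inner : ∀ {n} r (qs rs : Vec ℕ n) c b v vs →
                vsgn 0 qs vs · (⟦ (hd0 vs ≤ᵇ r) ∧ (r ≤ᵇ v) ⟧ · g w 0 vs rs c b)
                ≡ ⟦ r ≤ᵇ v ⟧ · (vsgn 0 qs vs · (⟦ hd0 vs ≤ᵇ r ⟧ · g w 0 vs rs c b))
  lower-inner r qs rs c b v vs =
    trans (cong (λ z → vsgn 0 qs vs · (z · g w 0 vs rs c b))
                (trans (⟦∧⟧ (hd0 vs ≤ᵇ r) (r ≤ᵇ v)) (·-comm _ _)))
    (trans (cong (vsgn 0 qs vs ·_) (·-assoc ⟦ r ≤ᵇ v ⟧ ⟦ hd0 vs ≤ᵇ r ⟧ _))
           (·-swap (vsgn 0 qs vs) ⟦ r ≤ᵇ v ⟧ _))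

  lowerRow : ∀ {n} → ℕ → ℕ → Vec ℕ n → Vec ℕ n → ℕ → ℕ → ℕ → ℤ
  lowerRow s r qs rs a b v = ⟦ v ≤ᵇ s ⟧ · (⟦ r ≤ᵇ v ⟧ · lower r qs rs (a + (v ∸ r)) b)

  lower-∷ : ∀ {n} s q r (qs rs : Vec ℕ n) a b →
            lower s (q ∷ qs) (r ∷ rs) a b ≡ ∑ (vals m) (λ v → sg q v · lowerRow s r qs rs a b v)
  lower-∷ {n} s q r qs rs a b =
    trans (∑-vecs m n _) (∑-cong (vals m) λ v →
      trans (∑-cong (vecs m n) (λ vs →
               trans (·-shuffle′ (sg q v) (vsgn 0 qs vs) ⟦ v ≤ᵇ s ⟧ _ (g w 0 vs rs (a + (v ∸ r)) b))
                     (cong (λ z → sg q v · (⟦ v ≤ᵇ s ⟧ · z)) (lower-inner r qs rs (a + (v ∸ r)) b v vs))))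
      (trans (∑-·ˡ² (vecs m n) (sg q v) ⟦ v ≤ᵇ s ⟧ _)
             (cong (λ z → sg q v · (⟦ v ≤ᵇ s ⟧ · z)) (∑-*ˡ (vecs m n) ⟦ r ≤ᵇ v ⟧ _))))
  upperRow-in : ∀ {n} q (qs rs : Vec ℕ n) a b v → hd0 qs ≤ v → v ≤ q →
                upperRow q qs rs a b v ≡ upper qs rs (a + (q ∸ v)) b
  upperRow-in q qs rs a b v h₁ h₂ = ⟦true⟧· _ (cong₂ _∧_ (≤ᵇ-true h₁) (≤ᵇ-true h₂))

  upperRow-low : ∀ {n} q (qs rs : Vec ℕ n) a b v → v < hd0 qs → upperRow q qs rs a b v ≡ 0ℤ
  upperRow-low q qs rs a b v h = ⟦false⟧· _ (cong (_∧ (v ≤ᵇ q)) (≤ᵇ-false h))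

  upperRow-high : ∀ {n} q (qs rs : Vec ℕ n) a b v → q < v → upperRow q qs rs a b v ≡ 0ℤ
  upperRow-high q qs rs a b v h = ⟦false⟧· _ (trans (cong ((hd0 qs ≤ᵇ v) ∧_) (≤ᵇ-false h)) (∧-zeroʳ _))

  upper-low : ∀ {n} q r (qs rs : Vec ℕ n) a b → r ≤ m → r < hd0 qs → upper (q ∷ qs) (r ∷ rs) a b ≡ 0ℤ
  upper-low q zero    qs rs a b r≤m h =
    trans (upper-∷ q 0 qs rs a b) (trans (∑-sgˡ-zero (upperRow q qs rs a b)) (upperRow-low q qs rs a b 0 h))
  upper-low q (suc r) qs rs a b r≤m h =
    trans (upper-∷ q (suc r) qs rs a b) (trans (∑-sgˡ-suc (upperRow q qs rs a b) r≤m)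
      (trans (x⊕-0 _ (upperRow-low q qs rs a b r (<⇒≤ h))) (upperRow-low q qs rs a b (suc r) h)))

  upper-meet : ∀ {n} q r (qs rs : Vec ℕ n) a b → r ≤ m → r ≤ q → hd0 qs ≡ r →
               upper (q ∷ qs) (r ∷ rs) a b ≡ upper qs rs (a + (q ∸ r)) b
  upper-meet q zero    qs rs a b r≤m r≤q h =
    trans (upper-∷ q 0 qs rs a b) (trans (∑-sgˡ-zero (upperRow q qs rs a b))
      (upperRow-in q qs rs a b 0 (≤-reflexive h) r≤q))
  upper-meet q (suc r) qs rs a b r≤m r≤q h =
    trans (upper-∷ q (suc r) qs rs a b) (trans (∑-sgˡ-suc (upperRow q qs rs a b) r≤m)
      (trans (x⊕-0 _ (upperRow-low q qs rs a b r (≤-reflexive (sym h))))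
             (upperRow-in q qs rs a b (suc r) (≤-reflexive h) r≤q)))

  -- Both `r` and `r - 1` are admissible ends here. The second has the opposite sign and one more
  -- box, so `Law` turns the difference into one more factor `1 - x`.
  upper-between : ∀ {n} q r (qs rs : Vec ℕ n) a b → r ≤ m → r ≤ q → hd0 qs < r →
                  upper (q ∷ qs) (r ∷ rs) a b ≡ upper qs rs (a + (q ∸ r)) (suc b)
  upper-between q (suc r) qs rs a b r≤m r≤q (s≤s h) =
    trans (upper-∷ q (suc r) qs rs a b) (trans (∑-sgˡ-suc (upperRow q qs rs a b) r≤m)
      (trans (cong₂ (λ x y → x ⊕ -1ℤ · y)
                (upperRow-in q qs rs a b (suc r) (≤-trans h (n≤1+n r)) r≤q)
                (trans (upperRow-in q qs rs a b r h (<⇒≤ r≤q))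
                       (cong (λ z → upper qs rs z b) (+-suc-∸ a r≤q))))
             (sym (upper-law qs rs (a + (q ∸ suc r)) b))))

  -- A horizontal strip cannot leave more than `q` boxes, so the end `q + 1` arises only from `q`,
  -- by adding one signed box.
  upper-above : ∀ {n} q (qs rs : Vec ℕ n) a b → suc q ≤ m → hd0 qs ≤ q →
                upper (q ∷ qs) (suc q ∷ rs) a b ≡ -1ℤ · upper qs rs a b
  upper-above q qs rs a b q≤m h =
    trans (upper-∷ q (suc q) qs rs a b) (trans (∑-sgˡ-suc (upperRow q qs rs a b) q≤m)
      (trans (0⊕- _ (upperRow-high q qs rs a b (suc q) ≤-refl))
             (cong (-1ℤ ·_) (trans (upperRow-in q qs rs a b q h ≤-refl)
                                   (cong (λ z → upper qs rs z b) (a+n∸n a q))))))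

  upper-far : ∀ {n} q r (qs rs : Vec ℕ n) a b → r ≤ m → suc q < r →
              upper (q ∷ qs) (r ∷ rs) a b ≡ 0ℤ
  upper-far q (suc r) qs rs a b r≤m (s≤s h) =
    trans (upper-∷ q (suc r) qs rs a b) (trans (∑-sgˡ-suc (upperRow q qs rs a b) r≤m)
      (trans (x⊕-0 _ (upperRow-high q qs rs a b r h))
             (upperRow-high q qs rs a b (suc r) (≤-trans h (n≤1+n r)))))

  -- A vertical strip never shortens a row, so a first row already longer than `s` stays longer than
  -- `s`.
  lower-zero : ∀ {n} s (q r : Vec ℕ n) a b → s < hd0 q → lower s q r a b ≡ 0ℤ
  lower-zero {suc n} s (q ∷ qs) (r ∷ rs) a b s<q =
    trans (lower-∷ s q r qs rs a b) (∑-zero (vals m) (λ v _ → case-v v))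
    where
    case-v : ∀ v → sg q v · lowerRow s r qs rs a b v ≡ 0ℤ
    case-v v with ≤-<-connex q v
    ... | inj₁ q≤v = trans (cong (sg q v ·_) (⟦false⟧· _ (≤ᵇ-false (<-≤-trans s<q q≤v)))) (·-zeroʳ _)
    ... | inj₂ v<q = trans (cong (_· lowerRow s r qs rs a b v)
        (trans (x⊕-0 _ (cong ⟦_⟧ (≡ᵇ-false {suc q} {v}
        (λ e → n≮n v (<-≤-trans v<q (≤-trans (n≤1+n q) (≤-reflexive e)))))))
                                                             (cong ⟦_⟧ (≡ᵇ-false {q} {v}
                                                                 (λ e → n≮n v (<-≤-trans v<q
                                                                 (≤-reflexive e)))))))
                           (·-zeroˡ (lowerRow s r qs rs a b v))

  lowerRow-in : ∀ {n} s r (qs rs : Vec ℕ n) a b v → v ≤ s → r ≤ v →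
                lowerRow s r qs rs a b v ≡ lower r qs rs (a + (v ∸ r)) b
  lowerRow-in s r qs rs a b v h₁ h₂ = trans (⟦true⟧· _ (≤ᵇ-true h₁)) (⟦true⟧· _ (≤ᵇ-true h₂))

  lowerRow-low : ∀ {n} s r (qs rs : Vec ℕ n) a b v → v < r → lowerRow s r qs rs a b v ≡ 0ℤ
  lowerRow-low s r qs rs a b v h = trans (cong (⟦ v ≤ᵇ s ⟧ ·_) (⟦false⟧· _ (≤ᵇ-false h))) (·-zeroʳ _)

  lowerRow-high : ∀ {n} s r (qs rs : Vec ℕ n) a b v → s < v → lowerRow s r qs rs a b v ≡ 0ℤ
  lowerRow-high s r qs rs a b v h = ⟦false⟧· _ (≤ᵇ-false h)

  -- Transfer of one factor `1 - x`. If the first row ends before `s`, then on the left it may be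
  -- kept or extended by a signed box, and this choice produces the factor that the row above (with
  -- end `s`) has on the other side. If it ends exactly at `s`, extension is impossible and no
  -- factor appears.
  lower≡upper : ∀ {n} s (q r : Vec ℕ n) a b → s ≤ m → q ∈ vecs m n → r ∈ vecs m n →
                T (dec q) → T (dec (s ∷ r)) → T (lastZ (s ∷ r)) → hd0 q ≤ s →
                lower s q r a b ≡ upper q r a (if hd0 q <ᵇ s then suc b else b)

  -- Strips the first row. The position of `hd0 qs` relative to `r` decides whether this row yields
  -- a factor `1 - x`, and it is the same comparison that decides the factor in `lower≡upper` for
  -- the remaining rows with bound `r`.
  upper-step : ∀ {n} q r (qs rs : Vec ℕ n) a b → r ≤ m → qs ∈ vecs m n → rs ∈ vecs m n →
               T (dec qs) → T (dec (r ∷ rs)) → T (lastZ (r ∷ rs)) → r ≤ q →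
               upper (q ∷ qs) (r ∷ rs) a b ≡ lower r qs rs (a + (q ∸ r)) b
  upper-step q r qs rs a b r≤m qs∈ rs∈ dq dr lz r≤q with <-cmp (hd0 qs) r
  ... | tri< h _ _ = trans (upper-between q r qs rs a b r≤m r≤q h)
        (sym (trans (lower≡upper r qs rs (a + (q ∸ r)) b r≤m qs∈ rs∈ dq dr lz (<⇒≤ h))
                    (cong (λ c → upper qs rs (a + (q ∸ r)) (if c then suc b else b)) (<ᵇ-true h))))
  ... | tri≈ _ h _ = trans (upper-meet q r qs rs a b r≤m r≤q h)
        (sym (trans (lower≡upper r qs rs (a + (q ∸ r)) b r≤m qs∈ rs∈ dq dr lz (≤-reflexive h))
                    (cong (λ c → upper qs rs (a + (q ∸ r)) (if c then suc b else b))
                          (<ᵇ-false (≤-reflexive (sym h))))))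
  ... | tri> _ _ h = trans (upper-low q r qs rs a b r≤m h) (sym (lower-zero r qs rs _ b h))

  -- No row is left to supply a factor, and none is due: `lastZ` makes `s` equal to `0`, so the test
  -- `0 < s` fails.
  lower≡upper s [] [] a b s≤m _ _ _ _ lz _ rewrite ≡ᵇ⇒≡ s 0 lz =
    trans (∑-[ [] ] _)
    (trans (·-identityˡ _) (trans (·-identityˡ (w a b)) (sym (trans (∑-[ [] ] _) (·-identityʳ (w a b))))))
  lower≡upper s (q ∷ qs) (r ∷ rs) a b s≤m q∈ r∈ dq dr lz q≤s with ∈-vecs⁻ q∈ | ∈-vecs⁻ r∈
  ... | q≤m , qs∈ | r≤m , rs∈ with m≤n⇒m<n∨m≡n q≤s
  -- The first row touches the bound, so the extended end `suc q` is excluded.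
  ... | inj₂ refl =
    trans (lower-∷ q q r qs rs a b)
    (trans (∑-sgʳ-top (lowerRow q r qs rs a b) q≤m (λ _ → lowerRow-high q r qs rs a b (suc q) ≤-refl))
    (trans (lowerRow-in q r qs rs a b q ≤-refl r≤q)
    (trans (sym (upper-step q r qs rs a b r≤m qs∈ rs∈ (dec-tail q qs dq) (dec-tail s (r ∷ rs) dr) lz r≤q))
           (cong (λ c → upper (q ∷ qs) (r ∷ rs) a (if c then suc b else b)) (sym (<ᵇ-false {q} ≤-refl))))))
    where r≤q = dec-hd q (r ∷ rs) dr
  -- Both ends `q` and `suc q` fit under `s`. For `r ≤ q` their difference is the factor `1 - x`;
  -- for `r = suc q` only the negative term is left, and it matches `upper-above`; for larger `r`
  -- both sides vanish.
  ... | inj₁ q<s =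
    trans (lower-∷ s q r qs rs a b)
    (trans (∑-sgʳ (lowerRow s r qs rs a b) (≤-trans q<s s≤m))
    (trans (byRow (<-cmp r (suc q)))
           (cong (λ c → upper (q ∷ qs) (r ∷ rs) a (if c then suc b else b)) (sym (<ᵇ-true q<s)))))
    where
    hd≤q = dec-hd q qs dq
    byRow : Tri (r < suc q) (r ≡ suc q) (suc q < r) →
          lowerRow s r qs rs a b q ⊕ -1ℤ · lowerRow s r qs rs a b (suc q) ≡ upper (q ∷ qs) (r ∷ rs) a (suc b)
    byRow (tri< (s≤s r≤q) _ _) =
      trans (cong₂ (λ x y → x ⊕ -1ℤ · y)
               (lowerRow-in s r qs rs a b q q≤s r≤q)
               (trans (lowerRow-in s r qs rs a b (suc q) q<s (≤-trans r≤q (n≤1+n q)))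
                      (cong (λ z → lower r qs rs z b) (+-∸-suc a r≤q))))
      (trans (sym (lower-law r qs rs (a + (q ∸ r)) b))
             (sym (upper-step q r qs rs a (suc b) r≤m qs∈ rs∈ (dec-tail q qs dq) (dec-tail s (r ∷ rs) dr) lz
                 r≤q)))
    byRow (tri≈ _ refl _) =
      trans (0⊕- _ (lowerRow-low s r qs rs a b q ≤-refl))
      (trans (cong (-1ℤ ·_)
               (trans (lowerRow-in s r qs rs a b r q<s ≤-refl)
               (trans (cong (λ z → lower r qs rs z b) (a+n∸n a r))
               (trans (lower≡upper r qs rs a b r≤m qs∈ rs∈ (dec-tail q qs dq) (dec-tail s (r ∷ rs) dr) lz
                   (≤-trans hd≤q (n≤1+n q)))
                      (cong (λ c → upper qs rs a (if c then suc b else b)) (<ᵇ-true (s≤s hd≤q)))))))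
             (sym (upper-above q qs rs a (suc b) r≤m hd≤q)))
    byRow (tri> _ _ h) =
      trans (x⊕-0 _ (lowerRow-low s r qs rs a b (suc q) h))
      (trans (lowerRow-low s r qs rs a b q (<⇒≤ h)) (sym (upper-far q r qs rs a (suc b) r≤m h)))

  -- The vertical strip fixes the first `k + 1` rows, so these are shared by both sides. The last of
  -- them is eligible for `1 - x` on the left only; on the right the rows below it generate this
  -- factor, by `lower≡upper`.
  g-vsgn : ∀ {n} k (q r : Vec ℕ n) a b → q ∈ vecs m n → r ∈ vecs m n →
           T (dec q) → T (dec r) → T (lastZ r) →
           ∑ (vecs m n) (λ r′ → g w (suc k) q r′ a b · vsgn (suc k) r′ r)
           ≡ ∑ (vecs m n) (λ q′ → vsgn (suc k) q q′ · g w k q′ r a b)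
  g-vsgn k [] [] a b _ _ _ _ _ = trans (∑-[ [] ] _) (trans (·-comm (w a b) 1ℤ) (sym (∑-[ [] ] _)))
  g-vsgn {suc n} k (q ∷ qs) (r ∷ rs) a b q∈ r∈ dq dr lz with ∈-vecs⁻ q∈ | ∈-vecs⁻ r∈
  ... | q≤m , qs∈ | r≤m , rs∈ =
    trans (∑-vecs m n _)
    (trans (∑-cong (vals m) (λ v → trans (∑-cong (vecs m n) (λ vs → ·-shuffle _ _ ⟦ v ≡ᵇ r ⟧ (vsgn k vs rs)))
                                         (∑-·ˡ² (vecs m n) ⟦ v ≡ᵇ r ⟧ _ _)))
    (trans (∑-δ (λ v → ⟦ (hd0 qs ≤ᵇ v) ∧ (v ≤ᵇ q) ⟧ ·
                        ∑ (vecs m n) (λ vs → g w k qs vs (a + (q ∸ v)) (bump (suc k) (hd0 qs) v b) · vsgn k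
                            vs rs)) r≤m)
    (trans (rest k)
    (sym (trans (∑-vecs m n _)
         (trans (∑-cong (vals m) (λ v → trans (∑-cong (vecs m n) (λ vs → ·-assoc ⟦ q ≡ᵇ v ⟧ _ _))
                                              (∑-*ˡ (vecs m n) ⟦ q ≡ᵇ v ⟧ _)))
                (∑-δ′ (rhs k) q≤m)))))))
    where
    dqs = dec-tail q qs dq
    rhs : ℕ → ℕ → ℤ
    rhs k v = ∑ (vecs m n) (λ vs → vsgn k qs vs · (⟦ (hd0 vs ≤ᵇ r) ∧ (r ≤ᵇ v) ⟧ ·
                g w (pred k) vs rs (a + (v ∸ r)) (bump k (hd0 vs) r b)))
    c = a + (q ∸ r)
    rest : ∀ k → ⟦ (hd0 qs ≤ᵇ r) ∧ (r ≤ᵇ q) ⟧ ·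
                 ∑ (vecs m n) (λ vs → g w k qs vs c (bump (suc k) (hd0 qs) r b) · vsgn k vs rs) ≡ rhs k q
    -- The row just treated is the last fixed one; its end `r` is the bound `s` for the rows below.
    rest zero = sym (trans (∑-cong (vecs m n) (lower-inner r qs rs c b q))
                    (trans (∑-*ˡ (vecs m n) ⟦ r ≤ᵇ q ⟧ _) (by (≤-<-connex (hd0 qs) r))))
      where
      by : (hd0 qs ≤ r) ⊎ (r < hd0 qs) → ⟦ r ≤ᵇ q ⟧ · lower r qs rs c b ≡
           ⟦ (hd0 qs ≤ᵇ r) ∧ (r ≤ᵇ q) ⟧ · upper qs rs c (bump 1 (hd0 qs) r b)
      by (inj₁ h) = cong₂ (λ x y → ⟦ x ⟧ · y) (cong (_∧ (r ≤ᵇ q)) (sym (≤ᵇ-true h)))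
                          (lower≡upper r qs rs c b r≤m qs∈ rs∈ dqs dr lz h)
      by (inj₂ h) = trans (cong (⟦ r ≤ᵇ q ⟧ ·_) (lower-zero r qs rs c b h))
                          (trans (·-zeroʳ _) (sym (⟦false⟧· _ (cong (_∧ (r ≤ᵇ q)) (≤ᵇ-false h)))))
    rest (suc k) =
      trans (cong (⟦ (hd0 qs ≤ᵇ r) ∧ (r ≤ᵇ q) ⟧ ·_)
                  (g-vsgn k qs rs c (bump (suc (suc k)) (hd0 qs) r b) qs∈ rs∈ dqs (dec-tail r rs dr)
                      (lastZ-tail r rs lz)))
      (trans (sym (∑-*ˡ (vecs m n) _ _))
             (∑-cong (vecs m n) (λ vs → trans (·-swap _ (vsgn (suc k) qs vs) _)
               (sym (vsgn-hd k qs vs (λ h → ⟦ (h ≤ᵇ r) ∧ (r ≤ᵇ q) ⟧ · g w k vs rs c (bump (suc k) h r b)))))))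

-- Pointwise conditions and supports of the strip weights.

at : ∀ {n} → Vec ℕ n → ℕ → ℕ
at []       _       = 0
at (x ∷ xs) zero    = x
at (x ∷ xs) (suc i) = at xs i

hd0≡at : ∀ {n} (xs : Vec ℕ n) → hd0 xs ≡ at xs 0
hd0≡at []      = refl
hd0≡at (x ∷ _) = refl

at-ext : ∀ {n} (xs ys : Vec ℕ n) → (∀ i → at xs i ≡ at ys i) → xs ≡ ys
at-ext []       []       h = refl
at-ext (x ∷ xs) (y ∷ ys) h = cong₂ _∷_ (h 0) (at-ext xs ys (h ∘ suc))

Dec : ∀ {n} → Vec ℕ n → Set
Dec q = ∀ i → at q (suc i) ≤ at q i

dec⇒Dec : ∀ {n} (q : Vec ℕ n) → T (dec q) → Dec q
dec⇒Dec []       d i       = z≤n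
dec⇒Dec (q ∷ qs) d zero    = subst (_≤ q) (hd0≡at qs) (dec-hd q qs d)
dec⇒Dec (q ∷ qs) d (suc i) = dec⇒Dec qs (dec-tail q qs d) i

Dec⇒dec : ∀ {n} (q : Vec ℕ n) → Dec q → T (dec q)
Dec⇒dec []       d = tt
Dec⇒dec (q ∷ qs) d = dec-∷ q qs (subst (_≤ q) (sym (hd0≡at qs)) (d 0)) (Dec⇒dec qs (d ∘ suc))

lastZ-intro : ∀ {n} (q : Vec ℕ n) → at q (pred n) ≡ 0 → T (lastZ q)
lastZ-intro []           h = tt
lastZ-intro (x ∷ [])     h = ≡⇒≡ᵇ x 0 h
lastZ-intro (x ∷ y ∷ ys) h = lastZ-intro (y ∷ ys) h

lastZ-elim : ∀ {n} (q : Vec ℕ n) → T (lastZ q) → at q (pred n) ≡ 0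
lastZ-elim []           h = refl
lastZ-elim (x ∷ [])     h = ≡ᵇ⇒≡ x 0 h
lastZ-elim (x ∷ y ∷ ys) h = lastZ-elim (y ∷ ys) h

Interlaced : ∀ {n} → Vec ℕ n → Vec ℕ n → Set
Interlaced q r = ∀ i → at q (suc i) ≤ at r i × at r i ≤ at q i

Interlaced⇒Decˡ : ∀ {n} (q r : Vec ℕ n) → Interlaced q r → Dec q
Interlaced⇒Decˡ q r h i = ≤-trans (proj₁ (h i)) (proj₂ (h i))

Interlaced⇒Decʳ : ∀ {n} (q r : Vec ℕ n) → Interlaced q r → Dec r
Interlaced⇒Decʳ q r h i = ≤-trans (proj₂ (h (suc i))) (proj₁ (h i))

∧-case : ∀ a → T a ⊎ a ≡ false
∧-case true  = inj₁ tt
∧-case false = inj₂ refl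

0·′ : ∀ x {y} → y ≡ 0ℤ → x · y ≡ 0ℤ
0·′ x refl = ·-zeroʳ x

0· : ∀ {x} y → x ≡ 0ℤ → x · y ≡ 0ℤ
0· y refl = ·-zeroˡ y

-- The first of the support statements. Since the summation index runs over all bounded vectors,
-- such an alternative is how a summand is shown either to vanish or to satisfy the hypotheses of
-- the lemma applied to it.
g-supp : ∀ w {n} k (q r : Vec ℕ n) a b → (g w k q r a b ≡ 0ℤ) ⊎ Interlaced q r
g-supp w k []       []       a b = inj₂ (λ i → z≤n , z≤n)
g-supp w k (q ∷ qs) (r ∷ rs) a b with ∧-case ((hd0 qs ≤ᵇ r) ∧ (r ≤ᵇ q))
... | inj₂ f = inj₁ (⟦false⟧· _ f)
... | inj₁ t with g-supp w (pred k) qs rs (a + (q ∸ r)) (bump k (hd0 qs) r b)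
... | inj₁ z = inj₁ (0·′ ⟦ (hd0 qs ≤ᵇ r) ∧ (r ≤ᵇ q) ⟧ z)
... | inj₂ h = inj₂ λ { zero    → subst (_≤ r) (hd0≡at qs) (≤ᵇ⇒≤ (hd0 qs) r (∧-left t)) , ≤ᵇ⇒≤ r q
    (∧-right {hd0 qs ≤ᵇ r} t)
                      ; (suc i) → h i }

VStrip : ∀ {n} → ℕ → Vec ℕ n → Vec ℕ n → Set
VStrip k q q′ = ∀ i → at q i ≤ at q′ i × at q′ i ≤ suc (at q i) × (i < k → at q i ≡ at q′ i)

sg-supp : ∀ a b → (sg a b ≡ 0ℤ) ⊎ (a ≤ b × b ≤ suc a)
sg-supp a b with a ≟ b | suc a ≟ b
... | yes refl | _        = inj₂ (≤-refl , n≤1+n a)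
... | no _     | yes refl = inj₂ (n≤1+n a , ≤-refl)
... | no e₁    | no e₂    = inj₁ (trans (x⊕-0 _ (cong ⟦_⟧ (≡ᵇ-false e₂))) (cong ⟦_⟧ (≡ᵇ-false e₁)))

vsgn-supp : ∀ {n} k (q q′ : Vec ℕ n) → (vsgn k q q′ ≡ 0ℤ) ⊎ VStrip k q q′
vsgn-supp k       []       []         = inj₂ λ i → z≤n , z≤n , λ _ → refl
vsgn-supp zero    (q ∷ qs) (q′ ∷ qs′) with sg-supp q q′ | vsgn-supp 0 qs qs′
... | inj₁ z | _      = inj₁ (0· _ z)
... | inj₂ _ | inj₁ z = inj₁ (0·′ _ z)
... | inj₂ (h₁ , h₂) | inj₂ h = inj₂ λ { zero → h₁ , h₂ , λ () ; (suc i) → proj₁ (h i) , proj₁ (proj₂ (h i))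
    , λ () }
vsgn-supp (suc k) (q ∷ qs) (q′ ∷ qs′) with q ≟ q′ | vsgn-supp k qs qs′
... | no e     | _      = inj₁ (⟦false⟧· _ (≡ᵇ-false e))
... | yes refl | inj₁ z = inj₁ (0·′ _ z)
... | yes refl | inj₂ h = inj₂ λ { zero → ≤-refl , n≤1+n q , λ _ → refl
                                 ; (suc i) → proj₁ (h i) , proj₁ (proj₂ (h i)) , λ
                                     { (s≤s l) → proj₂ (proj₂ (h i)) l } }

eqV : ∀ {n} → Vec ℕ n → Vec ℕ n → Bool
eqV []       []       = true
eqV (x ∷ xs) (y ∷ ys) = (x ≡ᵇ y) ∧ eqV xs ys

eqV⇒≡ : ∀ {n} (xs ys : Vec ℕ n) → T (eqV xs ys) → xs ≡ ys
eqV⇒≡ []       []       h = refl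
eqV⇒≡ (x ∷ xs) (y ∷ ys) h = cong₂ _∷_ (≡ᵇ⇒≡ x y (∧-left h)) (eqV⇒≡ xs ys (∧-right {x ≡ᵇ y} h))

eqV-refl : ∀ {n} (xs : Vec ℕ n) → eqV xs xs ≡ true
eqV-refl []       = refl
eqV-refl (x ∷ xs) = cong₂ _∧_ (≡ᵇ-refl x) (eqV-refl xs)

eqV-false : ∀ {n} {xs ys : Vec ℕ n} → xs ≢ ys → eqV xs ys ≡ false
eqV-false {xs = xs} {ys} h = ¬T⇒≡ (λ t → h (eqV⇒≡ xs ys t))

-- Horizontal strips, containment, and inversion by signed vertical strips.

hs : ∀ {n} → ℕ → Vec ℕ n → Vec ℕ n → Bool
hs k       []       []       = true
hs zero    (t ∷ ts) (p ∷ ps) = ((hd0 ps ≤ᵇ t) ∧ (t ≤ᵇ p)) ∧ hs 0 ts ps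
hs (suc k) (t ∷ ts) (p ∷ ps) = (t ≡ᵇ p) ∧ hs k ts ps

-- Interpolates between the identity (`k = 0`) and the zeta matrix of containment (`k` at least
-- `n`): containment in the first `k` rows, equality below.
Z : ∀ {n} → ℕ → Vec ℕ n → Vec ℕ n → Bool
Z zero    t        p        = eqV t p
Z (suc k) []       []       = true
Z (suc k) (t ∷ ts) (p ∷ ps) = (t ≤ᵇ p) ∧ Z k ts ps

-- The product of `Z k` with the horizontal strips in the rows after the first `k`, in closed form;
-- see `Z-hs`.
ZH : ∀ {n} → ℕ → Vec ℕ n → Vec ℕ n → Bool
ZH zero    t        p        = hs 0 t p
ZH (suc k) []       []       = true
ZH (suc k) (t ∷ ts) (p ∷ ps) = (t ≤ᵇ p) ∧ ZH k ts ps

HStrip : ∀ {n} → ℕ → Vec ℕ n → Vec ℕ n → Set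
HStrip k t p = ∀ i → at t i ≤ at p i × (i < k → at t i ≡ at p i) × (k ≤ i → at p (suc i) ≤ at t i)

hs⇒HStrip : ∀ {n} k (t p : Vec ℕ n) → T (hs k t p) → HStrip k t p
hs⇒HStrip k       []       []       h i       = z≤n , (λ _ → refl) , λ _ → z≤n
hs⇒HStrip zero    (t ∷ ts) (p ∷ ps) h zero    =
  ≤ᵇ⇒≤ t p (∧-right {hd0 ps ≤ᵇ t} (∧-left h)) , (λ ()) ,
  λ _ → subst (_≤ t) (hd0≡at ps) (≤ᵇ⇒≤ (hd0 ps) t (∧-left (∧-left h)))
hs⇒HStrip zero    (t ∷ ts) (p ∷ ps) h (suc i) with hs⇒HStrip 0 ts ps (∧-right {(hd0 ps ≤ᵇ t) ∧ (t ≤ᵇ p)} h) i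
... | h₁ , _ , h₃ = h₁ , (λ ()) , λ _ → h₃ z≤n
hs⇒HStrip (suc k) (t ∷ ts) (p ∷ ps) h zero    =
  ≤-reflexive (≡ᵇ⇒≡ t p (∧-left h)) , (λ _ → ≡ᵇ⇒≡ t p (∧-left h)) , λ ()
hs⇒HStrip (suc k) (t ∷ ts) (p ∷ ps) h (suc i) with hs⇒HStrip k ts ps (∧-right {t ≡ᵇ p} h) i
... | h₁ , h₂ , h₃ = h₁ , (λ { (s≤s l) → h₂ l }) , λ { (s≤s l) → h₃ l }

HStrip⇒hs : ∀ {n} k (t p : Vec ℕ n) → HStrip k t p → T (hs k t p)
HStrip⇒hs k       []       []       h = tt
HStrip⇒hs zero    (t ∷ ts) (p ∷ ps) h =
  ∧-intro (∧-intro (≤⇒≤ᵇ (subst (_≤ t) (sym (hd0≡at ps)) (proj₂ (proj₂ (h 0)) z≤n))) (≤⇒≤ᵇ (proj₁ (h 0))))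
          (HStrip⇒hs 0 ts ps (λ i → proj₁ (h (suc i)) , (λ ()) , λ _ → proj₂ (proj₂ (h (suc i))) z≤n))
HStrip⇒hs (suc k) (t ∷ ts) (p ∷ ps) h =
  ∧-intro (≡⇒≡ᵇ t p (proj₁ (proj₂ (h 0)) (s≤s z≤n)))
          (HStrip⇒hs k ts ps (λ i → proj₁ (h (suc i)) , (λ l → proj₁ (proj₂ (h (suc i))) (s≤s l))
                                                      , (λ l → proj₂ (proj₂ (h (suc i))) (s≤s l))))

HStrip⇒Dec : ∀ {n} k (t p : Vec ℕ n) → Dec p → HStrip k t p → Dec t
HStrip⇒Dec k t p d h i with ≤-<-connex k i
... | inj₁ k≤i = ≤-trans (proj₁ (h (suc i))) (proj₂ (proj₂ (h i)) k≤i)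
... | inj₂ i<k = ≤-trans (proj₁ (h (suc i))) (≤-trans (d i) (≤-reflexive (sym (proj₁ (proj₂ (h i)) i<k))))

ZH-elim : ∀ {n} k (t p : Vec ℕ n) → T (ZH k t p) → ∀ i → at t i ≤ at p i × (k ≤ i → at p (suc i) ≤ at t i)
ZH-elim zero    t        p        h i       with hs⇒HStrip 0 t p h i
... | h₁ , _ , h₃ = h₁ , h₃
ZH-elim (suc k) []       []       h i       = z≤n , λ _ → z≤n
ZH-elim (suc k) (t ∷ ts) (p ∷ ps) h zero    = ≤ᵇ⇒≤ t p (∧-left h) , λ ()
ZH-elim (suc k) (t ∷ ts) (p ∷ ps) h (suc i) with ZH-elim k ts ps (∧-right {t ≤ᵇ p} h) i
... | h₁ , h₂ = h₁ , λ { (s≤s l) → h₂ l }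

Z-intro : ∀ {n} k (t p : Vec ℕ n) → n ≤ k → (∀ i → at t i ≤ at p i) → T (Z k t p)
Z-intro zero    []       []       _       h = tt
Z-intro (suc k) []       []       _       h = tt
Z-intro (suc k) (t ∷ ts) (p ∷ ps) (s≤s l) h = ∧-intro (≤⇒≤ᵇ (h 0)) (Z-intro k ts ps l (h ∘ suc))

Z-elim : ∀ {n} k (t p : Vec ℕ n) → T (Z k t p) → ∀ i → at t i ≤ at p i
Z-elim zero    t        p        h i       = ≤-reflexive (cong (λ v → at v i) (eqV⇒≡ t p h))
Z-elim (suc k) []       []       h i       = z≤n
Z-elim (suc k) (t ∷ ts) (p ∷ ps) h zero    = ≤ᵇ⇒≤ t p (∧-left h)
Z-elim (suc k) (t ∷ ts) (p ∷ ps) h (suc i) = Z-elim k ts ps (∧-right {t ≤ᵇ p} h) i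

∑-eqVˡ : ∀ {m n} (q : Vec ℕ n) (f : Vec ℕ n → ℤ) → q ∈ vecs m n → ∑ (vecs m n) (λ r → ⟦ eqV q r ⟧ · f r) ≡ f q
∑-eqVˡ {m} {n} q f q∈ =
  trans (∑-single _ (vecs-unique m n) q∈ (λ r _ r≢q → ⟦false⟧· (f r) (eqV-false (λ e → r≢q (sym e)))))
        (⟦true⟧· (f q) (eqV-refl q))

∑-eqVʳ : ∀ {m n} (q : Vec ℕ n) (f : Vec ℕ n → ℤ) → q ∈ vecs m n → ∑ (vecs m n) (λ r → f r · ⟦ eqV r q ⟧) ≡ f q
∑-eqVʳ {m} {n} q f q∈ =
  trans (∑-single _ (vecs-unique m n) q∈ (λ r _ r≢q → 0·′ (f r) (cong ⟦_⟧ (eqV-false r≢q))))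
        (trans (cong (f q ·_) (cong ⟦_⟧ (eqV-refl q))) (·-identityʳ (f q)))

-- Horizontal strips are inverse to signed vertical strips.
vsgn-hs : ∀ {m n} (t p : Vec ℕ n) → t ∈ vecs m n → p ∈ vecs m n → T (dec t) →
          ∑ (vecs m n) (λ v → vsgn 0 t v · ⟦ hs 0 v p ⟧) ≡ ⟦ eqV t p ⟧
vsgn-hs []       []       _  _  _ = trans (∑-[ [] ] _) (·-identityˡ 1ℤ)
vsgn-hs {m} {suc n} (t ∷ ts) (p ∷ ps) t∈ p∈ d with ∈-vecs⁻ t∈ | ∈-vecs⁻ p∈
... | t≤m , ts∈ | p≤m , ps∈ =
  trans (∑-vecs m n _)
  (trans (∑-cong (vals m) (λ v →
           trans (∑-cong (vecs m n) (λ vs →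
                   trans (cong ((sg t v · vsgn 0 ts vs) ·_) (⟦∧⟧ ((hd0 ps ≤ᵇ v) ∧ (v ≤ᵇ p)) (hs 0 vs ps)))
                         (·-interchange (sg t v) _ _ _)))
           (trans (∑-*ˡ (vecs m n) (sg t v · ⟦ (hd0 ps ≤ᵇ v) ∧ (v ≤ᵇ p) ⟧) _)
           (trans (cong ((sg t v · ⟦ (hd0 ps ≤ᵇ v) ∧ (v ≤ᵇ p) ⟧) ·_) (vsgn-hs ts ps ts∈ ps∈ (dec-tail t ts d)))
                  (·-assoc (sg t v) _ _)))))
         (byTail (∧-case (eqV ts ps))))
  where
  f : ℕ → ℤ
  f v = ⟦ (hd0 ps ≤ᵇ v) ∧ (v ≤ᵇ p) ⟧ · ⟦ eqV ts ps ⟧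
  f-high : ∀ v → p < v → f v ≡ 0ℤ
  f-high v h = ⟦false⟧· _ (trans (cong ((hd0 ps ≤ᵇ v) ∧_) (≤ᵇ-false h)) (∧-zeroʳ _))
  byTail : T (eqV ts ps) ⊎ eqV ts ps ≡ false → ∑ (vals m) (λ v → sg t v · f v) ≡ ⟦ (t ≡ᵇ p) ∧ eqV ts ps ⟧
  byTail (inj₂ z) = trans (∑-zero (vals m) (λ v _ → 0·′ (sg t v) (0·′ _ (cong ⟦_⟧ z))))
                          (sym (trans (cong (λ b → ⟦ (t ≡ᵇ p) ∧ b ⟧) z) (cong ⟦_⟧ (∧-zeroʳ _))))
  byTail (inj₁ e) = byHead (<-cmp t p)
    where
    hd≤t : hd0 ps ≤ t
    hd≤t = subst (λ z → hd0 z ≤ t) (eqV⇒≡ ts ps e) (dec-hd t ts d)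
    f-in : ∀ v → t ≤ v → v ≤ p → f v ≡ 1ℤ
    f-in v h₁ h₂ = trans (⟦true⟧· _ (cong₂ _∧_ (≤ᵇ-true (≤-trans hd≤t h₁)) (≤ᵇ-true h₂))) (⟦T⟧ e)
    byHead : Tri (t < p) (t ≡ p) (p < t) → ∑ (vals m) (λ v → sg t v · f v) ≡ ⟦ (t ≡ᵇ p) ∧ eqV ts ps ⟧
    byHead (tri< h e′ _) =
      trans (∑-sgʳ f (≤-trans h p≤m))
      (trans (cong₂ (λ x y → x ⊕ -1ℤ · y) (f-in t ≤-refl (<⇒≤ h)) (f-in (suc t) (n≤1+n t) h))
      (trans (⊕-inverseʳ 1ℤ) (sym (cong (λ b → ⟦ b ∧ eqV ts ps ⟧) (≡ᵇ-false e′)))))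
    byHead (tri≈ _ refl _) =
      trans (∑-sgʳ-top f t≤m (λ _ → f-high (suc t) ≤-refl))
      (trans (f-in t ≤-refl ≤-refl) (sym (cong₂ (λ x y → ⟦ x ∧ y ⟧) (≡ᵇ-refl t) (T⇒≡ e))))
    byHead (tri> _ e′ h) =
      trans (∑-sgʳ-top f t≤m (λ _ → f-high (suc t) (≤-trans h (n≤1+n t))))
      (trans (f-high t h) (sym (cong (λ b → ⟦ b ∧ eqV ts ps ⟧) (≡ᵇ-false e′))))

-- In the rows after the first `k + 1` the strips cancel by `vsgn-hs` and leave equality. Row
-- `k + 1` still carries the lower bound `hd0 ps ≤ t` from the horizontal strip, but equality below
-- and `dec t` make it automatic, so plain containment remains there.
vsgn-ZH : ∀ {m n} k (t p : Vec ℕ n) → t ∈ vecs m n → p ∈ vecs m n → T (dec t) →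
          ∑ (vecs m n) (λ v → vsgn (suc k) t v · ⟦ ZH k v p ⟧) ≡ ⟦ Z (suc k) t p ⟧
vsgn-ZH zero    []       []       _  _  _ = trans (∑-[ [] ] _) (·-identityˡ 1ℤ)
vsgn-ZH (suc k) []       []       _  _  _ = trans (∑-[ [] ] _) (·-identityˡ 1ℤ)
vsgn-ZH {m} {suc n} k (t ∷ ts) (p ∷ ps) t∈ p∈ d with ∈-vecs⁻ t∈ | ∈-vecs⁻ p∈
... | t≤m , ts∈ | p≤m , ps∈ =
  trans (∑-vecs m n _)
  (trans (∑-cong (vals m) (λ v → trans (∑-cong (vecs m n) (λ vs → ·-assoc ⟦ t ≡ᵇ v ⟧ _ _))
      (∑-*ˡ (vecs m n) ⟦ t ≡ᵇ v ⟧ _)))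
  (trans (∑-δ′ (λ v → ∑ (vecs m n) (λ vs → vsgn k ts vs · ⟦ ZH k (v ∷ vs) (p ∷ ps) ⟧)) t≤m)
         (rest k)))
  where
  pull : ∀ c (x : Vec ℕ n → ℤ) (y : Vec ℕ n → Bool) →
         ∑ (vecs m n) (λ vs → x vs · ⟦ c ∧ y vs ⟧) ≡ ⟦ c ⟧ · ∑ (vecs m n) (λ vs → x vs · ⟦ y vs ⟧)
  pull c x y = trans (∑-cong (vecs m n) (λ vs → trans (cong (x vs ·_) (⟦∧⟧ c (y vs))) (·-swap (x vs) ⟦ c ⟧ _)))
                     (∑-*ˡ (vecs m n) ⟦ c ⟧ _)
  drop : T (eqV ts ps) ⊎ eqV ts ps ≡ false →
         ⟦ (hd0 ps ≤ᵇ t) ∧ (t ≤ᵇ p) ⟧ · ⟦ eqV ts ps ⟧ ≡ ⟦ (t ≤ᵇ p) ∧ eqV ts ps ⟧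
  drop (inj₁ e) =
    trans (cong (λ b → ⟦ b ∧ (t ≤ᵇ p) ⟧ · ⟦ eqV ts ps ⟧)
                (≤ᵇ-true (subst (λ z → hd0 z ≤ t) (eqV⇒≡ ts ps e) (dec-hd t ts d))))
          (sym (⟦∧⟧ (t ≤ᵇ p) (eqV ts ps)))
  drop (inj₂ e) = trans (0·′ ⟦ (hd0 ps ≤ᵇ t) ∧ (t ≤ᵇ p) ⟧ (cong ⟦_⟧ e))
                        (sym (cong ⟦_⟧ (trans (cong ((t ≤ᵇ p) ∧_) e) (∧-zeroʳ _))))
  rest : ∀ k → ∑ (vecs m n) (λ vs → vsgn k ts vs · ⟦ ZH k (t ∷ vs) (p ∷ ps) ⟧) ≡ ⟦ (t ≤ᵇ p) ∧ Z k ts ps ⟧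
  rest zero =
    trans (pull ((hd0 ps ≤ᵇ t) ∧ (t ≤ᵇ p)) (vsgn 0 ts) (λ vs → hs 0 vs ps))
    (trans (cong (⟦ (hd0 ps ≤ᵇ t) ∧ (t ≤ᵇ p) ⟧ ·_) (vsgn-hs ts ps ts∈ ps∈ (dec-tail t ts d)))
           (drop (∧-case (eqV ts ps))))
  rest (suc k) =
    trans (pull (t ≤ᵇ p) (vsgn (suc k) ts) (λ vs → ZH k vs ps))
    (trans (cong (⟦ t ≤ᵇ p ⟧ ·_) (vsgn-ZH k ts ps ts∈ ps∈ (dec-tail t ts d)))
        (sym (⟦∧⟧ (t ≤ᵇ p) (Z (suc k) ts ps))))

Z-hs : ∀ {m n} k (t p : Vec ℕ n) → t ∈ vecs m n → p ∈ vecs m n →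
       ∑ (vecs m n) (λ v → ⟦ Z k t v ⟧ · ⟦ hs k v p ⟧) ≡ ⟦ ZH k t p ⟧
Z-hs zero    t        p        t∈ p∈ = ∑-eqVˡ t (λ v → ⟦ hs 0 v p ⟧) t∈
Z-hs (suc k) []       []       t∈ p∈ = trans (∑-[ [] ] _) (·-identityˡ 1ℤ)
Z-hs {m} {suc n} (suc k) (t ∷ ts) (p ∷ ps) t∈ p∈ with ∈-vecs⁻ t∈ | ∈-vecs⁻ p∈
... | t≤m , ts∈ | p≤m , ps∈ =
  trans (∑-vecs m n _)
  (trans (∑-cong (vals m) (λ v →
           trans (∑-cong (vecs m n) (λ vs →
             trans (cong₂ _·_ (⟦∧⟧ (t ≤ᵇ v) (Z k ts vs)) (⟦∧⟧ (v ≡ᵇ p) (hs k vs ps)))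
                   (·-shuffle ⟦ t ≤ᵇ v ⟧ ⟦ Z k ts vs ⟧ ⟦ v ≡ᵇ p ⟧ ⟦ hs k vs ps ⟧)))
             (∑-*ˡ (vecs m n) ⟦ v ≡ᵇ p ⟧ _)))
  (trans (∑-δ (λ v → ∑ (vecs m n) (λ vs → ⟦ t ≤ᵇ v ⟧ · (⟦ Z k ts vs ⟧ · ⟦ hs k vs ps ⟧))) p≤m)
  (trans (∑-*ˡ (vecs m n) ⟦ t ≤ᵇ p ⟧ _)
  (trans (cong (⟦ t ≤ᵇ p ⟧ ·_) (Z-hs k ts ps ts∈ ps∈)) (sym (⟦∧⟧ (t ≤ᵇ p) (ZH k ts ps)))))))

∑-⊎ : ∀ (xs : List A) {f : A → ℤ} {P : Set} → (∀ x → (f x ≡ 0ℤ) ⊎ P) → (∑ xs f ≡ 0ℤ) ⊎ P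
∑-⊎ []       h = inj₁ (∑-[] _)
∑-⊎ (x ∷ xs) h with h x | ∑-⊎ xs h
... | inj₂ p | _      = inj₂ p
... | inj₁ _ | inj₂ p = inj₂ p
... | inj₁ z | inj₁ y = inj₁ (trans (∑-∷ x xs _) (trans (cong₂ _⊕_ z y) (⊕-identityʳ 0ℤ)))

·-⊎ : ∀ {x y} {P Q : Set} → (x ≡ 0ℤ) ⊎ P → (y ≡ 0ℤ) ⊎ Q → (x · y ≡ 0ℤ) ⊎ (P × Q)
·-⊎ {x} {y} (inj₁ z) _        = inj₁ (0· y z)
·-⊎ {x} {y} (inj₂ p) (inj₁ z) = inj₁ (0·′ x z)
·-⊎         (inj₂ p) (inj₂ q) = inj₂ (p , q)

⟦⟧-⊎ : ∀ b → (⟦ b ⟧ ≡ 0ℤ) ⊎ T b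
⟦⟧-⊎ true  = inj₂ tt
⟦⟧-⊎ false = inj₁ refl

map-⊎ : ∀ {x} {P Q : Set} → (P → Q) → (x ≡ 0ℤ) ⊎ P → (x ≡ 0ℤ) ⊎ Q
map-⊎ f (inj₁ z) = inj₁ z
map-⊎ f (inj₂ p) = inj₂ (f p)

-- Lets a rewriting of one factor assume the support condition of the other.
⊎-cong : ∀ {x y z} {P : Set} → (x ≡ 0ℤ) ⊎ P → (P → y ≡ z) → x · y ≡ x · z
⊎-cong {x} {y} {z} (inj₁ e) h = trans (0· y e) (sym (0· z e))
⊎-cong {x} (inj₂ p) h = cong (x ·_) (h p)

⊎-congʳ : ∀ {x y z} {P : Set} → (x ≡ 0ℤ) ⊎ P → (P → y ≡ z) → y · x ≡ z · x
⊎-congʳ {x} {y} {z} s h = trans (·-comm y x) (trans (⊎-cong s h) (·-comm x z))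

-- coef d a b is the coefficient of x ^ d in x ^ a * (1 - x) ^ b.
coef : ℕ → ℕ → ℕ → ℤ
coef d a zero    = ⟦ a ≡ᵇ d ⟧
coef d a (suc b) = coef d a b ⊕ -1ℤ · coef d (suc a) b

coef-law : ∀ d → Law (coef d)
coef-law d a b = refl

_≤ᵛ_ : ∀ {n} → Vec ℕ n → Vec ℕ n → Set
q ≤ᵛ r = ∀ i → at q i ≤ at r i

-- Transfer matrices and the expansion as a matrix product.

module Matrix (m n : ℕ) where

  Mat : Set
  Mat = Vec ℕ n → Vec ℕ n → ℤ

  infixr 7 _⊗_
  _⊗_ : Mat → Mat → Mat
  (F ⊗ H) q r = ∑ (vecs m n) (λ s → F q s · H s r)

  ⊗-assoc : ∀ F G H q r → ((F ⊗ G) ⊗ H) q r ≡ (F ⊗ (G ⊗ H)) q r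
  ⊗-assoc F G H q r =
    trans (∑-cong (vecs m n) (λ s → sym (∑-*ʳ (vecs m n) (H s r) _)))
    (trans (∑-swap (vecs m n) (vecs m n) _)
           (∑-cong (vecs m n) (λ t → trans (∑-cong (vecs m n) (λ s → ·-assoc (F q t) (G t s) (H s r)))
                                           (∑-*ˡ (vecs m n) (F q t) _))))

  ⊗-cong : ∀ (F : Mat) q {x y : Vec ℕ n → ℤ} → (∀ s → s ∈ vecs m n → x s ≡ y s) →
           ∑ (vecs m n) (λ s → F q s · x s) ≡ ∑ (vecs m n) (λ s → F q s · y s)
  ⊗-cong F q h = ∑-cong∈ (vecs m n) (λ s s∈ → cong (F q s ·_) (h s s∈))

  I : Mat
  I q r = ⟦ eqV q r ⟧

  -- `vsgn` alone may lead from a decreasing vector to one that is not; the indicator keeps only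
  -- strips between partitions.
  V : ℕ → Mat
  V k q q′ = ⟦ dec q ∧ dec q′ ⟧ · vsgn k q q′

  H : ℕ → Mat
  H k t p = ⟦ hs k t p ⟧

  -- `V k` places the label `k`, which row-boundedness confines to the rows after the first `k`.
  -- Rows decrease, so the largest label lies next to the inner boundary and its factor comes first.
  C : ℕ → Mat
  C zero    = I
  C (suc k) = V (suc k) ⊗ C k

  -- `H k` places the label `k + 1`, which may occur from row `k + 1` on. The largest label is
  -- outermost, so its factor comes last.
  E : ℕ → Mat
  E zero    = I
  E (suc k) = E k ⊗ H k

  V-supp : ∀ k q q′ → (V k q q′ ≡ 0ℤ) ⊎ (T (dec q ∧ dec q′) × VStrip k q q′)
  V-supp k q q′ = ·-⊎ (⟦⟧-⊎ _) (vsgn-supp k q q′)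

  C-supp : ∀ k q r → (C k q r ≡ 0ℤ) ⊎ (q ≤ᵛ r)
  C-supp zero    q r = map-⊎ (λ e i → ≤-reflexive (cong (λ v → at v i) (eqV⇒≡ q r e))) (⟦⟧-⊎ _)
  C-supp (suc k) q r = ∑-⊎ (vecs m n) (λ s →
    map-⊎ (λ { ((_ , v) , c) i → ≤-trans (proj₁ (v i)) (c i) }) (·-⊎ (V-supp (suc k) q s) (C-supp k s r)))

  E-supp : ∀ k t p → (E k t p ≡ 0ℤ) ⊎ (t ≤ᵛ p)
  E-supp zero    t p = map-⊎ (λ e i → ≤-reflexive (cong (λ v → at v i) (eqV⇒≡ t p e))) (⟦⟧-⊎ _)
  E-supp (suc k) t p = ∑-⊎ (vecs m n) (λ s →
    map-⊎ (λ { (e , h) i → ≤-trans (e i) (proj₁ (hs⇒HStrip k s p h i)) }) (·-⊎ (E-supp k t s) (⟦⟧-⊎ _)))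

  -- The product is regrouped so that `C k ⊗ E k`, known by induction, stands between the outer
  -- factors `V (suc k)` and `H k`; then `Z-hs` and `vsgn-ZH` absorb these one after the other.
  C⊗E : ∀ k t p → t ∈ vecs m n → p ∈ vecs m n → T (dec t) → T (dec p) → (C k ⊗ E k) t p ≡ ⟦ Z k t p ⟧
  C⊗E zero    t p t∈ p∈ dt dp = ∑-eqVˡ t (λ r → ⟦ eqV r p ⟧) t∈
  C⊗E (suc k) t p t∈ p∈ dt dp =
    trans (⊗-assoc (V (suc k)) (C k) (E k ⊗ H k) t p)
    (trans (∑-cong∈ (vecs m n) (λ t′ t′∈ → trans
        (⊎-cong (V-supp (suc k) t t′) (λ v → inner t′ t′∈ (∧-right {dec t} (proj₁ v))))
                                                (trans (·-assoc ⟦ dec t ∧ dec t′ ⟧ _ _) (dropDec t′))))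
           (vsgn-ZH k t p t∈ p∈ dt))
    where
    inner : ∀ t′ → t′ ∈ vecs m n → T (dec t′) → (C k ⊗ (E k ⊗ H k)) t′ p ≡ ⟦ ZH k t′ p ⟧
    inner t′ t′∈ dt′ =
      trans (sym (⊗-assoc (C k) (E k) (H k) t′ p))
      (trans (∑-cong∈ (vecs m n) (λ p′ p′∈ → ⊎-congʳ (⟦⟧-⊎ (hs k p′ p)) (λ h →
                C⊗E k t′ p′ t′∈ p′∈ dt′ (Dec⇒dec p′ (HStrip⇒Dec k p′ p (dec⇒Dec p dp) (hs⇒HStrip k p′ p h))))))
             (Z-hs k t′ p t′∈ p∈))
    Dec-t′ : ∀ t′ → VStrip (suc k) t t′ → T (ZH k t′ p) → Dec t′
    Dec-t′ t′ v z i with ≤-<-connex k i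
    ... | inj₁ k≤i = ≤-trans (proj₁ (ZH-elim k t′ p z (suc i))) (proj₂ (ZH-elim k t′ p z i) k≤i)
    ... | inj₂ i<k = subst₂ _≤_ (proj₂ (proj₂ (v (suc i))) (s≤s i<k))
        (proj₂ (proj₂ (v i)) (≤-trans i<k (n≤1+n k)))
                            (dec⇒Dec t dt i)
    dropDec : ∀ t′ → ⟦ dec t ∧ dec t′ ⟧ · (vsgn (suc k) t t′ · ⟦ ZH k t′ p ⟧) ≡ vsgn (suc k) t t′ ·
        ⟦ ZH k t′ p ⟧
    dropDec t′ with ·-⊎ (vsgn-supp (suc k) t t′) (⟦⟧-⊎ (ZH k t′ p))
    ... | inj₁ z       = trans (0·′ ⟦ dec t ∧ dec t′ ⟧ z) (sym z)
    ... | inj₂ (v , z) = ⟦true⟧· _ (T⇒≡ (∧-intro dt (Dec⇒dec t′ (Dec-t′ t′ v z))))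

  module _ (w : ℕ → ℕ → ℤ) (w-law : Law w) where
    open Intertwine m w w-law

    G : ℕ → Mat
    G k q r = g w k q r 0 0

    -- A nonzero entry of `G` forces both of its indices to be decreasing. The indicator inside `V`
    -- can therefore be expressed by the outer indices `q` and `r` on either side and pulled out of
    -- the sum.
    G⊗V : ∀ k q r → q ∈ vecs m n → r ∈ vecs m n → T (lastZ r) →
          (G (suc k) ⊗ V (suc k)) q r ≡ (V (suc k) ⊗ G k) q r
    G⊗V k q r q∈ r∈ lz =
      trans (trans (∑-cong (vecs m n) left) (∑-*ˡ (vecs m n) ⟦ dec q ∧ dec r ⟧ _))
      (trans (⟦⟧-cond (dec q ∧ dec r) (λ d → g-vsgn k q r 0 0 q∈ r∈ (∧-left d) (∧-right {dec q} d) lz))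
             (sym (trans (∑-cong (vecs m n) right) (∑-*ˡ (vecs m n) ⟦ dec q ∧ dec r ⟧ _))))
      where
      left : ∀ s → G (suc k) q s · V (suc k) s r ≡ ⟦ dec q ∧ dec r ⟧ · (G (suc k) q s · vsgn (suc k) s r)
      left s = trans (⊎-cong (g-supp w (suc k) q s 0 0) (λ h → cong (λ b → ⟦ b ∧ dec r ⟧ · vsgn (suc k) s r)
                        (trans (T⇒≡ (Dec⇒dec s (Interlaced⇒Decʳ q s h)))
                            (sym (T⇒≡ (Dec⇒dec q (Interlaced⇒Decˡ q s h)))))))
                     (·-swap _ _ _)
      right : ∀ s → V (suc k) q s · G k s r ≡ ⟦ dec q ∧ dec r ⟧ · (vsgn (suc k) q s · G k s r)
      right s = trans (⊎-congʳ (g-supp w k s r 0 0) (λ h → cong (λ b → ⟦ dec q ∧ b ⟧ · vsgn (suc k) q s)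
                         (trans (T⇒≡ (Dec⇒dec s (Interlaced⇒Decˡ s r h)))
                             (sym (T⇒≡ (Dec⇒dec r (Interlaced⇒Decʳ s r h)))))))
                      (·-assoc _ _ _)

    C⊗G : ∀ k q r → q ∈ vecs m n → r ∈ vecs m n → T (lastZ r) → (C k ⊗ G 0) q r ≡ (G k ⊗ C k) q r
    C⊗G zero    q r q∈ r∈ lz = trans (∑-eqVˡ q (λ s → G 0 s r) q∈) (sym (∑-eqVʳ r (λ s → G 0 q s) r∈))
    C⊗G (suc k) q r q∈ r∈ lz =
      trans (⊗-assoc (V (suc k)) (C k) (G 0) q r)
      (trans (⊗-cong (V (suc k)) q (λ s s∈ → C⊗G k s r s∈ r∈ lz))
      (trans (sym (⊗-assoc (V (suc k)) (G k) (C k) q r))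
      -- The vector `s` lies below `r` wherever `C k s r` is nonzero, so it inherits the empty last
      -- row.
      (trans (∑-cong∈ (vecs m n) (λ s s∈ → ⊎-congʳ (C-supp k s r) (λ h →
                sym (G⊗V k q s q∈ s∈ (lastZ-intro s
                    (n≤0⇒n≡0 (≤-trans (h (pred n)) (≤-reflexive (lastZ-elim r lz)))))))))
             (⊗-assoc (G (suc k)) (V (suc k)) (C k) q r))))

  -- Matrix of the skew Schur polynomials; the exponent of the largest variable comes first.
  Γ : List ℕ → Mat
  Γ []       = I
  Γ (d ∷ ds) = G (coef d) (coef-law d) 0 ⊗ Γ ds

  -- A column holds each label at most once, so `length ds` labels fill at most that many boxes of a
  -- column: the row of `q` that many steps down already lies inside `p`.
  Γ-supp : ∀ ds q p → (Γ ds q p ≡ 0ℤ) ⊎ (∀ i → at p i ≤ at q i × at q (length ds + i) ≤ at p i)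
  Γ-supp []       q p = map-⊎ (λ e i → ≤-reflexive (cong (λ v → at v i) (sym (eqV⇒≡ q p e))) ,
                                       ≤-reflexive (cong (λ v → at v i) (eqV⇒≡ q p e))) (⟦⟧-⊎ _)
  Γ-supp (d ∷ ds) q p = ∑-⊎ (vecs m n) (λ r →
    map-⊎ (λ { (h , s) i → ≤-trans (proj₁ (s i)) (proj₂ (h i)) , ≤-trans (proj₁ (h (length ds + i)))
        (proj₂ (s i)) })
          (·-⊎ (g-supp (coef d) 0 q r 0 0) (Γ-supp ds r p)))

  -- The right-hand side of the theorem: `C` chooses the part below with its sign, `E` the part
  -- above, and `Γ` is the skew Schur polynomial between the new boundaries.
  Φ : List ℕ → Mat
  Φ ds = C n ⊗ (Γ ds ⊗ E n)

  Φ-[] : ∀ q p → q ∈ vecs m n → p ∈ vecs m n → T (dec q) → T (dec p) → Φ [] q p ≡ ⟦ Z n q p ⟧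
  Φ-[] q p q∈ p∈ dq dp =
    trans (⊗-cong (C n) q (λ s s∈ → ∑-eqVˡ s (λ r → E n r p) s∈)) (C⊗E n q p q∈ p∈ dq dp)

  -- The hypotheses on `p` and `length ds` ensure that the last row is empty: by `Γ-supp` the
  -- intermediate vector reaches at most `length ds` rows further down than its inner boundary,
  -- which lies inside `p`. This is what `C⊗G` requires.
  Φ-∷ : ∀ d ds q p → q ∈ vecs m n → at p (pred n ∸ length ds) ≡ 0 → length ds ≤ pred n →
        Φ (d ∷ ds) q p ≡ (G (coef d) (coef-law d) n ⊗ Φ ds) q p
  Φ-∷ d ds q p q∈ z l =
    trans (⊗-cong (C n) q (λ s s∈ → ⊗-assoc (G (coef d) (coef-law d) 0) (Γ ds) (E n) s p))
    (trans (sym (⊗-assoc (C n) (G (coef d) (coef-law d) 0) (Γ ds ⊗ E n) q p))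
    (trans (∑-cong∈ (vecs m n) (λ r r∈ → ⊎-congʳ (supp r) (λ lz → C⊗G (coef d) (coef-law d) n q r q∈ r∈ lz)))
           (⊗-assoc (G (coef d) (coef-law d) n) (C n) (Γ ds ⊗ E n) q p)))
    where
    supp : ∀ r → ((Γ ds ⊗ E n) r p ≡ 0ℤ) ⊎ T (lastZ r)
    supp r = ∑-⊎ (vecs m n) (λ p′ → map-⊎ (λ { (h , e) → lastZ-intro r (n≤0⇒n≡0
      (subst (_≤ 0) (cong (at r) (m+[n∸m]≡n l))
        (≤-trans (proj₂ (h (pred n ∸ length ds))) (≤-trans (e (pred n ∸ length ds)) (≤-reflexive z))))) })
      (·-⊎ (Γ-supp ds r p′) (E-supp n p′ p)))

-- Telescoping over the inner boundaries inside `p`.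

if-cong : ∀ {c d : Bool} {x y : ℕ} → c ≡ d → (if c then x else y) ≡ (if d then x else y)
if-cong refl = refl

⊕-cancel : ∀ x y → (x ⊕ -1ℤ · y) ⊕ y ≡ x
⊕-cancel x y = trans (⊕-assoc x _ y) (trans (cong (x ⊕_) (trans (⊕-comm _ y) (⊕-inverseʳ y))) (⊕-identityʳ x))

⟦⟧-exclusive : ∀ a b {c} → c ≡ a ∨ b → (T a → T b → ⊥) → ⟦ c ⟧ ≡ ⟦ a ⟧ ⊕ ⟦ b ⟧
⟦⟧-exclusive true  true  _    h = ⊥-elim (h tt tt)
⟦⟧-exclusive true  false refl h = sym (⊕-identityʳ 1ℤ)
⟦⟧-exclusive false true  refl h = sym (⊕-identityˡ 1ℤ)
⟦⟧-exclusive false false refl h = sym (⊕-identityˡ 0ℤ)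

-- For `v = l` the term is a pure power of `x`; for larger `v` the factor `1 - x` makes it the
-- difference of two consecutive powers, so only the power of the last `v` is left.
∑-telescope : ∀ {m} (f : ℕ → ℕ → ℤ) → Law f → ∀ l q j a b → l + j ≤ q → l + j ≤ m →
              ∑ (vals m) (λ v → ⟦ (l ≤ᵇ v) ∧ (v ≤ᵇ l + j) ⟧ · f (a + (q ∸ v)) (if l <ᵇ v then suc b else b))
              ≡ f (a + (q ∸ (l + j))) b
∑-telescope {m} f law l q zero a b h₁ h₂ rewrite +-identityʳ l =
  trans (∑-single _ (vals-unique m) (∈-vals⁺ h₂) (λ v _ v≢l → ⟦false⟧· _ (outside v v≢l)))
  (trans (⟦true⟧· _ (cong₂ _∧_ (≤ᵇ-true (≤-refl {l})) (≤ᵇ-true (≤-refl {l}))))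
         (cong (f (a + (q ∸ l))) (if-cong (<ᵇ-false (≤-refl {l})))))
  where
  outside : ∀ v → v ≢ l → ((l ≤ᵇ v) ∧ (v ≤ᵇ l)) ≡ false
  outside v v≢l = ¬T⇒≡ (λ t → v≢l (≤-antisym (≤ᵇ⇒≤ v l (∧-right {l ≤ᵇ v} t)) (≤ᵇ⇒≤ l v (∧-left t))))
∑-telescope {m} f law l q (suc j) a b h₁ h₂ rewrite +-suc l j =
  trans (∑-cong (vals m) (λ v → trans (cong (_· X v) (split v)) (·-distribʳ (X v) _ _)))
  (trans (∑-+ (vals m) _ _)
  (trans (cong₂ _⊕_ (trans (∑-telescope f law l q j a b (<⇒≤ h₁) (<⇒≤ h₂)) (cong (λ z → f z b) (+-suc-∸ a h₁)))
                    (trans (∑-δ X h₂) (trans (cong (f c) (if-cong (<ᵇ-true (s≤s (m≤m+n l j))))) (law c b))))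
  (trans (⊕-comm _ _) (⊕-cancel (f c b) (f (suc c) b)))))
  where
  t = suc (l + j)
  c = a + (q ∸ t)
  X : ℕ → ℤ
  X v = f (a + (q ∸ v)) (if l <ᵇ v then suc b else b)
  split : ∀ v → ⟦ (l ≤ᵇ v) ∧ (v ≤ᵇ t) ⟧ ≡ ⟦ (l ≤ᵇ v) ∧ (v ≤ᵇ l + j) ⟧ ⊕ ⟦ v ≡ᵇ t ⟧
  split v = ⟦⟧-exclusive _ (v ≡ᵇ t)
    (T⇔⇒≡ (λ h → from T-∨ (by (m≤n⇒m<n∨m≡n (≤ᵇ⇒≤ v t (∧-right {l ≤ᵇ v} h))) h)) back)
    (λ h e → n≮n (l + j) (subst (_≤ l + j) (≡ᵇ⇒≡ v t e) (≤ᵇ⇒≤ v (l + j) (∧-right {l ≤ᵇ v} h))))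
    where
    by : v < t ⊎ v ≡ t → T ((l ≤ᵇ v) ∧ (v ≤ᵇ t)) → T ((l ≤ᵇ v) ∧ (v ≤ᵇ l + j)) ⊎ T (v ≡ᵇ t)
    by (inj₁ (s≤s x)) h = inj₁ (∧-intro (∧-left h) (≤⇒≤ᵇ x))
    by (inj₂ e)       h = inj₂ (≡⇒≡ᵇ v t e)
    back : T (((l ≤ᵇ v) ∧ (v ≤ᵇ l + j)) ∨ (v ≡ᵇ t)) → T ((l ≤ᵇ v) ∧ (v ≤ᵇ t))
    back h with to T-∨ h
    ... | inj₁ x = ∧-intro (∧-left x) (≤⇒≤ᵇ (≤-trans (≤ᵇ⇒≤ v (l + j) (∧-right {l ≤ᵇ v} x)) (n≤1+n (l + j))))
    ... | inj₂ e rewrite ≡ᵇ⇒≡ v t e = ∧-intro (≤⇒≤ᵇ (≤-trans (m≤m+n l j) (n≤1+n (l + j)))) (≤⇒≤ᵇ (≤-refl {t}))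

-- One row of the change of weights; `q₂` and `p₂` are the ends of the row below. An end `v > p`
-- keeps its weight, because `p₂ ≤ p` cannot affect the comparisons with `v`. All ends `v ≤ p` are
-- clipped to `p`, and their weights telescope to a single one without the factor `1 - x`; this is
-- why `gp` demands `p < u` for a factor.
module _ {m : ℕ} (F : ℕ → ℕ → ℕ → ℤ) (F-law : ∀ u → Law (F u))
         (q p q₂ p₂ a b : ℕ) (q₂≤q : q₂ ≤ q) (p₂≤p : p₂ ≤ p) (q≤m : q ≤ m) (p≤m : p ≤ m) where

  private
    freeTerm clippedTerm : ℕ → ℤ
    freeTerm v = ⟦ (q₂ ≤ᵇ v) ∧ (v ≤ᵇ q) ⟧ · F (v ⊔ p) (a + (q ∸ v)) (if q₂ <ᵇ v then suc b else b)
    clippedTerm u = ⟦ (p ≤ᵇ u) ∧ ((q₂ ⊔ p₂ ≤ᵇ u) ∧ (u ≤ᵇ q ⊔ p)) ⟧ ·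
                    F u (a + ((q ⊔ p) ∸ u)) (if (p <ᵇ u) ∧ (q₂ ⊔ p₂ <ᵇ u) then suc b else b)

    above : ∀ v → p < v → freeTerm v ≡ clippedTerm v
    above v p<v with ≤-<-connex v q
    ... | inj₁ v≤q = cong₂ _·_
          (cong ⟦_⟧ (cong₂ _∧_ {x = true} {y = p ≤ᵇ v} (sym (≤ᵇ-true (<⇒≤ p<v)))
             (cong₂ _∧_ (T⇔⇒≡ (λ t → ≤⇒≤ᵇ (⊔-lub (≤ᵇ⇒≤ q₂ v t) (≤-trans p₂≤p (<⇒≤ p<v))))
                              (λ t → ≤⇒≤ᵇ (≤-trans (m≤m⊔n q₂ p₂) (≤ᵇ⇒≤ (q₂ ⊔ p₂) v t))))
                        (cong (v ≤ᵇ_) (sym q⊔p)))))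
          (trans (cong₂ (λ x y → F x (a + (y ∸ v)) (if q₂ <ᵇ v then suc b else b)) (m≥n⇒m⊔n≡m (<⇒≤ p<v))
              (sym q⊔p))
                 (cong (F v (a + ((q ⊔ p) ∸ v)))
                       (if-cong (cong₂ _∧_ {x = true} {y = p <ᵇ v} (sym (<ᵇ-true p<v))
                         (T⇔⇒≡ (λ t → <⇒<ᵇ (⊔-lub (<ᵇ⇒< q₂ v t) (≤-<-trans p₂≤p p<v)))
                               (λ t → <⇒<ᵇ (≤-<-trans (m≤m⊔n q₂ p₂) (<ᵇ⇒< (q₂ ⊔ p₂) v t))))))))
          where q⊔p = m≥n⇒m⊔n≡m (≤-trans (<⇒≤ p<v) v≤q)
    ... | inj₂ q<v = trans (⟦false⟧· _ (trans (cong ((q₂ ≤ᵇ v) ∧_) (≤ᵇ-false q<v)) (∧-zeroʳ _)))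
                           (sym (⟦false⟧· _ (¬T⇒≡ (λ t → n≮n v (≤-<-trans
                              (≤ᵇ⇒≤ v (q ⊔ p) (∧-right {q₂ ⊔ p₂ ≤ᵇ v} (∧-right {p ≤ᵇ v} t)))
                                  (⊔-lub q<v p<v))))))

    below : ∑ (vals m) (λ v → ⟦ v ≤ᵇ p ⟧ · freeTerm v) ≡ clippedTerm p
    below with ≤-<-connex q₂ p
    ... | inj₂ p<q₂ =
      trans (∑-zero (vals m) (λ v _ → vanish v (≤-<-connex v p)))
            (sym (⟦false⟧· _ (¬T⇒≡ (λ t → n≮n p (<-≤-trans p<q₂
              (≤-trans (m≤m⊔n q₂ p₂) (≤ᵇ⇒≤ (q₂ ⊔ p₂) p (∧-left (∧-right {p ≤ᵇ p} t)))))))))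
      where
      vanish : ∀ v → v ≤ p ⊎ p < v → ⟦ v ≤ᵇ p ⟧ · freeTerm v ≡ 0ℤ
      vanish v (inj₁ h) = 0·′ ⟦ v ≤ᵇ p ⟧ (⟦false⟧· _ (cong (_∧ (v ≤ᵇ q)) (≤ᵇ-false (≤-<-trans h p<q₂))))
      vanish v (inj₂ h) = ⟦false⟧· _ (≤ᵇ-false h)
    ... | inj₁ q₂≤p =
      trans (∑-cong (vals m) (λ v → clip v (≤-<-connex v p)))
      (trans (∑-telescope {m} (F p) (F-law p) q₂ q j a b (≤-trans (≤-reflexive q₂+j) (m⊓n≤m q p))
                          (≤-trans (≤-reflexive q₂+j) (≤-trans (m⊓n≤m q p) q≤m)))
      (trans (cong (λ z → F p (a + z) b) (trans (cong (q ∸_) q₂+j) (gap (≤-total q p))))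
             (sym (trans (⟦true⟧· _ (cong₂ _∧_ (≤ᵇ-true (≤-refl {p}))
                             (cong₂ _∧_ (≤ᵇ-true (⊔-lub q₂≤p p₂≤p)) (≤ᵇ-true (m≤n⊔m q p)))))
                         (cong (F p (a + ((q ⊔ p) ∸ p)))
                             (if-cong (cong (_∧ (q₂ ⊔ p₂ <ᵇ p)) (<ᵇ-false (≤-refl {p})))))))))
      where
      j = (q ⊓ p) ∸ q₂
      q₂+j : q₂ + j ≡ q ⊓ p
      q₂+j = m+[n∸m]≡n (⊓-glb q₂≤q q₂≤p)
      gap : q ≤ p ⊎ p ≤ q → q ∸ (q ⊓ p) ≡ (q ⊔ p) ∸ p
      gap (inj₁ h) = trans (cong (q ∸_) (m≤n⇒m⊓n≡m h)) (trans (n∸n≡0 q)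
                           (sym (trans (cong (_∸ p) (m≤n⇒m⊔n≡n h)) (n∸n≡0 p))))
      gap (inj₂ h) = cong₂ _∸_ (sym (m≥n⇒m⊔n≡m h)) (m≥n⇒m⊓n≡n h)
      clip : ∀ v → v ≤ p ⊎ p < v → ⟦ v ≤ᵇ p ⟧ · freeTerm v ≡
             ⟦ (q₂ ≤ᵇ v) ∧ (v ≤ᵇ q₂ + j) ⟧ · F p (a + (q ∸ v)) (if q₂ <ᵇ v then suc b else b)
      clip v (inj₁ h) = trans (⟦true⟧· _ (≤ᵇ-true h)) (cong₂ _·_
        (cong (λ z → ⟦ (q₂ ≤ᵇ v) ∧ z ⟧) (T⇔⇒≡
           (λ t → ≤⇒≤ᵇ (≤-trans (⊓-glb (≤ᵇ⇒≤ v q t) h) (≤-reflexive (sym q₂+j))))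
           (λ t → ≤⇒≤ᵇ (≤-trans (≤ᵇ⇒≤ v (q₂ + j) t) (≤-trans (≤-reflexive q₂+j) (m⊓n≤m q p))))))
        (cong (λ z → F z (a + (q ∸ v)) (if q₂ <ᵇ v then suc b else b)) (m≤n⇒m⊔n≡n h)))
      clip v (inj₂ h) = trans (⟦false⟧· _ (≤ᵇ-false h)) (sym (⟦false⟧· _
        (trans (cong ((q₂ ≤ᵇ v) ∧_) (≤ᵇ-false (≤-<-trans (≤-trans (≤-reflexive q₂+j) (m⊓n≤n q p)) h)))
            (∧-zeroʳ _))))

  ∑-clip : ∑ (vals m) freeTerm ≡ ∑ (vals m) clippedTerm
  ∑-clip =
    trans (∑-cong (vals m) (λ v → trans (sym (·-identityˡ _))
        (trans (cong (_· freeTerm v) (dichotomy v)) (·-distribʳ _ _ _))))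
    (trans (∑-+ (vals m) _ _)
    (trans (cong₂ _⊕_ below (∑-cong (vals m) (λ v → ⟦⟧-cond (p <ᵇ v) (λ t → above v (<ᵇ⇒< p v t)))))
    (trans (cong (_⊕ ∑ (vals m) (λ v → ⟦ p <ᵇ v ⟧ · clippedTerm v)) (sym (∑-δ clippedTerm p≤m)))
    (trans (sym (∑-+ (vals m) _ _))
           (∑-cong (vals m) (λ v → trans (sym (·-distribʳ _ _ _)) (collect v (<-cmp v p))))))))
    where
    dichotomy : ∀ v → 1ℤ ≡ ⟦ v ≤ᵇ p ⟧ ⊕ ⟦ p <ᵇ v ⟧
    dichotomy v = ⟦⟧-exclusive (v ≤ᵇ p) (p <ᵇ v) {true} (sym (T⇒≡ (from T-∨ (by (≤-<-connex v p)))))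
      (λ h₁ h₂ → n≮n p (<-≤-trans (<ᵇ⇒< p v h₂) (≤ᵇ⇒≤ v p h₁)))
      where
      by : v ≤ p ⊎ p < v → T (v ≤ᵇ p) ⊎ T (p <ᵇ v)
      by (inj₁ h) = inj₁ (≤⇒≤ᵇ h)
      by (inj₂ h) = inj₂ (<⇒<ᵇ h)
    collect : ∀ v → Tri (v < p) (v ≡ p) (p < v) → (⟦ v ≡ᵇ p ⟧ ⊕ ⟦ p <ᵇ v ⟧) · clippedTerm v ≡ clippedTerm v
    collect v (tri< h _ _) = trans (0·′ _ z) (sym z)
      where z = ⟦false⟧· _ (cong (_∧ ((q₂ ⊔ p₂ ≤ᵇ v) ∧ (v ≤ᵇ q ⊔ p))) (≤ᵇ-false h))
    collect v (tri≈ _ refl _) = trans (cong (_· clippedTerm v)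
      (trans (cong₂ (λ x y → ⟦ x ⟧ ⊕ ⟦ y ⟧) (≡ᵇ-refl v) (<ᵇ-false (≤-refl {v}))) (⊕-identityʳ 1ℤ)))
          (·-identityˡ _)
    collect v (tri> _ e h) = trans (cong (_· clippedTerm v)
      (trans (cong₂ (λ x y → ⟦ x ⟧ ⊕ ⟦ y ⟧) (≡ᵇ-false e) (<ᵇ-true h)) (⊕-identityˡ 1ℤ))) (·-identityˡ _)

_⊔ᵛ_ : ∀ {n} → Vec ℕ n → Vec ℕ n → Vec ℕ n
[]       ⊔ᵛ []       = []
(x ∷ xs) ⊔ᵛ (y ∷ ys) = (x ⊔ y) ∷ (xs ⊔ᵛ ys)

hd0-⊔ : ∀ {n} (xs ys : Vec ℕ n) → hd0 (xs ⊔ᵛ ys) ≡ hd0 xs ⊔ hd0 ys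
hd0-⊔ []       []       = refl
hd0-⊔ (x ∷ xs) (y ∷ ys) = refl

-- The weight g with every row eligible for the factor 1 - x, except that the last box of u in a row must
-- lie outside p.
gp : (ℕ → ℕ → ℤ) → ∀ {n} → Vec ℕ n → Vec ℕ n → Vec ℕ n → ℕ → ℕ → ℤ
gp w []       []       []       a b = w a b
gp w (p ∷ ps) (s ∷ ss) (u ∷ us) a b =
  ⟦ (p ≤ᵇ u) ∧ ((hd0 ss ≤ᵇ u) ∧ (u ≤ᵇ s)) ⟧ ·
  gp w ps ss us (a + (s ∸ u)) (if (p <ᵇ u) ∧ (hd0 ss <ᵇ u) then suc b else b)

if-suc : ∀ c b → (if c then suc (suc b) else suc b) ≡ suc (if c then suc b else b)
if-suc true  b = refl
if-suc false b = refl

gp-law : ∀ {w} → Law w → ∀ {n} (p s u : Vec ℕ n) → Law (gp w p s u)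
gp-law l []       []       []       a b = l a b
gp-law {w} l (p ∷ ps) (s ∷ ss) (u ∷ us) a b =
  trans (cong (λ b′ → c · gp w ps ss us a′ b′) (if-suc ((p <ᵇ u) ∧ (hd0 ss <ᵇ u)) b))
        (Law-· c {gp w ps ss us} (gp-law l ps ss us) a′ (if (p <ᵇ u) ∧ (hd0 ss <ᵇ u) then suc b else b))
  where
  c = ⟦ (p ≤ᵇ u) ∧ ((hd0 ss ≤ᵇ u) ∧ (u ≤ᵇ s)) ⟧
  a′ = a + (s ∸ u)

-- In a row where r may end anywhere inside p, the weights of the possible ends telescope.
∑-g-⊔ : ∀ {m} w → Law w → ∀ {n} (q p : Vec ℕ n) (h : Vec ℕ n → ℤ) a b →
        q ∈ vecs m n → p ∈ vecs m n → T (dec q) → T (dec p) →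
        ∑ (vecs m n) (λ r → g w n q r a b · h (r ⊔ᵛ p)) ≡ ∑ (vecs m n) (λ u → gp w p (q ⊔ᵛ p) u a b · h u)
∑-g-⊔ w l []       []       h a b _  _  _  _  = trans (∑-[ [] ] _) (sym (∑-[ [] ] _))
∑-g-⊔ {m} w l {suc n} (q ∷ qs) (p ∷ ps) h a b q∈ p∈ dq dp with ∈-vecs⁻ q∈ | ∈-vecs⁻ p∈
... | q≤m , qs∈ | p≤m , ps∈ =
  trans (∑-vecs m n _)
  (trans (∑-cong (vals m) (λ v →
           trans (∑-cong (vecs m n) (λ vs → ·-assoc ⟦ (hd0 qs ≤ᵇ v) ∧ (v ≤ᵇ q) ⟧ _ _))
           (trans (∑-*ˡ (vecs m n) ⟦ (hd0 qs ≤ᵇ v) ∧ (v ≤ᵇ q) ⟧ _)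
                  (cong (⟦ (hd0 qs ≤ᵇ v) ∧ (v ≤ᵇ q) ⟧ ·_)
                        (∑-g-⊔ w l qs ps (λ vs → h ((v ⊔ p) ∷ vs)) _ _ qs∈ ps∈ (dec-tail q qs dq)
                            (dec-tail p ps dp))))))
  (trans (∑-clip F (λ u → Law-∑ (vecs m n) {λ us a b → gp w ps (qs ⊔ᵛ ps) us a b · h (u ∷ us)}
                            (λ us → Law-·ʳ (h (u ∷ us)) (gp-law l ps (qs ⊔ᵛ ps) us)))
                 q p (hd0 qs) (hd0 ps) a b (dec-hd q qs dq) (dec-hd p ps dp) q≤m p≤m)
         (sym (trans (∑-vecs m n _) (∑-cong (vals m) (λ u →
            trans (∑-cong (vecs m n) (λ us → ·-assoc _ _ _))
            (trans (∑-*ˡ (vecs m n) _ _)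
                   (cong (λ z → ⟦ (p ≤ᵇ u) ∧ ((z ≤ᵇ u) ∧ (u ≤ᵇ q ⊔ p)) ⟧ ·
                                F u (a + ((q ⊔ p) ∸ u)) (if (p <ᵇ u) ∧ (z <ᵇ u) then suc b else b))
                         (hd0-⊔ qs ps)))))))))
  where
  F : ℕ → ℕ → ℕ → ℤ
  F u a b = ∑ (vecs m n) (λ us → gp w ps (qs ⊔ᵛ ps) us a b · h (u ∷ us))

at-⊔ : ∀ {n} (q p : Vec ℕ n) i → at (q ⊔ᵛ p) i ≡ at q i ⊔ at p i
at-⊔ []       []       i       = refl
at-⊔ (q ∷ qs) (p ∷ ps) zero    = refl
at-⊔ (q ∷ qs) (p ∷ ps) (suc i) = at-⊔ qs ps i

-- The expansion equals the Grothendieck matrix.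

module _ (m n : ℕ) where
  open Matrix m n

  -- Matrix of the skew stable Grothendieck polynomials; the exponent of the largest variable comes first.
  Groth : List ℕ → Mat
  Groth []       s p = I s p
  Groth (d ∷ ds) s p = ∑ (vecs m n) (λ u → gp (coef d) p s u 0 0 · Groth ds u p)

  -- The inner vectors reached through `G` need not contain `p`, so the induction must allow such
  -- `q`; only `q ⊔ᵛ p` matters, since row ends inside `p` are summed out. `R` bounds the rows met
  -- by `p`, and the inequality with `pred n` keeps one spare row for each remaining variable.
  Φ≡Groth⊔ : ∀ ds R q p → (∀ i → R ≤ i → at p i ≡ 0) → R + length ds ≤ pred n →
             q ∈ vecs m n → p ∈ vecs m n → T (dec q) → T (dec p) → Φ ds q p ≡ Groth ds (q ⊔ᵛ p) p
  Φ≡Groth⊔ [] R q p z l q∈ p∈ dq dp =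
    trans (Φ-[] q p q∈ p∈ dq dp)
          (cong ⟦_⟧ (T⇔⇒≡
            (λ t → ≡⇒T (trans (cong (λ v → eqV v p) (at-ext (q ⊔ᵛ p) p (λ i →
                      trans (at-⊔ q p i) (m≤n⇒m⊔n≡n (Z-elim n q p t i))))) (eqV-refl p)))
            (λ t → Z-intro n q p ≤-refl (λ i → ≤-trans (m≤m⊔n (at q i) (at p i))
                      (≤-reflexive (trans (sym (at-⊔ q p i)) (cong (λ v → at v i) (eqV⇒≡ (q ⊔ᵛ p) p t))))))))
  Φ≡Groth⊔ (d ∷ ds) R q p z l q∈ p∈ dq dp =
    trans (Φ-∷ d ds q p q∈ (z _ (m+n≤o⇒m≤o∸n R l′)) (≤-trans (m≤n+m (length ds) R) l′))
    (trans (∑-cong∈ (vecs m n) (λ r r∈ → ⊎-cong (g-supp (coef d) n q r 0 0) (λ h →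
              Φ≡Groth⊔ ds R r p z l′ r∈ p∈ (Dec⇒dec r (Interlaced⇒Decʳ q r h)) dp)))
           (∑-g-⊔ (coef d) (coef-law d) q p (λ u → Groth ds u p) 0 0 q∈ p∈ dq dp))
    where
    l′ : R + length ds ≤ pred n
    l′ = ≤-trans (≤-trans (n≤1+n _) (≤-reflexive (sym (+-suc R (length ds))))) l

  Φ≡Groth : ∀ ds R q p → (∀ i → R ≤ i → at p i ≡ 0) → R + length ds ≤ pred n →
            q ∈ vecs m n → p ∈ vecs m n → T (dec q) → T (dec p) → p ≤ᵛ q → Φ ds q p ≡ Groth ds q p
  Φ≡Groth ds R q p z l q∈ p∈ dq dp p≤q =
    trans (Φ≡Groth⊔ ds R q p z l q∈ p∈ dq dp)
          (cong (λ v → Groth ds v p) (at-ext (q ⊔ᵛ p) q (λ i → trans (at-⊔ q p i) (m≥n⇒m⊔n≡m (p≤q i)))))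

-- Sums over the ways to distribute a list into an ordered pair of sublists

splits : List A → List (List A × List A)
splits []       = ([] , []) ∷ []
splits (x ∷ xs) = map (λ (s , t) → x ∷ s , t) (splits xs) ++ map (λ (s , t) → s , x ∷ t) (splits xs)

∑-splits-∷ : ∀ (x : A) xs (f : List A → List A → ℤ) →
             ∑ (splits (x ∷ xs)) (λ (s , t) → f s t)
             ≡ ∑ (splits xs) (λ (s , t) → f (x ∷ s) t) ⊕ ∑ (splits xs) (λ (s , t) → f s (x ∷ t))
∑-splits-∷ x xs f =
  trans (∑-++ (map _ (splits xs)) _ _) (cong₂ _⊕_ (∑-map (splits xs) _ _) (∑-map (splits xs) _ _))

∑-splits-++ : ∀ (xs ys : List A) (f : List A → List A → ℤ) →
              ∑ (splits (xs ++ ys)) (λ (s , t) → f s t)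
              ≡ ∑ (splits xs) (λ (s , t) → ∑ (splits ys) (λ (s′ , t′) → f (s ++ s′) (t ++ t′)))
∑-splits-++ []       ys f = sym (∑-[ ([] , []) ] _)
∑-splits-++ (x ∷ xs) ys f =
  trans (∑-splits-∷ x (xs ++ ys) f)
  (trans (cong₂ _⊕_ (∑-splits-++ xs ys (λ s t → f (x ∷ s) t)) (∑-splits-++ xs ys (λ s t → f s (x ∷ t))))
         (sym (∑-splits-∷ x xs (λ s t → ∑ (splits ys) (λ (s′ , t′) → f (s ++ s′) (t ++ t′))))))

record SplitOf {A : Set} (xs s t : List A) : Set where
  field
    left  : ∀ {x} → x ∈ s → x ∈ xs
    right : ∀ {x} → x ∈ t → x ∈ xs
    cover : ∀ {x} → x ∈ xs → x ∈ s ⊎ x ∈ t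
open SplitOf

splitOf : ∀ (xs : List A) {s t} → (s , t) ∈ splits xs → SplitOf xs s t
splitOf []       (here refl) = record { left = λ () ; right = λ () ; cover = λ () }
splitOf (x ∷ xs) h with ∈-++⁻ (map _ (splits xs)) h
... | inj₁ h′ with ∈-map⁻ _ h′
... | (s , t) , st∈ , refl = record
  { left  = λ { (here e) → here e ; (there y) → there (left so y) }
  ; right = λ y → there (right so y)
  ; cover = λ { (here e) → inj₁ (here e) ; (there y) → Sum.map₁ there (cover so y) } }
  where so = splitOf xs st∈
splitOf (x ∷ xs) h | inj₂ h′ with ∈-map⁻ _ h′
... | (s , t) , st∈ , refl = record
  { left  = λ y → there (left so y)
  ; right = λ { (here e) → here e ; (there y) → there (right so y) }
  ; cover = λ { (here e) → inj₂ (here e) ; (there y) → Sum.map₂ there (cover so y) } }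
  where so = splitOf xs st∈

null : List A → Bool
null []      = true
null (_ ∷ _) = false

∑-splits-nullˡ : ∀ (xs : List A) (f : List A → List A → ℤ) →
                 ∑ (splits xs) (λ (s , t) → ⟦ null s ⟧ · f s t) ≡ f [] xs
∑-splits-nullˡ []       f = trans (∑-[ ([] , []) ] _) (·-identityˡ _)
∑-splits-nullˡ (x ∷ xs) f =
  trans (∑-splits-∷ x xs (λ s t → ⟦ null s ⟧ · f s t))
  (trans (cong₂ _⊕_ (∑-zero (splits xs) (λ _ _ → ·-zeroˡ _)) (∑-splits-nullˡ xs (λ s t → f s (x ∷ t))))
         (⊕-identityˡ _))

∑-splits-nullʳ : ∀ (xs : List A) (f : List A → List A → ℤ) →
                 ∑ (splits xs) (λ (s , t) → ⟦ null t ⟧ · f s t) ≡ f xs []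
∑-splits-nullʳ []       f = trans (∑-[ ([] , []) ] _) (·-identityˡ _)
∑-splits-nullʳ (x ∷ xs) f =
  trans (∑-splits-∷ x xs (λ s t → ⟦ null t ⟧ · f s t))
  (trans (cong₂ _⊕_ (∑-splits-nullʳ xs (λ s t → f (x ∷ s) t)) (∑-zero (splits xs) (λ _ _ → ·-zeroˡ _)))
         (⊕-identityʳ _))

-- Sums over fillings, organised by the boxes of the largest label.

opaque
  Fill : {U : Set} → List U → List Box → (List (Box × U) → ℤ) → ℤ
  Fill vs bs f = ∑ (fillingsFrom vs bs) (λ T → f (zip bs T))

opaque
  unfolding Fill

  Fill-def : ∀ {U : Set} (vs : List U) bs f → Fill vs bs f ≡ ∑ (fillingsFrom vs bs) (λ T → f (zip bs T))
  Fill-def vs bs f = refl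

  Fill-[] : ∀ {U : Set} (vs : List U) f → Fill vs [] f ≡ f []
  Fill-[] vs f = ∑-[ [] ] _

  Fill-∷ : ∀ {U : Set} (vs : List U) b bs f → Fill vs (b ∷ bs) f ≡ ∑ vs
      (λ v → Fill vs bs (λ z → f ((b , v) ∷ z)))
  Fill-∷ vs b bs f =
    trans (∑-concatMap vs _ _) (∑-cong vs (λ v → ∑-map (fillingsFrom vs bs) (v ∷_) _))

  Fill-⊕ : ∀ {U : Set} (vs : List U) bs (f h : List (Box × U) → ℤ) →
           Fill vs bs (λ z → f z ⊕ h z) ≡ Fill vs bs f ⊕ Fill vs bs h
  Fill-⊕ vs bs f h = ∑-+ (fillingsFrom vs bs) _ _

  Fill-· : ∀ {U : Set} (vs : List U) bs k (f : List (Box × U) → ℤ) → Fill vs bs (λ z → k · f z) ≡ k · Fill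
      vs bs f
  Fill-· vs bs k f = ∑-*ˡ (fillingsFrom vs bs) k _

module _ {U : Set} where

  Invariant : (List (Box × U) → ℤ) → Set
  Invariant f = ∀ {xs ys} → xs ↭ ys → f xs ≡ f ys

  Fill-cong : ∀ (vs : List U) bs {f h} →
              (∀ z → map proj₁ z ≡ bs → All (λ x → proj₂ x ∈ vs) z → f z ≡ h z) → Fill vs bs f ≡ Fill vs bs h
  Fill-cong vs []       e = trans (Fill-[] vs _) (trans (e [] refl []) (sym (Fill-[] vs _)))
  Fill-cong vs (b ∷ bs) e =
    trans (Fill-∷ vs b bs _)
    (trans (∑-cong∈ vs (λ v v∈ → Fill-cong vs bs (λ z m a → e ((b , v) ∷ z) (cong (b ∷_) m) (v∈ ∷ a))))
           (sym (Fill-∷ vs b bs _)))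

  Fill-empty : ∀ b bs f → Fill {U} [] (b ∷ bs) f ≡ 0ℤ
  Fill-empty b bs f = trans (Fill-∷ [] b bs f) (∑-[] _)

  label : U → List Box → List (Box × U)
  label y = map (_, y)

  -- Sorts the fillings by the set `t` of boxes labelled `y`. These boxes are moved to the end of
  -- the list, which is why `f` must be invariant under permutations.
  Fill-∷ʳ : ∀ (vs : List U) y bs f → Invariant f →
            Fill (vs ++ y ∷ []) bs f ≡ ∑ (splits bs) (λ (s , t) → Fill vs s (λ z → f (z ++ label y t)))
  Fill-∷ʳ vs y []       f inv = trans (Fill-[] _ f) (sym (trans (∑-[ ([] , []) ] _) (Fill-[] vs _)))
  Fill-∷ʳ vs y (b ∷ bs) f inv =
    trans (Fill-∷ (vs ++ y ∷ []) b bs f)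
    (trans (∑-++ vs (y ∷ []) _)
    (trans (cong₂ _⊕_
      (trans (∑-cong vs (λ v → Fill-∷ʳ vs y bs (λ z → f ((b , v) ∷ z)) (λ p → inv (↭-prep _ p))))
      (trans (∑-swap vs (splits bs) _)
             (∑-cong (splits bs) (λ (s , t) → sym (Fill-∷ vs b s (λ z → f (z ++ label y t)))))))
      (trans (∑-[ y ] _)
      (trans (Fill-∷ʳ vs y bs (λ z → f ((b , y) ∷ z)) (λ p → inv (↭-prep _ p)))
             (∑-cong (splits bs) (λ (s , t) → Fill-cong vs s (λ z _ _ →
                inv (↭-sym (Permₚ.shift (b , y) z (label y t)))))))))
           (sym (∑-splits-∷ b bs (λ s t → Fill vs s (λ z → f (z ++ label y t)))))))

  module _ (ad : U → U) where

    relabel : List (Box × U) → List (Box × U)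
    relabel = map (λ x → proj₁ x , ad (proj₂ x))

    -- The set-valued version: a box holds an old set (`o`), an old set enlarged by the new label
    -- (`u`, through `ad`), or the new label alone (`t`).
    Fill-∷ʳ-ad : ∀ (vs vs′ : List U) y →
                 (∀ f → ∑ vs′ f ≡ ∑ vs (λ v → f v ⊕ f (ad v)) ⊕ f y) → ∀ bs f → Invariant f →
                 Fill vs′ bs f ≡ ∑ (splits bs) (λ (s , t) → Fill vs s (λ z →
                   ∑ (splits z) (λ (o , u) → f (o ++ (relabel u ++ label y t)))))
    Fill-∷ʳ-ad vs vs′ y e []       f inv =
      trans (Fill-[] _ f) (sym (trans (∑-[ _ ] _) (trans (Fill-[] vs _) (∑-[ _ ] _))))
    Fill-∷ʳ-ad vs vs′ y e (b ∷ bs) f inv =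
      trans (Fill-∷ vs′ b bs f)
      (trans (e _)
      (trans (cong₂ _⊕_
        (trans (∑-cong vs (λ v → cong₂ _⊕_ (ih v) (ih (ad v))))
        (trans (∑-cong vs (λ v → sym (∑-+ (splits bs) _ _)))
        (trans (∑-swap vs (splits bs) _)
               (∑-cong (splits bs) (λ (s , t) →
                  trans (∑-cong vs (λ v → sym (Fill-⊕ vs s _ _)))
                  (sym (trans (Fill-∷ vs b s _)
                         (∑-cong vs (λ v → Fill-cong vs s (λ z _ _ →
                            trans (∑-splits-∷ (b , v) z (body t))
                                  (cong (∑ (splits z) (λ (o , u) → body t ((b , v) ∷ o) u) ⊕_)
                                      (∑-cong (splits z) (λ (o , u) → inv
                                      (Permₚ.shift (b , ad v) o _))))))))))))))
        (trans (ih y) (∑-cong (splits bs) (λ (s , t) → Fill-cong vs s (λ z _ _ → ∑-cong (splits z) (λ (o , u) →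
           inv (↭-trans (Perm.↭-reflexive (cong ((b , y) ∷_) (sym (++-assoc o (relabel u) (label y t)))))
               (↭-trans (↭-sym (Permₚ.shift (b , y) (o ++ relabel u) (label y t)))
                        (Perm.↭-reflexive (++-assoc o (relabel u) _))))))))))
             (sym (∑-splits-∷ b bs (λ s t → Fill vs s (λ z → ∑ (splits z) (λ (o , u) → body t o u)))))))
      where
      body : List Box → List (Box × U) → List (Box × U) → ℤ
      body t o u = f (o ++ (relabel u ++ label y t))
      ih : ∀ v → Fill vs′ bs (λ z → f ((b , v) ∷ z)) ≡ _
      ih v = Fill-∷ʳ-ad vs vs′ y e bs (λ z → f ((b , v) ∷ z)) (λ p → inv (↭-prep _ p))

-- Invariance of the tableau conditions under permutation of the boxes

all-cong : ∀ {p q : A → Bool} (xs : List A) → (∀ x → x ∈ xs → p x ≡ q x) → all p xs ≡ all q xs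
all-cong []       h = refl
all-cong (x ∷ xs) h = cong₂ _∧_ (h x (here refl)) (all-cong xs (λ y y∈ → h y (there y∈)))

all-↭ : ∀ (p : A → Bool) {xs ys} → xs ↭ ys → all p xs ≡ all p ys
all-↭ p {xs} {ys} e = T⇔⇒≡ (λ t → T-all⁺ p (Permₚ.All-resp-↭ e (T-all⁻ p xs t)))
                           (λ t → T-all⁺ p (Permₚ.All-resp-↭ (↭-sym e) (T-all⁻ p ys t)))

allPairs-↭ : ∀ (p : A → A → Bool) {xs ys} → xs ↭ ys → allPairs p xs ≡ allPairs p ys
allPairs-↭ p {xs} {ys} e = trans (all-↭ _ e) (all-cong ys (λ x _ → all-↭ (p x) e))

T-all-intro : ∀ (p : A → Bool) xs → (∀ x → x ∈ xs → T (p x)) → T (all p xs)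
T-all-intro p xs h = T-all⁺ p (All.tabulate (λ {x} → h x))

T-all-elim : ∀ (p : A → Bool) xs → T (all p xs) → ∀ x → x ∈ xs → T (p x)
T-all-elim p xs t x x∈ = All.lookup (T-all⁻ p xs t) x∈

T-pairs-intro : ∀ (p : A → A → Bool) xs → (∀ x y → x ∈ xs → y ∈ xs → T (p x y)) → T (allPairs p xs)
T-pairs-intro p xs h = T-all-intro _ xs (λ x x∈ → T-all-intro _ xs (λ y y∈ → h x y x∈ y∈))

T-pairs-elim : ∀ (p : A → A → Bool) xs → T (allPairs p xs) → ∀ x y → x ∈ xs → y ∈ xs → T (p x y)
T-pairs-elim p xs t x y x∈ y∈ = T-all-elim _ xs (T-all-elim _ xs t x x∈) y y∈

all-++ : ∀ (p : A → Bool) xs ys → all p (xs ++ ys) ≡ all p xs ∧ all p ys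
all-++ p xs ys = T⇔⇒≡
  (λ h → ∧-intro (T-all-intro p xs (λ x x∈ → T-all-elim p (xs ++ ys) h x (∈-++⁺ˡ x∈)))
                 (T-all-intro p ys (λ x x∈ → T-all-elim p (xs ++ ys) h x (∈-++⁺ʳ xs x∈))))
  (λ h → T-all-intro p (xs ++ ys) (λ x x∈ → pick h x (∈-++⁻ xs x∈)))
  where
  pick : T (all p xs ∧ all p ys) → ∀ x → x ∈ xs ⊎ x ∈ ys → T (p x)
  pick h x (inj₁ x∈) = T-all-elim p xs (∧-left h) x x∈
  pick h x (inj₂ x∈) = T-all-elim p ys (∧-right {all p xs} h) x x∈

count : (A → Bool) → List A → ℕ
count p xs = length (filterᵇ p xs)

b2n : Bool → ℕ
b2n b = if b then 1 else 0

count-∷ : ∀ (p : A → Bool) x xs → count p (x ∷ xs) ≡ b2n (p x) + count p xs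
count-∷ p x xs with p x
... | true  = refl
... | false = refl

count-++ : ∀ (p : A → Bool) xs ys → count p (xs ++ ys) ≡ count p xs + count p ys
count-++ p []       ys = refl
count-++ p (x ∷ xs) ys =
  trans (count-∷ p x (xs ++ ys))
  (trans (cong (λ c → b2n (p x) + c) (count-++ p xs ys))
  (trans (sym (+-assoc (b2n (p x)) _ _)) (cong (λ c → c + count p ys) (sym (count-∷ p x xs)))))

count-↭ : ∀ (p : A → Bool) {xs ys} → xs ↭ ys → count p xs ≡ count p ys
count-↭ p e = Permₚ.↭-length (Permₚ.filter-↭ _ e)

count-none : ∀ (p : A → Bool) xs → (∀ x → x ∈ xs → p x ≡ false) → count p xs ≡ 0
count-none p []       h = refl
count-none p (x ∷ xs) h =
  trans (count-∷ p x xs) (cong₂ _+_ (cong b2n (h x (here refl))) (count-none p xs (λ y y∈ → h y (there y∈))))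

-- Boxes that the largest label can occupy.

open ∨-∧-Solver using (solve; _:*_; _:=_)

T-not : ∀ {b} → ¬ T b → T (not b)
T-not {true}  h = h tt
T-not {false} h = tt

T-not⁻ : ∀ {b} → T (not b) → ¬ T b
T-not⁻ {true} h _ = h

none : (A → A → Bool) → List A → List A → Bool
none R s t = all (λ a → all (λ b → not (R a b)) t) s

none-intro : ∀ (R : A → A → Bool) s t → (∀ a b → a ∈ s → b ∈ t → ¬ T (R a b)) → T (none R s t)
none-intro R s t h = T-all-intro _ s (λ a a∈ → T-all-intro _ t (λ b b∈ → T-not (h a b a∈ b∈)))

none-elim : ∀ (R : A → A → Bool) s t → T (none R s t) → ∀ a b → a ∈ s → b ∈ t → ¬ T (R a b)
none-elim R s t h a b a∈ b∈ = T-not⁻ (T-all-elim _ t (T-all-elim _ s h a a∈) b b∈)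

-- t can be occupied by the largest label of a semistandard tableau of shape s ∪ t.
HS : List Box → List Box → Bool
HS s t = none sameRowLeft t s ∧ (none sameColAbove t s ∧ none sameColAbove t t)

-- t can be occupied by the largest label of a reverse row-strict tableau of shape s ∪ t.
VS : List Box → List Box → Bool
VS s t = none sameRowLeft s t ∧ (none sameColAbove s t ∧ none sameRowLeft t t)

srl-row : ∀ a b → T (sameRowLeft a b) → row a ≡ row b
srl-row a b t = ≡ᵇ⇒≡ (row a) (row b) (∧-left t)

srl-col : ∀ a b → T (sameRowLeft a b) → col a < col b
srl-col a b t = <ᵇ⇒< (col a) (col b) (∧-right {row a ≡ᵇ row b} t)

sca-row : ∀ a b → T (sameColAbove a b) → row a < row b
sca-row a b t = <ᵇ⇒< (row a) (row b) (∧-right {col a ≡ᵇ col b} t)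

sca-col : ∀ a b → T (sameColAbove a b) → col a ≡ col b
sca-col a b t = ≡ᵇ⇒≡ (col a) (col b) (∧-left t)

none-vacuous : ∀ (R : A → A → Bool) s t → (∀ a b → a ∈ s → b ∈ t → ¬ T (R a b)) → none R s t ≡ true
none-vacuous R s t h = T⇒≡ (none-intro R s t h)

none-++ʳ : ∀ (R : A → A → Bool) s t t′ → none R s (t ++ t′) ≡ none R s t ∧ none R s t′
none-++ʳ R s t t′ = T⇔⇒≡
  (λ h → ∧-intro (none-intro R s t (λ a b a∈ b∈ → none-elim R s (t ++ t′) h a b a∈ (∈-++⁺ˡ b∈)))
                 (none-intro R s t′ (λ a b a∈ b∈ → none-elim R s (t ++ t′) h a b a∈ (∈-++⁺ʳ t b∈))))
  (λ h → none-intro R s (t ++ t′) (λ a b a∈ b∈ → pick h a b a∈ (∈-++⁻ t b∈)))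
  where
  pick : T (none R s t ∧ none R s t′) → ∀ a b → a ∈ s → b ∈ t ⊎ b ∈ t′ → ¬ T (R a b)
  pick h a b a∈ (inj₁ b∈) = none-elim R s t (∧-left h) a b a∈ b∈
  pick h a b a∈ (inj₂ b∈) = none-elim R s t′ (∧-right {none R s t} h) a b a∈ b∈

none-++ : ∀ (R : A → A → Bool) s s′ t t′ →
          none R (s ++ s′) (t ++ t′) ≡ (none R s t ∧ none R s t′) ∧ (none R s′ t ∧ none R s′ t′)
none-++ R s s′ t t′ = trans (all-++ _ s s′) (cong₂ _∧_ (none-++ʳ R s t t′) (none-++ʳ R s′ t t′))

none-split : ∀ (R : Box → Box → Bool) {r s t} → SplitOf r s t → ∀ u → none R u r ≡ none R u s ∧ none R u t
none-split R {r} {s} {t} so u = trans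
  (T⇔⇒≡ (λ h → none-intro R u (s ++ t) (λ a b a∈ b∈ → none-elim R u r h a b a∈ (back (∈-++⁻ s b∈))))
        (λ h → none-intro R u r (λ a b a∈ b∈ → none-elim R u (s ++ t) h a b a∈ (forth (cover so b∈)))))
  (none-++ʳ R u s t)
  where
  back : ∀ {b} → b ∈ s ⊎ b ∈ t → b ∈ r
  back (inj₁ h) = left so h
  back (inj₂ h) = right so h
  forth : ∀ {b} → b ∈ s ⊎ b ∈ t → b ∈ s ++ t
  forth (inj₁ h) = ∈-++⁺ˡ h
  forth (inj₂ h) = ∈-++⁺ʳ s h

InRow Below : ℕ → List Box → Set
InRow i s = ∀ {a} → a ∈ s → row a ≡ i
Below i s = ∀ {a} → a ∈ s → i < row a

none-row-++ : ∀ {i} {s₁ s₂ t₁ t₂} → InRow i s₁ → Below i s₂ → InRow i t₁ → Below i t₂ →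
              none sameRowLeft (s₁ ++ s₂) (t₁ ++ t₂) ≡ none sameRowLeft s₁ t₁ ∧ none sameRowLeft s₂ t₂
none-row-++ {i} {s₁} {s₂} {t₁} {t₂} rs₁ rs₂ rt₁ rt₂ =
  trans (none-++ sameRowLeft s₁ s₂ t₁ t₂) (cong₂ _∧_
    (trans (cong (none sameRowLeft s₁ t₁ ∧_) (none-vacuous sameRowLeft s₁ t₂ (λ a b a∈ b∈ t →
       n≮n i (≤-trans (rt₂ b∈) (≤-reflexive (trans (sym (srl-row a b t)) (rs₁ a∈))))))) (∧-identityʳ _))
    (cong (_∧ none sameRowLeft s₂ t₂) (none-vacuous sameRowLeft s₂ t₁ (λ a b a∈ b∈ t →
       n≮n i (≤-trans (rs₂ a∈) (≤-reflexive (trans (srl-row a b t) (rt₁ b∈))))))))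

none-col-++ : ∀ {i} {s₁ s₂ t₁ t₂} → InRow i s₁ → Below i s₂ → InRow i t₁ →
              none sameColAbove (s₁ ++ s₂) (t₁ ++ t₂) ≡ none sameColAbove s₁ t₂ ∧ none sameColAbove s₂ t₂
none-col-++ {i} {s₁} {s₂} {t₁} {t₂} rs₁ rs₂ rt₁ =
  trans (none-++ sameColAbove s₁ s₂ t₁ t₂) (cong₂
      (λ x y → (x ∧ none sameColAbove s₁ t₂) ∧ (y ∧ none sameColAbove s₂ t₂))
    (none-vacuous sameColAbove s₁ t₁ (λ a b a∈ b∈ t → n≮n i (subst₂ _<_ (rs₁ a∈) (rt₁ b∈) (sca-row a b t))))
    (none-vacuous sameColAbove s₂ t₁ (λ a b a∈ b∈ t →
       n≮n i (≤-trans (<⇒≤ (s≤s (rs₂ a∈))) (≤-trans (sca-row a b t) (≤-reflexive (rt₁ b∈)))))))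

module _ {i : ℕ} {s₁ t₁ s₂ t₂ : List Box}
         (rs₁ : InRow i s₁) (rt₁ : InRow i t₁) (rs₂ : Below i s₂) (rt₂ : Below i t₂) where

  -- The new boxes of the top row must avoid lying above `s₂` and above `t₂`. Together this is a
  -- condition against `r`, independent of how `r` is split, which lets the sum over splittings of
  -- the lower rows factor out.
  HS-++ : ∀ {r} → SplitOf r s₂ t₂ → HS (s₁ ++ s₂) (t₁ ++ t₂) ≡
          none sameRowLeft t₁ s₁ ∧ (none sameColAbove t₁ r ∧ HS s₂ t₂)
  HS-++ so =
    trans (cong₂ _∧_ (none-row-++ rt₁ rt₂ rs₁ rs₂)
        (cong₂ _∧_ (none-col-++ rt₁ rt₂ rs₁) (none-col-++ rt₁ rt₂ rt₁)))
    (trans (regroup (none sameRowLeft t₁ s₁) (none sameRowLeft t₂ s₂) (none sameColAbove t₁ s₂)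
                    (none sameColAbove t₂ s₂) (none sameColAbove t₁ t₂) (none sameColAbove t₂ t₂))
           (cong (λ x → none sameRowLeft t₁ s₁ ∧ (x ∧ HS s₂ t₂)) (sym (none-split sameColAbove so t₁))))
    where
    regroup : ∀ a b c d e f → (a ∧ b) ∧ ((c ∧ d) ∧ (e ∧ f)) ≡ a ∧ ((c ∧ e) ∧ (b ∧ (d ∧ f)))
    regroup = solve 6 (λ a b c d e f → (a :* b) :* ((c :* d) :* (e :* f)) := a :*
        ((c :* e) :* (b :* (d :* f)))) refl

  VS-++ : VS (s₁ ++ s₂) (t₁ ++ t₂) ≡
          (none sameRowLeft s₁ t₁ ∧ none sameRowLeft t₁ t₁) ∧ (none sameColAbove s₁ t₂ ∧ VS s₂ t₂)
  VS-++ =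
    trans (cong₂ _∧_ (none-row-++ rs₁ rs₂ rt₁ rt₂)
        (cong₂ _∧_ (none-col-++ rs₁ rs₂ rt₁) (none-row-++ rt₁ rt₂ rt₁ rt₂)))
          (regroup (none sameRowLeft s₁ t₁) (none sameRowLeft s₂ t₂) (none sameColAbove s₁ t₂)
                   (none sameColAbove s₂ t₂) (none sameRowLeft t₁ t₁) (none sameRowLeft t₂ t₂))
    where
    regroup : ∀ a b c d e f → (a ∧ b) ∧ ((c ∧ d) ∧ (e ∧ f)) ≡ (a ∧ e) ∧ (c ∧ (b ∧ (d ∧ f)))
    regroup = solve 6 (λ a b c d e f → (a :* b) :* ((c :* d) :* (e :* f)) := (a :* e) :*
        (c :* (b :* (d :* f)))) refl

-- Shapes row by row, and strips along the outer boundary.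

seg : ℕ → ℕ → List ℕ
seg p zero    = []
seg p (suc k) = suc p ∷ seg (suc p) k

seg-∈⁻ : ∀ p k {j} → j ∈ seg p k → p < j × j ≤ p + k
seg-∈⁻ p (suc k) (here refl) = ≤-refl , ≤-trans (m≤m+n (suc p) k) (≤-reflexive (sym (+-suc p k)))
seg-∈⁻ p (suc k) (there h) with seg-∈⁻ (suc p) k h
... | h₁ , h₂ = <⇒≤ h₁ , ≤-trans h₂ (≤-reflexive (sym (+-suc p k)))

seg-∈⁺ : ∀ p k {j} → p < j → j ≤ p + k → j ∈ seg p k
seg-∈⁺ p zero    h₁ h₂ = ⊥-elim (n≮n p (<-≤-trans h₁ (≤-trans h₂ (≤-reflexive (+-identityʳ p)))))
seg-∈⁺ p (suc k) h₁ h₂ with m≤n⇒m<n∨m≡n h₁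
... | inj₂ refl = here refl
... | inj₁ h    = there (seg-∈⁺ (suc p) k h (≤-trans h₂ (≤-reflexive (+-suc p k))))

seg-length : ∀ p k → length (seg p k) ≡ k
seg-length p zero    = refl
seg-length p (suc k) = cong suc (seg-length (suc p) k)

outer : ∀ {n} → Vec ℕ n → Vec ℕ n → Vec ℕ n → Bool
outer []       []       []       = true
outer (q ∷ qs) (p ∷ ps) (r ∷ rs) = ((p ≤ᵇ r) ∧ (r ≤ᵇ q)) ∧ ((hd0 qs ≤ᵇ r) ∧ outer qs ps rs)

-- The shape whose row i + k occupies the columns j₀ + at p k + 1 , … , j₀ + at q k.
module Boxes (j₀ : ℕ) where

  cell : ℕ → ℕ → Box
  cell i j = i , j₀ + j

  cells : ℕ → List ℕ → List Box
  cells i = map (cell i)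

  cells-row : ∀ i js {a} → a ∈ cells i js → row a ≡ i
  cells-row i js a∈ with ∈-map⁻ _ a∈
  ... | _ , _ , refl = refl

  bx : ∀ {n} → ℕ → Vec ℕ n → Vec ℕ n → List Box
  bx i []       []       = []
  bx i (q ∷ qs) (p ∷ ps) = cells i (seg p (q ∸ p)) ++ bx (suc i) qs ps

  bx-∈⁻ : ∀ {n} i (q p : Vec ℕ n) {b} → b ∈ bx i q p →
          ∃[ k ] ∃[ j ] (b ≡ cell (i + k) j × at p k < j × j ≤ at q k)
  bx-∈⁻ i []       []       ()
  bx-∈⁻ i (q ∷ qs) (p ∷ ps) b∈ with ∈-++⁻ (cells i (seg p (q ∸ p))) b∈
  ... | inj₁ h with ∈-map⁻ _ h
  ... | j , j∈ , refl with seg-∈⁻ p (q ∸ p) j∈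
  ... | h₁ , h₂ = 0 , j , cong (λ z → cell z j) (sym (+-identityʳ i)) , h₁ , below (≤-total p q)
    where
    below : p ≤ q ⊎ q ≤ p → j ≤ q
    below (inj₁ p≤q) = ≤-trans h₂ (≤-reflexive (m+[n∸m]≡n p≤q))
    below (inj₂ q≤p) = ⊥-elim (n≮n p (<-≤-trans h₁ (≤-trans h₂
      (≤-reflexive (trans (cong (λ z → p + z) (m≤n⇒m∸n≡0 q≤p)) (+-identityʳ p))))))
  bx-∈⁻ i (q ∷ qs) (p ∷ ps) b∈ | inj₂ h with bx-∈⁻ (suc i) qs ps h
  ... | k , j , refl , h₁ , h₂ = suc k , j , cong (λ z → cell z j) (sym (+-suc i k)) , h₁ , h₂

  bx-∈⁺ : ∀ {n} i (q p : Vec ℕ n) k {j} → at p k < j → j ≤ at q k → cell (i + k) j ∈ bx i q p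
  bx-∈⁺ i []       []       k       h₁ h₂ = ⊥-elim (n≮n 0 (<-≤-trans h₁ h₂))
  bx-∈⁺ i (q ∷ qs) (p ∷ ps) zero    {j} h₁ h₂ =
    ∈-++⁺ˡ (subst (λ z → cell z j ∈ cells i (seg p (q ∸ p))) (sym (+-identityʳ i))
      (∈-map⁺ (cell i) (seg-∈⁺ p (q ∸ p) h₁ (≤-trans h₂ (m≤n+m∸n q p)))))
  bx-∈⁺ i (q ∷ qs) (p ∷ ps) (suc k) {j} h₁ h₂ =
    ∈-++⁺ʳ (cells i (seg p (q ∸ p)))
      (subst (λ z → cell z j ∈ bx (suc i) qs ps) (sym (+-suc i k)) (bx-∈⁺ (suc i) qs ps k h₁ h₂))

  bx-row : ∀ {n} i (q p : Vec ℕ n) {a} → a ∈ bx i q p → i ≤ row a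
  bx-row i q p a∈ with bx-∈⁻ i q p a∈
  ... | k , j , refl , _ = m≤m+n i k

  Dec-≤hd : ∀ {n} (q : Vec ℕ n) → Dec q → ∀ k → at q k ≤ hd0 q
  Dec-≤hd q d zero    = ≤-reflexive (sym (hd0≡at q))
  Dec-≤hd q d (suc k) = ≤-trans (d k) (Dec-≤hd q d k)

  -- Only the first row below matters, as the longest one. If it extends beyond `v`, then its last
  -- box lies under the strip, and `hd0 y ≤ v` guarantees that this box was not removed with `y`.
  none-below : ∀ {n} i v q (x y : Vec ℕ n) → Dec x → hd0 x ≤ q → hd0 y ≤ v → v ≤ q →
               none sameColAbove (cells i (seg v (q ∸ v))) (bx (suc i) x y) ≡ (hd0 x ≤ᵇ v)
  none-below i v q x y dx x≤q y≤v v≤q = T⇔⇒≡ fwd bwd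
    where
    fwd : T (none sameColAbove (cells i (seg v (q ∸ v))) (bx (suc i) x y)) → T (hd0 x ≤ᵇ v)
    fwd h with ≤-<-connex (hd0 x) v
    ... | inj₁ x≤v = ≤⇒≤ᵇ x≤v
    ... | inj₂ v<x = ⊥-elim (none-elim sameColAbove _ _ h (cell i (hd0 x)) (cell (suc i + 0) (hd0 x))
            (∈-map⁺ (cell i) (seg-∈⁺ v (q ∸ v) v<x (≤-trans x≤q (≤-reflexive (sym (m+[n∸m]≡n v≤q))))))
            (bx-∈⁺ (suc i) x y 0 (≤-<-trans (≤-trans (≤-reflexive (sym (hd0≡at y))) y≤v) v<x)
                (≤-reflexive (hd0≡at x)))
            (∧-intro (≡⇒≡ᵇ (j₀ + hd0 x) (j₀ + hd0 x) refl) (<⇒<ᵇ (s≤s (m≤m+n i 0)))))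
    bwd : T (hd0 x ≤ᵇ v) → T (none sameColAbove (cells i (seg v (q ∸ v))) (bx (suc i) x y))
    bwd t = none-intro sameColAbove _ _ λ a b a∈ b∈ s → case-of a b (∈-map⁻ _ a∈) (bx-∈⁻ (suc i) x y b∈) s
      where
      case-of : ∀ a b → ∃[ j ] (j ∈ seg v (q ∸ v) × a ≡ cell i j) →
                ∃[ k ] ∃[ j ] (b ≡ cell (suc i + k) j × at y k < j × j ≤ at x k) → ¬ T (sameColAbove a b)
      case-of _ _ (j , j∈ , refl) (k , j′ , refl , _ , j′≤) s =
        n≮n v (<-≤-trans (proj₁ (seg-∈⁻ v (q ∸ v) j∈))
          (≤-trans (≤-reflexive (+-cancelˡ-≡ j₀ j j′ (sca-col (cell i j) (cell (suc i + k) j′) s)))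
          (≤-trans j′≤ (≤-trans (Dec-≤hd x dx k) (≤ᵇ⇒≤ (hd0 x) v t)))))

  -- No box of `t` may stand to the left of a box of `s`, so a row splits at a cut point `v`: `s` is
  -- an initial segment and `t` the rest. The cut points of all rows form the intermediate vector in
  -- `∑-outer`.
  ∑-row-outer : ∀ {m} i p k (ψ : List Box → List Box → ℤ) → p + k ≤ m →
    ∑ (splits (cells i (seg p k))) (λ (s , t) → ⟦ none sameRowLeft t s ⟧ · ψ s t)
    ≡ ∑ (vals m) (λ v → ⟦ (p ≤ᵇ v) ∧ (v ≤ᵇ p + k) ⟧ · ψ (cells i (seg p (v ∸ p)))
        (cells i (seg v ((p + k) ∸ v))))
  ∑-row-outer {m} i p zero ψ h rewrite +-identityʳ p =
    trans (∑-[ _ ] _) (trans (·-identityˡ _)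
    (sym (trans (∑-single _ (vals-unique m) (∈-vals⁺ h) (λ v _ v≢p → ⟦false⟧· _ (¬T⇒≡ (λ t →
                   v≢p (≤-antisym (≤ᵇ⇒≤ v p (∧-right {p ≤ᵇ v} t)) (≤ᵇ⇒≤ p v (∧-left t)))))))
         (trans (⟦true⟧· _ (cong₂ _∧_ (≤ᵇ-true (≤-refl {p})) (≤ᵇ-true (≤-refl {p}))))
                (cong (λ z → ψ (cells i (seg p z)) (cells i (seg p z))) (n∸n≡0 p))))))
  ∑-row-outer {m} i p (suc k) ψ h rewrite +-suc p k =
    trans (∑-splits-∷ x xs (λ s t → ⟦ none sameRowLeft t s ⟧ · ψ s t))
    (trans (cong₂ _⊕_
      (trans (∑-cong∈ (splits xs) (λ (s , t) st∈ → cong (λ z → ⟦ z ⟧ · ψ (x ∷ s) t) (drop (splitOf xs st∈))))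
             (∑-row-outer i (suc p) k (λ s → ψ (x ∷ s)) h))
      (trans (∑-cong∈ (splits xs) (λ (s , t) st∈ → cong (λ z → ⟦ z ⟧ · ψ s (x ∷ t)) (isNull (splitOf xs st∈))))
             (∑-splits-nullˡ xs (λ s t → ψ s (x ∷ t)))))
    (trans (⊕-comm _ _)
    (sym (trans (∑-cong (vals m) (λ v → trans (cong (_· X v) (split v)) (·-distribʳ (X v) _ _)))
         (trans (∑-+ (vals m) _ _)
           (cong₂ _⊕_ (trans (∑-δ X (≤-trans (m≤m+n p k) (<⇒≤ h))) atp)
                      (∑-cong (vals m) (λ v → ⟦⟧-cond ((suc p ≤ᵇ v) ∧ (v ≤ᵇ suc (p + k))) (λ c →
                         cong (λ z → ψ (cells i z) (cells i (seg v (suc (p + k) ∸ v))))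
                              (seg-suc v (≤ᵇ⇒≤ (suc p) v (∧-left c))))))))))))
    where
    x = cell i (suc p)
    xs = cells i (seg (suc p) k)
    X : ℕ → ℤ
    X v = ψ (cells i (seg p (v ∸ p))) (cells i (seg v (suc (p + k) ∸ v)))
    right-of-x : ∀ {b} → b ∈ xs → col x < col b
    right-of-x b∈ with ∈-map⁻ _ b∈
    ... | j , j∈ , refl = +-monoʳ-< j₀ (proj₁ (seg-∈⁻ (suc p) k j∈))
    drop : ∀ {s t} → SplitOf xs s t → none sameRowLeft t (x ∷ s) ≡ none sameRowLeft t s
    drop {s} {t} so = T⇔⇒≡
      (λ h → none-intro sameRowLeft t s (λ a b a∈ b∈ → none-elim sameRowLeft t (x ∷ s) h a b a∈ (there b∈)))
      (λ h → none-intro sameRowLeft t (x ∷ s) (λ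
        { a b a∈ (here refl) c → <-asym (srl-col a x c) (right-of-x (right so a∈))
        ; a b a∈ (there b∈)    → none-elim sameRowLeft t s h a b a∈ b∈ }))
    isNull : ∀ {s t} → SplitOf xs s t → none sameRowLeft (x ∷ t) s ≡ null s
    isNull {[]}    {t} so = T⇒≡ (none-intro sameRowLeft (x ∷ t) [] (λ _ _ _ ()))
    isNull {y ∷ s} {t} so = ¬T⇒≡ (λ h → none-elim sameRowLeft (x ∷ t) (y ∷ s) h x y (here refl) (here refl)
      (∧-intro (≡⇒≡ᵇ i (row y) (sym (cells-row i (seg (suc p) k) (left so (here refl)))))
               (<⇒<ᵇ (right-of-x (left so (here refl))))))
    atp : X p ≡ ψ [] (x ∷ xs)
    atp = cong₂ (λ y z → ψ (cells i (seg p y)) (cells i (seg p z))) (n∸n≡0 p)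
                (trans (cong (_∸ p) (sym (+-suc p k))) (m+n∸m≡n p (suc k)))
    seg-suc : ∀ v → suc p ≤ v → seg p (v ∸ p) ≡ suc p ∷ seg (suc p) (v ∸ suc p)
    seg-suc v h = cong (seg p) (+-suc-∸ 0 h)
    split : ∀ v → ⟦ (p ≤ᵇ v) ∧ (v ≤ᵇ suc (p + k)) ⟧ ≡ ⟦ v ≡ᵇ p ⟧ ⊕ ⟦ (suc p ≤ᵇ v) ∧ (v ≤ᵇ suc (p + k)) ⟧
    split v = ⟦⟧-exclusive (v ≡ᵇ p) ((suc p ≤ᵇ v) ∧ (v ≤ᵇ suc (p + k)))
      (T⇔⇒≡ (λ t → from (T-∨ {v ≡ᵇ p}) (by (m≤n⇒m<n∨m≡n (≤ᵇ⇒≤ p v (∧-left t))) t)) back)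
      (λ e t → n≮n p (subst (p <_) (≡ᵇ⇒≡ v p e) (≤ᵇ⇒≤ (suc p) v (∧-left t))))
      where
      by : p < v ⊎ p ≡ v → T ((p ≤ᵇ v) ∧ (v ≤ᵇ suc (p + k))) → T (v ≡ᵇ p) ⊎ T
          ((suc p ≤ᵇ v) ∧ (v ≤ᵇ suc (p + k)))
      by (inj₁ l) t = inj₂ (∧-intro (≤⇒≤ᵇ l) (∧-right {p ≤ᵇ v} t))
      by (inj₂ e) t = inj₁ (≡⇒≡ᵇ v p (sym e))
      back : T ((v ≡ᵇ p) ∨ ((suc p ≤ᵇ v) ∧ (v ≤ᵇ suc (p + k)))) → T ((p ≤ᵇ v) ∧ (v ≤ᵇ suc (p + k)))
      back t with to (T-∨ {v ≡ᵇ p}) t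
      ... | inj₁ e = subst (λ z → T ((p ≤ᵇ z) ∧ (z ≤ᵇ suc (p + k)))) (sym (≡ᵇ⇒≡ v p e))
                       (∧-intro (≤⇒≤ᵇ (≤-refl {p})) (≤⇒≤ᵇ (≤-trans (m≤m+n p k) (n≤1+n _))))
      ... | inj₂ u = ∧-intro (≤⇒≤ᵇ (<⇒≤ (≤ᵇ⇒≤ (suc p) v (∧-left u)))) (∧-right {suc p ≤ᵇ v} u)

  ∑-outer : ∀ {m n} i (q p : Vec ℕ n) (φ : List Box → List Box → ℤ) →
            q ∈ vecs m n → T (dec q) → T (dec p) → p ≤ᵛ q →
            ∑ (splits (bx i q p)) (λ (s , t) → ⟦ HS s t ⟧ · φ s t)
            ≡ ∑ (vecs m n) (λ r → ⟦ outer q p r ⟧ · φ (bx i r p) (bx i q r))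
  ∑-outer i [] [] φ _ _ _ _ = trans (∑-[ _ ] _) (sym (∑-[ _ ] _))
  ∑-outer {m} {suc n} i (q ∷ qs) (p ∷ ps) φ q∈ dq dp p≤q with ∈-vecs⁻ q∈
  ... | q≤m , qs∈ =
    trans (∑-splits-++ (cells i (seg p (q ∸ p))) rest (λ s t → ⟦ HS s t ⟧ · φ s t))
    (trans (∑-cong∈ (splits (cells i (seg p (q ∸ p)))) (λ (s₁ , t₁) st₁ →
      trans (∑-cong∈ (splits rest) (λ (s₂ , t₂) st₂ → factor s₁ t₁ s₂ t₂ (splitOf _ st₁) (splitOf _ st₂)))
      (trans (∑-·ˡ² (splits rest) ⟦ none sameRowLeft t₁ s₁ ⟧ ⟦ none sameColAbove t₁ rest ⟧ _)
             (cong (λ z → ⟦ none sameRowLeft t₁ s₁ ⟧ · (⟦ none sameColAbove t₁ rest ⟧ · z))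
                   (∑-outer (suc i) qs ps (λ s₂ t₂ → φ (s₁ ++ s₂) (t₁ ++ t₂)) qs∈ (dec-tail q qs dq)
                       (dec-tail p ps dp)
                            (λ k → p≤q (suc k)))))))
    (trans (∑-row-outer {m} i p (q ∸ p) (λ s₁ t₁ → ⟦ none sameColAbove t₁ rest ⟧ · Y s₁ t₁)
        (≤-trans (≤-reflexive q≡) q≤m))
    (sym (trans (∑-vecs m n _) (∑-cong (vals m) row-v)))))
    where
    rest = bx (suc i) qs ps
    q≡ = m+[n∸m]≡n (p≤q 0)
    Y : List Box → List Box → ℤ
    Y s₁ t₁ = ∑ (vecs m n) (λ rs → ⟦ outer qs ps rs ⟧ · φ (s₁ ++ bx (suc i) rs ps) (t₁ ++ bx (suc i) qs rs))
    factor : ∀ s₁ t₁ s₂ t₂ → SplitOf (cells i (seg p (q ∸ p))) s₁ t₁ → SplitOf rest s₂ t₂ →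
      ⟦ HS (s₁ ++ s₂) (t₁ ++ t₂) ⟧ · φ (s₁ ++ s₂) (t₁ ++ t₂) ≡
      ⟦ none sameRowLeft t₁ s₁ ⟧ · (⟦ none sameColAbove t₁ rest ⟧ · (⟦ HS s₂ t₂ ⟧ · φ (s₁ ++ s₂) (t₁ ++ t₂)))
    factor s₁ t₁ s₂ t₂ so₁ so₂ =
      trans (cong (λ b → ⟦ b ⟧ · φ (s₁ ++ s₂) (t₁ ++ t₂))
          (HS-++ {i} (λ a∈ → cells-row i _ (left so₁ a∈)) (λ a∈ → cells-row i _ (right so₁ a∈))
              (λ a∈ → bx-row (suc i) qs ps (left so₂ a∈)) (λ a∈ → bx-row (suc i) qs ps (right so₂ a∈)) so₂))
      (trans (cong (_· φ (s₁ ++ s₂) (t₁ ++ t₂))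
          (trans (⟦∧⟧ (none sameRowLeft t₁ s₁) _)
          (cong (⟦ none sameRowLeft t₁ s₁ ⟧ ·_) (⟦∧⟧ (none sameColAbove t₁ rest) (HS s₂ t₂)))))
      (trans (·-assoc _ _ _) (cong (⟦ none sameRowLeft t₁ s₁ ⟧ ·_) (·-assoc _ _ _))))
    row-v : ∀ v → ∑ (vecs m n) (λ rs → ⟦ ((p ≤ᵇ v) ∧ (v ≤ᵇ q)) ∧ ((hd0 qs ≤ᵇ v) ∧ outer qs ps rs) ⟧ ·
                     φ (cells i (seg p (v ∸ p)) ++ bx (suc i) rs ps)
                         (cells i (seg v (q ∸ v)) ++ bx (suc i) qs rs))
            ≡ ⟦ (p ≤ᵇ v) ∧ (v ≤ᵇ p + (q ∸ p)) ⟧ ·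
                (⟦ none sameColAbove (cells i (seg v ((p + (q ∸ p)) ∸ v))) rest ⟧ ·
                Y (cells i (seg p (v ∸ p))) (cells i (seg v ((p + (q ∸ p)) ∸ v))))
    row-v v rewrite q≡ =
      trans (∑-cong (vecs m n) (λ rs → trans (cong (_· φ _ _)
          (trans (⟦∧⟧ ((p ≤ᵇ v) ∧ (v ≤ᵇ q)) _)
          (cong (⟦ (p ≤ᵇ v) ∧ (v ≤ᵇ q) ⟧ ·_) (⟦∧⟧ (hd0 qs ≤ᵇ v) (outer qs ps rs)))))
                                          (trans (·-assoc _ _ _) (cong (⟦ (p ≤ᵇ v) ∧ (v ≤ᵇ q) ⟧ ·_)
                                              (·-assoc _ _ _)))))
      (trans (∑-·ˡ² (vecs m n) ⟦ (p ≤ᵇ v) ∧ (v ≤ᵇ q) ⟧ ⟦ hd0 qs ≤ᵇ v ⟧ _)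
             (⟦⟧-cond ((p ≤ᵇ v) ∧ (v ≤ᵇ q)) (λ c → cong
                 (λ b → ⟦ b ⟧ · Y (cells i (seg p (v ∸ p))) (cells i (seg v (q ∸ v))))
               (sym (none-below i v q qs ps (dec⇒Dec qs (dec-tail q qs dq)) (dec-hd q qs dq)
                       (≤-trans (dec-hd p ps dp) (≤ᵇ⇒≤ p v (∧-left c))) (≤ᵇ⇒≤ v q (∧-right {p ≤ᵇ v} c)))))))

-- Strips along the inner boundary.

inner : ∀ {n} → Vec ℕ n → Vec ℕ n → Vec ℕ n → Bool
inner []       []       []       = true
inner (q ∷ qs) (p ∷ ps) (r ∷ rs) = (((p ≤ᵇ r) ∧ (r ≤ᵇ q)) ∧ (r ≤ᵇ suc p)) ∧ ((hd0 rs ≤ᵇ r) ∧ inner qs ps rs)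

inner-dec : ∀ {n} (q p r : Vec ℕ n) → T (inner q p r) → T (dec r)
inner-dec []       []       []       h = tt
inner-dec (q ∷ qs) (p ∷ ps) (r ∷ rs) h =
  ∧-intro (∧-left h′) (inner-dec qs ps rs (∧-right {hd0 rs ≤ᵇ r} h′))
  where h′ = ∧-right {((p ≤ᵇ r) ∧ (r ≤ᵇ q)) ∧ (r ≤ᵇ suc p)} h

inner-hd : ∀ {n} (q p r : Vec ℕ n) → T (inner q p r) → hd0 r ≤ hd0 q
inner-hd []       []       []       h = z≤n
inner-hd (q ∷ qs) (p ∷ ps) (r ∷ rs) h = ≤ᵇ⇒≤ r q (∧-right {p ≤ᵇ r} (∧-left (∧-left h)))

module InnerStrips (j₀ : ℕ) where
  open Boxes j₀

  -- In a strictly decreasing row the largest label occurs at most once, in the first box, so the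
  -- cut point is `p` or `p + 1`.
  ∑-row-inner : ∀ {m} i p k (ψ : List Box → List Box → ℤ) → p + k ≤ m →
    ∑ (splits (cells i (seg p k))) (λ (s , t) → ⟦ none sameRowLeft s t ∧ none sameRowLeft t t ⟧ · ψ s t)
    ≡ ∑ (vals m) (λ v → ⟦ ((p ≤ᵇ v) ∧ (v ≤ᵇ p + k)) ∧ (v ≤ᵇ suc p) ⟧ ·
                        ψ (cells i (seg v ((p + k) ∸ v))) (cells i (seg p (v ∸ p))))
  ∑-row-inner {m} i p zero ψ h rewrite +-identityʳ p =
    trans (∑-[ _ ] _) (trans (·-identityˡ _)
    (sym (trans (∑-single _ (vals-unique m) (∈-vals⁺ h) (λ v _ v≢p → ⟦false⟧· _ (¬T⇒≡ (λ t →
                   v≢p (≤-antisym (≤ᵇ⇒≤ v p (∧-right {p ≤ᵇ v} (∧-left t))) (≤ᵇ⇒≤ p v (∧-left (∧-left t))))))))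
         (trans (⟦true⟧· _ (cong₂ _∧_ (cong₂ _∧_ (≤ᵇ-true (≤-refl {p})) (≤ᵇ-true (≤-refl {p})))
             (≤ᵇ-true (n≤1+n p))))
                (cong (λ z → ψ (cells i (seg p z)) (cells i (seg p z))) (n∸n≡0 p))))))
  ∑-row-inner {m} i p (suc k) ψ h rewrite +-suc p k =
    trans (∑-splits-∷ x xs (λ s t → ⟦ none sameRowLeft s t ∧ none sameRowLeft t t ⟧ · ψ s t))
    (trans (cong₂ _⊕_
      (trans (∑-cong∈ (splits xs) (λ (s , t) st∈ → cong (λ z → ⟦ z ⟧ · ψ (x ∷ s) t) (nullOld (splitOf xs st∈))))
             (∑-splits-nullʳ xs (λ s t → ψ (x ∷ s) t)))
      (trans (∑-cong∈ (splits xs) (λ (s , t) st∈ → cong (λ z → ⟦ z ⟧ · ψ s (x ∷ t)) (nullNew (splitOf xs st∈))))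
             (∑-splits-nullʳ xs (λ s t → ψ s (x ∷ t)))))
    (sym (trans (∑-cong (vals m) (λ v → trans (cong (_· X v) (split v)) (·-distribʳ (X v) _ _)))
         (trans (∑-+ (vals m) _ _)
           (cong₂ _⊕_ (trans (∑-δ X (≤-trans (m≤m+n p k) (<⇒≤ h))) atp)
                      (trans (∑-δ X (≤-trans (s≤s (m≤m+n p k)) h)) atsp))))))
    where
    x = cell i (suc p)
    xs = cells i (seg (suc p) k)
    X : ℕ → ℤ
    X v = ψ (cells i (seg v (suc (p + k) ∸ v))) (cells i (seg p (v ∸ p)))
    xs-row : ∀ {b} → b ∈ xs → row b ≡ i
    xs-row b∈ = cells-row i (seg (suc p) k) b∈
    right-of-x : ∀ {b} → b ∈ xs → col x < col b
    right-of-x b∈ with ∈-map⁻ _ b∈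
    ... | j , j∈ , refl = +-monoʳ-< j₀ (proj₁ (seg-∈⁻ (suc p) k j∈))
    x-left : ∀ {b} → b ∈ xs → T (sameRowLeft x b)
    x-left {b} b∈ = ∧-intro (≡⇒≡ᵇ i (row b) (sym (xs-row b∈))) (<⇒<ᵇ (right-of-x b∈))
    nullOld : ∀ {s t} → SplitOf xs s t → none sameRowLeft (x ∷ s) t ∧ none sameRowLeft t t ≡ null t
    nullOld {s} {[]}    so = T⇒≡ (∧-intro (none-intro sameRowLeft (x ∷ s) [] (λ _ _ _ ())) tt)
    nullOld {s} {y ∷ t} so = ¬T⇒≡ (λ h → none-elim sameRowLeft (x ∷ s) (y ∷ t) (∧-left h) x y (here refl)
        (here refl)
                                          (x-left (right so (here refl))))
    nullNew : ∀ {s t} → SplitOf xs s t → none sameRowLeft s (x ∷ t) ∧ none sameRowLeft (x ∷ t) (x ∷ t) ≡ null t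
    nullNew {s} {[]}    so = T⇒≡ (∧-intro
      (none-intro sameRowLeft s (x ∷ []) (λ { a b a∈ (here refl) c → <-asym (srl-col a x c)
          (right-of-x (left so a∈)) }))
      (none-intro sameRowLeft (x ∷ []) (x ∷ []) (λ { a b (here refl) (here refl) c → n≮n _ (srl-col x x c) })))
    nullNew {s} {y ∷ t} so = ¬T⇒≡ (λ h → none-elim sameRowLeft (x ∷ y ∷ t) (x ∷ y ∷ t)
      (∧-right {none sameRowLeft s (x ∷ y ∷ t)} h) x y (here refl) (there (here refl))
          (x-left (right so (here refl))))
    atp : X p ≡ ψ (x ∷ xs) []
    atp = cong₂ (λ y z → ψ (cells i (seg p z)) (cells i (seg p y))) (n∸n≡0 p)
                (trans (cong (_∸ p) (sym (+-suc p k))) (m+n∸m≡n p (suc k)))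
    atsp : X (suc p) ≡ ψ xs (x ∷ [])
    atsp = cong₂ (λ y z → ψ (cells i (seg (suc p) z)) (cells i (seg p y)))
                 (trans (+-∸-assoc 1 (≤-refl {p})) (cong suc (n∸n≡0 p))) (m+n∸m≡n p k)
    split : ∀ v → ⟦ ((p ≤ᵇ v) ∧ (v ≤ᵇ suc (p + k))) ∧ (v ≤ᵇ suc p) ⟧ ≡ ⟦ v ≡ᵇ p ⟧ ⊕ ⟦ v ≡ᵇ suc p ⟧
    split v = ⟦⟧-exclusive (v ≡ᵇ p) (v ≡ᵇ suc p)
      (T⇔⇒≡ (λ t → from (T-∨ {v ≡ᵇ p}) (by (m≤n⇒m<n∨m≡n (≤ᵇ⇒≤ p v (∧-left (∧-left t))))
                                           (≤ᵇ⇒≤ v (suc p) (∧-right {(p ≤ᵇ v) ∧ (v ≤ᵇ suc (p + k))} t)))) back)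
      (λ e e′ → n≮n p (≤-reflexive (sym (trans (sym (≡ᵇ⇒≡ v p e)) (≡ᵇ⇒≡ v (suc p) e′)))))
      where
      by : p < v ⊎ p ≡ v → v ≤ suc p → T (v ≡ᵇ p) ⊎ T (v ≡ᵇ suc p)
      by (inj₁ l) u = inj₂ (≡⇒≡ᵇ v (suc p) (≤-antisym u l))
      by (inj₂ e) u = inj₁ (≡⇒≡ᵇ v p (sym e))
      back : T ((v ≡ᵇ p) ∨ (v ≡ᵇ suc p)) → T (((p ≤ᵇ v) ∧ (v ≤ᵇ suc (p + k))) ∧ (v ≤ᵇ suc p))
      back t with to (T-∨ {v ≡ᵇ p}) t
      ... | inj₁ e = subst (λ z → T (((p ≤ᵇ z) ∧ (z ≤ᵇ suc (p + k))) ∧ (z ≤ᵇ suc p))) (sym (≡ᵇ⇒≡ v p e))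
                       (∧-intro (∧-intro (≤⇒≤ᵇ (≤-refl {p})) (≤⇒≤ᵇ (≤-trans (m≤m+n p k) (n≤1+n _))))
                           (≤⇒≤ᵇ (n≤1+n p)))
      ... | inj₂ e = subst (λ z → T (((p ≤ᵇ z) ∧ (z ≤ᵇ suc (p + k))) ∧ (z ≤ᵇ suc p))) (sym (≡ᵇ⇒≡ v (suc p) e))
                       (∧-intro (∧-intro (≤⇒≤ᵇ (n≤1+n p)) (≤⇒≤ᵇ (s≤s (m≤m+n p k)))) (≤⇒≤ᵇ (≤-refl {suc p})))

  -- In contrast to `∑-outer`, the column condition of a row depends on the new boxes `t₂` of the
  -- rows below, not on all their boxes. The induction therefore carries it inside `φ` and turns it
  -- into `hd0 rs ≤ r` once the lower vector is known.
  ∑-inner : ∀ {m n} i (q p : Vec ℕ n) (φ : List Box → List Box → ℤ) →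
            q ∈ vecs m n → T (dec q) → T (dec p) → p ≤ᵛ q →
            ∑ (splits (bx i q p)) (λ (s , t) → ⟦ VS s t ⟧ · φ s t)
            ≡ ∑ (vecs m n) (λ r → ⟦ inner q p r ⟧ · φ (bx i q r) (bx i r p))
  ∑-inner i [] [] φ _ _ _ _ = trans (∑-[ _ ] _) (sym (∑-[ _ ] _))
  ∑-inner {m} {suc n} i (q ∷ qs) (p ∷ ps) φ q∈ dq dp p≤q with ∈-vecs⁻ q∈
  ... | q≤m , qs∈ =
    trans (∑-splits-++ (cells i (seg p (q ∸ p))) rest (λ s t → ⟦ VS s t ⟧ · φ s t))
    (trans (∑-cong∈ (splits (cells i (seg p (q ∸ p)))) (λ (s₁ , t₁) st₁ →
      trans (∑-cong∈ (splits rest) (λ (s₂ , t₂) st₂ → factor s₁ t₁ s₂ t₂ (splitOf _ st₁) (splitOf _ st₂)))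
      (trans (∑-*ˡ (splits rest) ⟦ rowOK s₁ t₁ ⟧ _)
             (cong (⟦ rowOK s₁ t₁ ⟧ ·_)
                   (∑-inner (suc i) qs ps (λ s₂ t₂ → ⟦ none sameColAbove s₁ t₂ ⟧ · φ (s₁ ++ s₂) (t₁ ++ t₂)) qs∈
                            (dec-tail q qs dq) (dec-tail p ps dp) (λ k → p≤q (suc k)))))))
    (trans (∑-row-inner {m} i p (q ∸ p) Y (≤-trans (≤-reflexive q≡) q≤m))
    (sym (trans (∑-vecs m n _) (∑-cong (vals m) row-v)))))
    where
    rest = bx (suc i) qs ps
    rowOK : List Box → List Box → Bool
    rowOK s t = none sameRowLeft s t ∧ none sameRowLeft t t
    q≡ = m+[n∸m]≡n (p≤q 0)
    Y : List Box → List Box → ℤ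
    Y s₁ t₁ = ∑ (vecs m n) (λ rs → ⟦ inner qs ps rs ⟧ ·
                (⟦ none sameColAbove s₁ (bx (suc i) rs ps) ⟧ · φ (s₁ ++ bx (suc i) qs rs)
                    (t₁ ++ bx (suc i) rs ps)))
    factor : ∀ s₁ t₁ s₂ t₂ → SplitOf (cells i (seg p (q ∸ p))) s₁ t₁ → SplitOf rest s₂ t₂ →
      ⟦ VS (s₁ ++ s₂) (t₁ ++ t₂) ⟧ · φ (s₁ ++ s₂) (t₁ ++ t₂) ≡
      ⟦ rowOK s₁ t₁ ⟧ · (⟦ VS s₂ t₂ ⟧ · (⟦ none sameColAbove s₁ t₂ ⟧ · φ (s₁ ++ s₂) (t₁ ++ t₂)))
    factor s₁ t₁ s₂ t₂ so₁ so₂ =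
      trans (cong (λ b → ⟦ b ⟧ · φ (s₁ ++ s₂) (t₁ ++ t₂))
          (VS-++ {i} (λ a∈ → cells-row i _ (left so₁ a∈)) (λ a∈ → cells-row i _ (right so₁ a∈))
              (λ a∈ → bx-row (suc i) qs ps (left so₂ a∈)) (λ a∈ → bx-row (suc i) qs ps (right so₂ a∈))))
      (trans (cong (_· φ (s₁ ++ s₂) (t₁ ++ t₂)) (trans (⟦∧⟧ (rowOK s₁ t₁) _) (cong (⟦ rowOK s₁ t₁ ⟧ ·_)
                (trans (⟦∧⟧ (none sameColAbove s₁ t₂) (VS s₂ t₂)) (·-comm _ _)))))
      (trans (·-assoc _ _ _) (cong (⟦ rowOK s₁ t₁ ⟧ ·_) (·-assoc _ _ _))))
    row-v : ∀ v → ∑ (vecs m n) (λ rs → ⟦ (((p ≤ᵇ v) ∧ (v ≤ᵇ q)) ∧ (v ≤ᵇ suc p)) ∧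
        ((hd0 rs ≤ᵇ v) ∧ inner qs ps rs) ⟧ ·
                     φ (cells i (seg v (q ∸ v)) ++ bx (suc i) qs rs)
                         (cells i (seg p (v ∸ p)) ++ bx (suc i) rs ps))
            ≡ ⟦ ((p ≤ᵇ v) ∧ (v ≤ᵇ p + (q ∸ p))) ∧ (v ≤ᵇ suc p) ⟧ ·
                Y (cells i (seg v ((p + (q ∸ p)) ∸ v))) (cells i (seg p (v ∸ p)))
    row-v v rewrite q≡ =
      trans (∑-cong (vecs m n) (λ rs → trans (cong (_· φ _ _)
          (trans (⟦∧⟧ c _) (cong (⟦ c ⟧ ·_) (trans (⟦∧⟧ (hd0 rs ≤ᵇ v) (inner qs ps rs)) (·-comm _ _)))))
                                          (trans (·-assoc _ _ _) (cong (⟦ c ⟧ ·_) (·-assoc _ _ _)))))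
      (trans (∑-*ˡ (vecs m n) ⟦ c ⟧ _)
             (⟦⟧-cond c (λ t → ∑-cong (vecs m n) (λ rs → ⟦⟧-cond (inner qs ps rs) (λ h →
               cong (λ b → ⟦ b ⟧ · φ (cells i (seg v (q ∸ v)) ++ bx (suc i) qs rs)
                   (cells i (seg p (v ∸ p)) ++ bx (suc i) rs ps))
                 (sym (none-below i v q rs ps (dec⇒Dec rs (inner-dec qs ps rs h))
                     (≤-trans (inner-hd qs ps rs h) (dec-hd q qs dq))
                         (≤-trans (dec-hd p ps dp) (≤ᵇ⇒≤ p v (∧-left (∧-left t))))
                         (≤ᵇ⇒≤ v q (∧-right {p ≤ᵇ v} (∧-left t))))))))))
      where c = ((p ≤ᵇ v) ∧ (v ≤ᵇ q)) ∧ (v ≤ᵇ suc p)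

-- Closed forms of the strip weights.

size : ∀ {n} → Vec ℕ n → Vec ℕ n → ℕ
size []       []       = 0
size (q ∷ qs) (p ∷ ps) = (q ∸ p) + size qs ps

length-bx : ∀ j₀ {n} i (q p : Vec ℕ n) → length (Boxes.bx j₀ i q p) ≡ size q p
length-bx j₀ i []       []       = refl
length-bx j₀ i (q ∷ qs) (p ∷ ps) =
  trans (length-++ (Boxes.cells j₀ i (seg p (q ∸ p))))
        (cong₂ _+_ (trans (length-map _ (seg p (q ∸ p))) (seg-length p (q ∸ p))) (length-bx j₀ (suc i) qs ps))

il : ∀ {n} → Vec ℕ n → Vec ℕ n → Bool
il []       []       = true
il (q ∷ qs) (r ∷ rs) = ((hd0 qs ≤ᵇ r) ∧ (r ≤ᵇ q)) ∧ il qs rs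

g₀-eval : ∀ w {n} (q r : Vec ℕ n) a b → g w 0 q r a b ≡ ⟦ il q r ⟧ · w (a + size q r) b
g₀-eval w []       []       a b = trans (cong (λ z → w z b) (sym (+-identityʳ a))) (sym (·-identityˡ _))
g₀-eval w (q ∷ qs) (r ∷ rs) a b =
  trans (cong (⟦ (hd0 qs ≤ᵇ r) ∧ (r ≤ᵇ q) ⟧ ·_) (g₀-eval w qs rs (a + (q ∸ r)) b))
  (trans (sym (·-assoc _ _ _))
         (cong₂ _·_ (sym (⟦∧⟧ ((hd0 qs ≤ᵇ r) ∧ (r ≤ᵇ q)) (il qs rs)))
             (cong (λ z → w z b) (+-assoc a (q ∸ r) (size qs rs)))))

corners : ∀ {n} → Vec ℕ n → Vec ℕ n → Vec ℕ n → ℕ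
corners []       []       []       = 0
corners (s ∷ ss) (p ∷ ps) (u ∷ us) = b2n ((p <ᵇ u) ∧ (hd0 ss <ᵇ u)) + corners ss ps us

∧-rearrange : ∀ x y z w → (x ∧ (y ∧ z)) ∧ w ≡ (x ∧ z) ∧ (y ∧ w)
∧-rearrange false y     z     w = refl
∧-rearrange true  false true  w = refl
∧-rearrange true  false false w = refl
∧-rearrange true  true  z     w = refl

if≡b2n : ∀ c b x → (if c then suc b else b) + x ≡ b + (b2n c + x)
if≡b2n true  b x = sym (+-suc b x)
if≡b2n false b x = refl

gp-eval : ∀ w {n} (p s u : Vec ℕ n) a b → gp w p s u a b ≡ ⟦ outer s p u ⟧ · w (a + size s u)
    (b + corners s p u)
gp-eval w []       []       []       a b =
  trans (cong₂ w (sym (+-identityʳ a)) (sym (+-identityʳ b))) (sym (·-identityˡ _))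
gp-eval w (p ∷ ps) (s ∷ ss) (u ∷ us) a b =
  trans (cong (⟦ (p ≤ᵇ u) ∧ ((hd0 ss ≤ᵇ u) ∧ (u ≤ᵇ s)) ⟧ ·_) (gp-eval w ps ss us _ _))
  (trans (sym (·-assoc _ _ _))
         (cong₂ _·_ (trans (sym (⟦∧⟧ ((p ≤ᵇ u) ∧ ((hd0 ss ≤ᵇ u) ∧ (u ≤ᵇ s))) (outer ss ps us)))
                           (cong ⟦_⟧ (∧-rearrange (p ≤ᵇ u) (hd0 ss ≤ᵇ u) (u ≤ᵇ s) (outer ss ps us))))
                    (cong₂ w (+-assoc a (s ∸ u) (size ss us)) (if≡b2n ((p <ᵇ u) ∧ (hd0 ss <ᵇ u)) b _))))

-- Tableau conditions after adding a largest label.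

T-⇒-intro : ∀ {a b} → (T a → T b) → T (a ⇒ᵇ b)
T-⇒-intro {true}  h = h tt
T-⇒-intro {false} h = tt

T-⇒-elim : ∀ {a b} → T (a ⇒ᵇ b) → T a → T b
T-⇒-elim {true} h _ = h

module Conditions {U : Set} (f h : U → U → Bool) where

  cond : (Box × U) → (Box × U) → Bool
  cond (a , u) (b , v) = (sameRowLeft a b ⇒ᵇ f u v) ∧ (sameColAbove a b ⇒ᵇ h u v)

  cond-intro : ∀ x y → (T (sameRowLeft (proj₁ x) (proj₁ y)) → T (f (proj₂ x) (proj₂ y))) →
               (T (sameColAbove (proj₁ x) (proj₁ y)) → T (h (proj₂ x) (proj₂ y))) → T (cond x y)
  cond-intro (a , u) (b , v) p q = ∧-intro (T-⇒-intro p) (T-⇒-intro q)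

  cond-row : ∀ x y → T (cond x y) → T (sameRowLeft (proj₁ x) (proj₁ y)) → T (f (proj₂ x) (proj₂ y))
  cond-row (a , u) (b , v) c = T-⇒-elim (∧-left c)

  cond-col : ∀ x y → T (cond x y) → T (sameColAbove (proj₁ x) (proj₁ y)) → T (h (proj₂ x) (proj₂ y))
  cond-col (a , u) (b , v) c = T-⇒-elim (∧-right {sameRowLeft a b ⇒ᵇ f u v} c)

∈-label⁻ : ∀ {U : Set} {y : U} t {x} → x ∈ label y t → proj₁ x ∈ t × proj₂ x ≡ y
∈-label⁻ t x∈ with ∈-map⁻ _ x∈
... | b , b∈ , refl = b∈ , refl

∈-label⁺ : ∀ {U : Set} (y : U) t {b} → b ∈ t → (b , y) ∈ label y t
∈-label⁺ y t = ∈-map⁺ (_, y)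

∈-boxes : ∀ {U : Set} {z : List (Box × U)} {s b} → map proj₁ z ≡ s → b ∈ s → ∃[ u ] ((b , u) ∈ z)
∈-boxes refl b∈ with ∈-map⁻ _ b∈
... | (_ , u) , x∈ , refl = u , x∈

boxes-∈ : ∀ {U : Set} {z : List (Box × U)} {s x} → map proj₁ z ≡ s → x ∈ z → proj₁ x ∈ s
boxes-∈ refl x∈ = ∈-map⁺ proj₁ x∈

-- `f` and `h` are the row and column comparisons of labels. How `y` compares with the older labels
-- and with itself decides everything: `outer-split` is for a label that is maximal in an increasing
-- order, `inner-split` for one that is maximal in a decreasing order.
module Extend {U : Set} (f h : U → U → Bool) (y : U) (z : List (Box × U)) (s t : List Box)
    (bz : map proj₁ z ≡ s) where
  open Conditions f h

  outer-split : (∀ {x} → x ∈ z → T (f (proj₂ x) y) × T (h (proj₂ x) y) × ¬ T (f y (proj₂ x)) × ¬ T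
      (h y (proj₂ x))) →
                T (f y y) → ¬ T (h y y) →
                allPairs cond (z ++ label y t) ≡ allPairs cond z ∧ HS s t
  outer-split old fyy ¬hyy = T⇔⇒≡
    (λ c → let P = λ a b a∈ b∈ → T-pairs-elim cond (z ++ label y t) c a b a∈ b∈ in
      ∧-intro (T-pairs-intro cond z (λ a b a∈ b∈ → P a b (∈-++⁺ˡ a∈) (∈-++⁺ˡ b∈)))
      (∧-intro (none-intro sameRowLeft t s (λ a b a∈ b∈ r → let (u , b∈z) = ∈-boxes bz b∈ in
                  proj₁ (proj₂ (proj₂ (old b∈z)))
                      (cond-row (a , y) (b , u) (P _ _ (∈-++⁺ʳ z (∈-label⁺ y t a∈)) (∈-++⁺ˡ b∈z)) r)))
      (∧-intro (none-intro sameColAbove t s (λ a b a∈ b∈ r → let (u , b∈z) = ∈-boxes bz b∈ in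
                  proj₂ (proj₂ (proj₂ (old b∈z)))
                      (cond-col (a , y) (b , u) (P _ _ (∈-++⁺ʳ z (∈-label⁺ y t a∈)) (∈-++⁺ˡ b∈z)) r)))
               (none-intro sameColAbove t t (λ a b a∈ b∈ r →
                  ¬hyy (cond-col (a , y) (b , y)
                      (P _ _ (∈-++⁺ʳ z (∈-label⁺ y t a∈)) (∈-++⁺ʳ z (∈-label⁺ y t b∈))) r))))))
    (λ c → let A = T-pairs-elim cond z (∧-left c)
               c′ = ∧-right {allPairs cond z} c
               L = none-elim sameRowLeft t s (∧-left c′)
               M = none-elim sameColAbove t s (∧-left (∧-right {none sameRowLeft t s} c′))
               N = none-elim sameColAbove t t (∧-right {none sameColAbove t s}
                   (∧-right {none sameRowLeft t s} c′))
           in T-pairs-intro cond (z ++ label y t) (λ a b a∈ b∈ → pick A L M N a b (∈-++⁻ z a∈) (∈-++⁻ z b∈)))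
    where
    No : (Box → Box → Bool) → List Box → List Box → Set
    No R s t = ∀ a b → a ∈ s → b ∈ t → ¬ T (R a b)
    pick : (∀ a b → a ∈ z → b ∈ z → T (cond a b)) → No sameRowLeft t s → No sameColAbove t s → No
        sameColAbove t t →
           ∀ a b → a ∈ z ⊎ a ∈ label y t → b ∈ z ⊎ b ∈ label y t → T (cond a b)
    pick A L M N a b (inj₁ p) (inj₁ q) = A a b p q
    pick A L M N a b (inj₁ p) (inj₂ q) with ∈-label⁻ t q
    ... | b∈ , refl = cond-intro a b (λ _ → proj₁ (old p)) (λ _ → proj₁ (proj₂ (old p)))
    pick A L M N a b (inj₂ p) (inj₁ q) with ∈-label⁻ t p
    ... | a∈ , refl = cond-intro a b (λ r → ⊥-elim (L _ _ a∈ (boxes-∈ bz q) r))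
        (λ r → ⊥-elim (M _ _ a∈ (boxes-∈ bz q) r))
    pick A L M N a b (inj₂ p) (inj₂ q) with ∈-label⁻ t p | ∈-label⁻ t q
    ... | a∈ , refl | b∈ , e = cond-intro a b (λ _ → subst (λ v → T (f y v)) (sym e) fyy)
        (λ r → ⊥-elim (N _ _ a∈ b∈ r))

  inner-split : (∀ {x} → x ∈ z → ¬ T (f (proj₂ x) y) × ¬ T (h (proj₂ x) y) × T (f y (proj₂ x)) × T
      (h y (proj₂ x))) →
                ¬ T (f y y) → T (h y y) →
                allPairs cond (z ++ label y t) ≡ allPairs cond z ∧ VS s t
  inner-split old ¬fyy hyy = T⇔⇒≡
    (λ c → let P = λ a b a∈ b∈ → T-pairs-elim cond (z ++ label y t) c a b a∈ b∈ in
      ∧-intro (T-pairs-intro cond z (λ a b a∈ b∈ → P a b (∈-++⁺ˡ a∈) (∈-++⁺ˡ b∈)))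
      (∧-intro (none-intro sameRowLeft s t (λ a b a∈ b∈ r → let (u , a∈z) = ∈-boxes bz a∈ in
                  proj₁ (old a∈z) (cond-row (a , u) (b , y)
                      (P _ _ (∈-++⁺ˡ a∈z) (∈-++⁺ʳ z (∈-label⁺ y t b∈))) r)))
      (∧-intro (none-intro sameColAbove s t (λ a b a∈ b∈ r → let (u , a∈z) = ∈-boxes bz a∈ in
                  proj₁ (proj₂ (old a∈z)) (cond-col (a , u) (b , y)
                      (P _ _ (∈-++⁺ˡ a∈z) (∈-++⁺ʳ z (∈-label⁺ y t b∈))) r)))
               (none-intro sameRowLeft t t (λ a b a∈ b∈ r →
                  ¬fyy (cond-row (a , y) (b , y)
                      (P _ _ (∈-++⁺ʳ z (∈-label⁺ y t a∈)) (∈-++⁺ʳ z (∈-label⁺ y t b∈))) r))))))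
    (λ c → let A = T-pairs-elim cond z (∧-left c)
               c′ = ∧-right {allPairs cond z} c
               L = none-elim sameRowLeft s t (∧-left c′)
               M = none-elim sameColAbove s t (∧-left (∧-right {none sameRowLeft s t} c′))
               N = none-elim sameRowLeft t t (∧-right {none sameColAbove s t}
                   (∧-right {none sameRowLeft s t} c′))
           in T-pairs-intro cond (z ++ label y t) (λ a b a∈ b∈ → pick A L M N a b (∈-++⁻ z a∈) (∈-++⁻ z b∈)))
    where
    No : (Box → Box → Bool) → List Box → List Box → Set
    No R s t = ∀ a b → a ∈ s → b ∈ t → ¬ T (R a b)
    pick : (∀ a b → a ∈ z → b ∈ z → T (cond a b)) → No sameRowLeft s t → No sameColAbove s t → No
        sameRowLeft t t →
           ∀ a b → a ∈ z ⊎ a ∈ label y t → b ∈ z ⊎ b ∈ label y t → T (cond a b)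
    pick A L M N a b (inj₁ p) (inj₁ q) = A a b p q
    pick A L M N a b (inj₁ p) (inj₂ q) with ∈-label⁻ t q
    ... | b∈ , refl = cond-intro a b (λ r → ⊥-elim (L _ _ (boxes-∈ bz p) b∈ r))
        (λ r → ⊥-elim (M _ _ (boxes-∈ bz p) b∈ r))
    pick A L M N a b (inj₂ p) (inj₁ q) with ∈-label⁻ t p
    ... | a∈ , refl = cond-intro a b (λ _ → proj₁ (proj₂ (proj₂ (old q)))) (λ _ → proj₂ (proj₂ (proj₂ (old q))))
    pick A L M N a b (inj₂ p) (inj₂ q) with ∈-label⁻ t p | ∈-label⁻ t q
    ... | a∈ , refl | b∈ , e = cond-intro a b (λ r → ⊥-elim (N _ _ a∈ b∈ r))
        (λ _ → subst (λ v → T (h y v)) (sym e) hyy)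

allPairs-cong : ∀ {p q : A → A → Bool} xs → (∀ x y → p x y ≡ q x y) → allPairs p xs ≡ allPairs q xs
allPairs-cong xs h = all-cong xs (λ x _ → all-cong xs (λ y _ → h x y))

isSSYT-cond : ∀ z → isSSYT z ≡ allPairs (Conditions.cond _≤ᵇ_ _<ᵇ_) z
isSSYT-cond z = allPairs-cong z (λ { (a , u) (b , v) → refl })

isRRS-cond : ∀ z → isReverseRowStrict z ≡ allPairs (Conditions.cond (λ u v → v <ᵇ u) (λ u v → v ≤ᵇ u)) z
isRRS-cond z = allPairs-cong z (λ { (a , u) (b , v) → refl })

Labels≤ : ℕ → List (Box × ℕ) → Set
Labels≤ N z = All (λ x → proj₂ x ∈ range1 N) z

∈-range1⁻ : ∀ {N u} → u ∈ range1 N → u ≤ N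
∈-range1⁻ {N} u∈ with ∈-applyUpTo⁻ suc u∈
... | _ , l , refl = l

range1-suc : ∀ N → range1 (suc N) ≡ range1 N ++ suc N ∷ []
range1-suc N = sym (applyUpTo-∷ʳ suc N)

isSSYT-label : ∀ N z s t → map proj₁ z ≡ s → Labels≤ N z → isSSYT (z ++ label (suc N) t) ≡ isSSYT z ∧ HS s t
isSSYT-label N z s t bz l =
  trans (isSSYT-cond (z ++ label (suc N) t))
  (trans (Extend.outer-split _≤ᵇ_ _<ᵇ_ (suc N) z s t bz
            (λ {x} x∈ → let u≤N = ∈-range1⁻ (All.lookup l x∈) in
               ≤⇒≤ᵇ (≤-trans u≤N (n≤1+n N)) , <⇒<ᵇ (s≤s u≤N) ,
               (λ c → n≮n N (≤-trans (≤ᵇ⇒≤ (suc N) (proj₂ x) c) u≤N)) ,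
               (λ c → n≮n N (≤-trans (<⇒≤ (<ᵇ⇒< (suc N) (proj₂ x) c)) u≤N)))
            (≤⇒≤ᵇ (≤-refl {suc N})) (λ c → n≮n (suc N) (<ᵇ⇒< (suc N) (suc N) c)))
         (cong (_∧ HS s t) (sym (isSSYT-cond z))))

isRRS-label : ∀ N z s t → map proj₁ z ≡ s → Labels≤ N z →
              isReverseRowStrict (z ++ label (suc N) t) ≡ isReverseRowStrict z ∧ VS s t
isRRS-label N z s t bz l =
  trans (isRRS-cond (z ++ label (suc N) t))
  (trans (Extend.inner-split _ _ (suc N) z s t bz
            (λ {x} x∈ → let u≤N = ∈-range1⁻ (All.lookup l x∈) in
               (λ c → n≮n N (≤-trans (<⇒≤ (<ᵇ⇒< (suc N) (proj₂ x) c)) u≤N)) ,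
               (λ c → n≮n N (≤-trans (≤ᵇ⇒≤ (suc N) (proj₂ x) c) u≤N)) ,
               <⇒<ᵇ (s≤s u≤N) , ≤⇒≤ᵇ (≤-trans u≤N (n≤1+n N)))
            (λ c → n≮n (suc N) (<ᵇ⇒< (suc N) (suc N) c)) (≤⇒≤ᵇ (≤-refl {suc N})))
         (cong (_∧ VS s t) (sym (isRRS-cond z))))

outer-elim : ∀ {n} (q p r : Vec ℕ n) → T (outer q p r) →
             ∀ i → at p i ≤ at r i × at r i ≤ at q i × at q (suc i) ≤ at r i
outer-elim []       []       []       h i       = z≤n , z≤n , z≤n
outer-elim (q ∷ qs) (p ∷ ps) (r ∷ rs) h zero    =
  ≤ᵇ⇒≤ p r (∧-left (∧-left h)) , ≤ᵇ⇒≤ r q (∧-right {p ≤ᵇ r} (∧-left h)) ,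
  subst (_≤ r) (hd0≡at qs) (≤ᵇ⇒≤ (hd0 qs) r (∧-left (∧-right {(p ≤ᵇ r) ∧ (r ≤ᵇ q)} h)))
outer-elim (q ∷ qs) (p ∷ ps) (r ∷ rs) h (suc i) =
  outer-elim qs ps rs (∧-right {hd0 qs ≤ᵇ r} (∧-right {(p ≤ᵇ r) ∧ (r ≤ᵇ q)} h)) i

outer-intro : ∀ {n} (q p r : Vec ℕ n) → p ≤ᵛ r → r ≤ᵛ q → (∀ i → at q (suc i) ≤ at r i) → T (outer q p r)
outer-intro []       []       []       h₁ h₂ h₃ = tt
outer-intro (q ∷ qs) (p ∷ ps) (r ∷ rs) h₁ h₂ h₃ =
  ∧-intro (∧-intro (≤⇒≤ᵇ (h₁ 0)) (≤⇒≤ᵇ (h₂ 0)))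
    (∧-intro (≤⇒≤ᵇ (subst (_≤ r) (sym (hd0≡at qs)) (h₃ 0)))
        (outer-intro qs ps rs (h₁ ∘ suc) (h₂ ∘ suc) (h₃ ∘ suc)))

outer-Dec : ∀ {n} (q p r : Vec ℕ n) → T (outer q p r) → Dec r
outer-Dec q p r h i = ≤-trans (proj₁ (proj₂ (outer-elim q p r h (suc i))))
    (proj₂ (proj₂ (outer-elim q p r h i)))

il-elim : ∀ {n} (q r : Vec ℕ n) → T (il q r) → Interlaced q r
il-elim []       []       h i       = z≤n , z≤n
il-elim (q ∷ qs) (r ∷ rs) h zero    =
  subst (_≤ r) (hd0≡at qs) (≤ᵇ⇒≤ (hd0 qs) r (∧-left (∧-left h))) , ≤ᵇ⇒≤ r q (∧-right {hd0 qs ≤ᵇ r} (∧-left h))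
il-elim (q ∷ qs) (r ∷ rs) h (suc i) = il-elim qs rs (∧-right {(hd0 qs ≤ᵇ r) ∧ (r ≤ᵇ q)} h) i

il-intro : ∀ {n} (q r : Vec ℕ n) → Interlaced q r → T (il q r)
il-intro []       []       h = tt
il-intro (q ∷ qs) (r ∷ rs) h =
  ∧-intro (∧-intro (≤⇒≤ᵇ (subst (_≤ r) (sym (hd0≡at qs)) (proj₁ (h 0)))) (≤⇒≤ᵇ (proj₂ (h 0))))
      (il-intro qs rs (h ∘ suc))

outer≡il : ∀ {n} (q p r : Vec ℕ n) → p ≤ᵛ r → outer q p r ≡ il q r
outer≡il q p r p≤r = T⇔⇒≡
  (λ h → il-intro q r (λ i → proj₂ (proj₂ (outer-elim q p r h i)) , proj₁ (proj₂ (outer-elim q p r h i))))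
  (λ h → outer-intro q p r p≤r (λ i → proj₂ (il-elim q r h i)) (λ i → proj₁ (il-elim q r h i)))

size-self : ∀ {n} (q : Vec ℕ n) → size q q ≡ 0
size-self []       = refl
size-self (q ∷ qs) = cong₂ _+_ (n∸n≡0 q) (size-self qs)

isSSYT-↭ : ∀ {xs ys} → xs ↭ ys → isSSYT xs ≡ isSSYT ys
isSSYT-↭ = allPairs-↭ _

isRRS-↭ : ∀ {xs ys} → xs ↭ ys → isReverseRowStrict xs ≡ isReverseRowStrict ys
isRRS-↭ = allPairs-↭ _

-- Removing the largest label from a sum over tableaux.

module Tableaux (m : ℕ) (j₀ : ℕ) {n : ℕ} where
  open Boxes j₀
  open InnerStrips j₀
  open Matrix m n

  -- Over the empty alphabet only the empty shape has a filling, and with `p ≤ᵛ q` an empty shape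
  -- means `q ≡ p`.
  Fill-none : ∀ {U : Set} (q p : Vec ℕ n) (F : List (Box × U) → ℤ) → p ≤ᵛ q → Fill [] (bx 1 q p) F ≡
      ⟦ eqV q p ⟧ · F []
  Fill-none {U} q p F p≤q = byBoxes (bx 1 q p) refl
    where
    byBoxes : ∀ bs → bx 1 q p ≡ bs → Fill [] bs F ≡ ⟦ eqV q p ⟧ · F []
    byBoxes []       e = trans (Fill-[] [] F) (sym (⟦true⟧· _ (trans (cong (λ v → eqV v p) q≡p) (eqV-refl p))))
      where
      q≡p : q ≡ p
      q≡p = at-ext q p (λ i → ≤-antisym (bound i) (p≤q i))
        where
        bound : ∀ i → at q i ≤ at p i
        bound i with ≤-<-connex (at q i) (at p i)
        ... | inj₁ h = h
        ... | inj₂ h with subst (λ bs → cell (1 + i) (at q i) ∈ bs) e (bx-∈⁺ 1 q p i h ≤-refl)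
        ... | ()
    byBoxes (b ∷ bs) e = trans (Fill-empty b bs F) (sym (⟦false⟧· _ (eqV-false {xs = q} {p} (λ q≡p →
      1≢0 (trans (trans (sym (cong length e)) (length-bx j₀ 1 q p))
          (trans (cong (λ v → size v p) q≡p) (size-self p)))))))
      where
      1≢0 : ∀ {k} → suc k ≢ 0
      1≢0 ()

  ssyt-step : ∀ N (q p : Vec ℕ n) (P : List (Box × ℕ) → ℤ) → Invariant P →
    q ∈ vecs m n → T (dec q) → T (dec p) → p ≤ᵛ q →
    Fill (range1 (suc N)) (bx 1 q p) (λ z → ⟦ isSSYT z ⟧ · P z)
    ≡ ∑ (vecs m n) (λ r → ⟦ outer q p r ⟧ ·
        Fill (range1 N) (bx 1 r p) (λ z → ⟦ isSSYT z ⟧ · P (z ++ label (suc N) (bx 1 q r))))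
  ssyt-step N q p P inv q∈ dq dp p≤q =
    trans (cong (λ vs → Fill vs (bx 1 q p) (λ z → ⟦ isSSYT z ⟧ · P z)) (range1-suc N))
    (trans (Fill-∷ʳ (range1 N) (suc N) (bx 1 q p) (λ z → ⟦ isSSYT z ⟧ · P z)
                    (λ e → cong₂ _·_ (cong ⟦_⟧ (isSSYT-↭ e)) (inv e)))
    (trans (∑-cong (splits (bx 1 q p)) (λ (s , t) →
              trans (Fill-cong (range1 N) s (λ z bz l →
                       trans (cong (_· P (z ++ label (suc N) t))
                                (trans (cong ⟦_⟧ (isSSYT-label N z s t bz l))
                                    (trans (⟦∧⟧ (isSSYT z) (HS s t)) (·-comm _ _))))
                             (·-assoc _ _ _)))
                    (Fill-· (range1 N) s ⟦ HS s t ⟧ _)))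
           (∑-outer 1 q p (λ s t → Fill (range1 N) s (λ z → ⟦ isSSYT z ⟧ · P (z ++ label (suc N) t))) q∈ dq
               dp p≤q)))

  rrs-step : ∀ N (q p : Vec ℕ n) (P : List (Box × ℕ) → ℤ) → Invariant P →
    q ∈ vecs m n → T (dec q) → T (dec p) → p ≤ᵛ q →
    Fill (range1 (suc N)) (bx 1 q p) (λ z → ⟦ isReverseRowStrict z ⟧ · P z)
    ≡ ∑ (vecs m n) (λ r → ⟦ inner q p r ⟧ ·
        Fill (range1 N) (bx 1 q r) (λ z → ⟦ isReverseRowStrict z ⟧ · P (z ++ label (suc N) (bx 1 r p))))
  rrs-step N q p P inv q∈ dq dp p≤q =
    trans (cong (λ vs → Fill vs (bx 1 q p) (λ z → ⟦ isReverseRowStrict z ⟧ · P z)) (range1-suc N))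
    (trans (Fill-∷ʳ (range1 N) (suc N) (bx 1 q p) (λ z → ⟦ isReverseRowStrict z ⟧ · P z)
                    (λ e → cong₂ _·_ (cong ⟦_⟧ (isRRS-↭ e)) (inv e)))
    (trans (∑-cong (splits (bx 1 q p)) (λ (s , t) →
              trans (Fill-cong (range1 N) s (λ z bz l →
                       trans (cong (_· P (z ++ label (suc N) t))
                                (trans (cong ⟦_⟧ (isRRS-label N z s t bz l))
                                    (trans (⟦∧⟧ (isReverseRowStrict z) (VS s t)) (·-comm _ _))))
                             (·-assoc _ _ _)))
                    (Fill-· (range1 N) s ⟦ VS s t ⟧ _)))
           (∑-inner 1 q p (λ s t → Fill (range1 N) s
               (λ z → ⟦ isReverseRowStrict z ⟧ · P (z ++ label (suc N) t))) q∈ dq dp p≤q)))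

-- Contents, row bounds and signs under adding a label.

all-map : ∀ (p : B → Bool) (f : A → B) xs → all p (map f xs) ≡ all (p ∘ f) xs
all-map p f []       = refl
all-map p f (x ∷ xs) = cong (p (f x) ∧_) (all-map p f xs)

count-all : ∀ (p : A → Bool) xs → (∀ x → x ∈ xs → p x ≡ true) → count p xs ≡ length xs
count-all p []       h = refl
count-all p (x ∷ xs) h =
  trans (count-∷ p x xs) (cong₂ _+_ (cong b2n (h x (here refl))) (count-all p xs (λ y y∈ → h y (there y∈))))

-- hasContent with the multiplicity of the largest label listed first
hasC : List ℕ → List ℕ → Bool
hasC []       es = true
hasC (d ∷ ds) es = hasC ds es ∧ (occurrences (suc (length ds)) es ≡ᵇ d)

hasContentFrom-∷ʳ : ∀ k cs d es →
  hasContentFrom k (cs ++ d ∷ []) es ≡ hasContentFrom k cs es ∧ (occurrences (k + length cs) es ≡ᵇ d)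
hasContentFrom-∷ʳ k []       d es = trans (∧-identityʳ _)
    (cong (λ z → occurrences z es ≡ᵇ d) (sym (+-identityʳ k)))
hasContentFrom-∷ʳ k (c ∷ cs) d es =
  trans (cong ((occurrences k es ≡ᵇ c) ∧_)
          (trans (hasContentFrom-∷ʳ (suc k) cs d es)
                 (cong (λ z → hasContentFrom (suc k) cs es ∧ (occurrences z es ≡ᵇ d))
                     (sym (+-suc k (length cs))))))
        (sym (∧-assoc (occurrences k es ≡ᵇ c) _ _))

hasContent-reverse : ∀ ds es → hasContent (reverse ds) es ≡ hasC ds es
hasContent-reverse []       es = refl
hasContent-reverse (d ∷ ds) es =
  trans (cong (λ c → hasContent c es) (unfold-reverse d ds))
  (trans (hasContentFrom-∷ʳ 1 (reverse ds) d es)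
         (cong₂ (λ x y → x ∧ (occurrences (suc y) es ≡ᵇ d)) (hasContent-reverse ds es) (length-reverse ds)))

hasC-cong : ∀ ds {es fs} → (∀ i → i ≤ length ds → occurrences i es ≡ occurrences i fs) → hasC ds es ≡ hasC ds fs
hasC-cong []       h = refl
hasC-cong (d ∷ ds) h = cong₂ (λ x y → x ∧ (y ≡ᵇ d)) (hasC-cong ds (λ i l → h i (≤-trans l (n≤1+n _))))
    (h (suc (length ds)) ≤-refl)

hasC-↭ : ∀ ds {es fs} → es ↭ fs → hasC ds es ≡ hasC ds fs
hasC-↭ ds e = hasC-cong ds (λ i _ → count-↭ (i ≡ᵇ_) e)

hasC-label : ∀ d ds z t → Labels≤ (length ds) z →
             hasC (d ∷ ds) (map proj₂ (z ++ label (suc (length ds)) t)) ≡ hasC ds (map proj₂ z) ∧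
                 (length t ≡ᵇ d)
hasC-label d ds z t l =
  cong₂ (λ x y → x ∧ (y ≡ᵇ d)) (hasC-cong ds low) (trans (occ N) (cong₂ _+_ old new))
  where
  N = suc (length ds)
  new-labels : ∀ u → u ∈ map proj₂ (label N t) → u ≡ N
  new-labels u u∈ with ∈-map⁻ proj₂ u∈
  ... | x , x∈ , refl = proj₂ (∈-label⁻ t x∈)
  occ : ∀ i → occurrences i (map proj₂ (z ++ label N t)) ≡ occurrences i (map proj₂ z) + occurrences i
      (map proj₂ (label N t))
  occ i = trans (cong (occurrences i) (map-++ proj₂ z (label N t))) (count-++ (i ≡ᵇ_) (map proj₂ z) _)
  low : ∀ i → i ≤ length ds → occurrences i (map proj₂ (z ++ label N t)) ≡ occurrences i (map proj₂ z)
  low i i≤ = trans (occ i) (trans (cong (λ c → occurrences i (map proj₂ z) + c)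
    (count-none (i ≡ᵇ_) _ (λ u u∈ → ≡ᵇ-false (λ e → n≮n i
        (≤-trans (s≤s i≤) (≤-reflexive (sym (trans e (new-labels u u∈)))))))))
    (+-identityʳ _))
  old : occurrences N (map proj₂ z) ≡ 0
  old = count-none (N ≡ᵇ_) _ (λ u u∈ → ≡ᵇ-false (λ e → bad u e (∈-map⁻ proj₂ u∈)))
    where
    bad : ∀ u → N ≡ u → ¬ (∃[ x ] (x ∈ z × u ≡ proj₂ x))
    bad u e (x , x∈ , refl) = n≮n (length ds) (≤-trans (≤-reflexive e) (∈-range1⁻ (All.lookup l x∈)))
  new : occurrences N (map proj₂ (label N t)) ≡ length t
  new = trans (count-all (N ≡ᵇ_) _ (λ u u∈ → trans (cong (N ≡ᵇ_) (new-labels u u∈)) (≡ᵇ-refl N)))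
              (trans (length-map proj₂ (label N t)) (length-map _ t))

isRowWeaklyBounded-label : ∀ y z t → isRowWeaklyBounded (z ++ label y t) ≡ isRowWeaklyBounded z ∧ all
    (λ b → y ≤ᵇ row b) t
isRowWeaklyBounded-label y z t =
  trans (all-++ _ z (label y t)) (cong (isRowWeaklyBounded z ∧_) (all-map _ _ t))

isRowBounded-label : ∀ y z t → isRowBounded (z ++ label y t) ≡ isRowBounded z ∧ all (λ b → y <ᵇ row b) t
isRowBounded-label y z t =
  trans (all-++ _ z (label y t)) (cong (isRowBounded z ∧_) (all-map _ _ t))

opaque
  unfolding _·_

  sign-+ : ∀ a b → sign (a + b) ≡ sign a · sign b
  sign-+ a b = ℤₚ.^-distribˡ-+-* -1ℤ a b

  sign-suc : ∀ a → sign (suc a) ≡ -1ℤ · sign a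
  sign-suc a = refl

sg-self : ∀ q → sg q q ≡ 1ℤ
sg-self q = trans (x⊕-0 _ (cong ⟦_⟧ (≡ᵇ-false {suc q} {q} (λ e → n≮n q (≤-reflexive e)))))
    (cong ⟦_⟧ (≡ᵇ-refl q))

sg-suc : ∀ q → sg q (suc q) ≡ -1ℤ
sg-suc q = trans (0⊕- _ (cong ⟦_⟧ (≡ᵇ-false {q} {suc q} (λ e → n≮n q (≤-reflexive (sym e))))))
                 (trans (cong (λ b → -1ℤ · ⟦ b ⟧) (≡ᵇ-refl q)) (·-identityʳ -1ℤ))

vsgn-eval : ∀ {n} k (q r : Vec ℕ n) → VStrip k q r → vsgn k q r ≡ sign (size r q)
vsgn-eval k       []       []       h = refl
vsgn-eval zero    (q ∷ qs) (r ∷ rs) h =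
  trans (cong₂ _·_ (one (m≤n⇒m<n∨m≡n (proj₁ (h 0))))
                   (vsgn-eval 0 qs rs (λ i → proj₁ (h (suc i)) , proj₁ (proj₂ (h (suc i))) , λ ())))
        (sym (sign-+ (r ∸ q) (size rs qs)))
  where
  one : q < r ⊎ q ≡ r → sg q r ≡ sign (r ∸ q)
  one (inj₂ refl) = trans (sg-self q) (sym (cong sign (n∸n≡0 q)))
  one (inj₁ l) with ≤-antisym (proj₁ (proj₂ (h 0))) l
  ... | refl = trans (sg-suc q) (sym (cong sign (trans (+-∸-assoc 1 (≤-refl {q})) (cong suc (n∸n≡0 q)))))
vsgn-eval (suc k) (q ∷ qs) (r ∷ rs) h with proj₂ (proj₂ (h 0)) (s≤s z≤n)
... | refl = trans (⟦true⟧· _ (≡ᵇ-refl q))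
  (trans (vsgn-eval k qs rs (λ i → proj₁ (h (suc i)) , proj₁ (proj₂ (h (suc i))) , λ l → proj₂
      (proj₂ (h (suc i))) (s≤s l)))
         (cong (λ z → sign (z + size rs qs)) (sym (n∸n≡0 q))))

size-+ : ∀ {n} (q r p : Vec ℕ n) → p ≤ᵛ r → r ≤ᵛ q → size q p ≡ size q r + size r p
size-+ []       []       []       h₁ h₂ = refl
size-+ (q ∷ qs) (r ∷ rs) (p ∷ ps) h₁ h₂ =
  trans (cong₂ _+_ (trans (cong (_∸ p) (sym (m∸n+n≡m (h₂ 0)))) (+-∸-assoc (q ∸ r) (h₁ 0)))
                   (size-+ qs rs ps (h₁ ∘ suc) (h₂ ∘ suc)))
        (+-interchange (q ∸ r) (r ∸ p) (size qs rs) (size rs ps))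
  where
  +-interchange : ∀ a b c d → (a + b) + (c + d) ≡ (a + c) + (b + d)
  +-interchange a b c d = trans (+-assoc a b (c + d)) (trans (cong (λ z → a + z)
    (trans (sym (+-assoc b c d)) (trans (cong (λ z → z + d) (+-comm b c)) (+-assoc c b d))))
        (sym (+-assoc a c (b + d))))

inner-elim : ∀ {n} (q p r : Vec ℕ n) → T (inner q p r) → ∀ i → at p i ≤ at r i × at r i ≤ at q i × at r i ≤
    suc (at p i)
inner-elim []       []       []       h i       = z≤n , z≤n , z≤n
inner-elim (q ∷ qs) (p ∷ ps) (r ∷ rs) h zero    =
  ≤ᵇ⇒≤ p r (∧-left (∧-left h′)) , ≤ᵇ⇒≤ r q (∧-right {p ≤ᵇ r} (∧-left h′)) ,
  ≤ᵇ⇒≤ r (suc p) (∧-right {(p ≤ᵇ r) ∧ (r ≤ᵇ q)} h′)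
  where h′ = ∧-left h
inner-elim (q ∷ qs) (p ∷ ps) (r ∷ rs) h (suc i) =
  inner-elim qs ps rs (∧-right {hd0 rs ≤ᵇ r} (∧-right {((p ≤ᵇ r) ∧ (r ≤ᵇ q)) ∧ (r ≤ᵇ suc p)} h)) i

inner-intro : ∀ {n} (q p r : Vec ℕ n) → Dec r → p ≤ᵛ r → r ≤ᵛ q → (∀ i → at r i ≤ suc (at p i)) → T
    (inner q p r)
inner-intro []       []       []       d h₁ h₂ h₃ = tt
inner-intro (q ∷ qs) (p ∷ ps) (r ∷ rs) d h₁ h₂ h₃ =
  ∧-intro (∧-intro (∧-intro (≤⇒≤ᵇ (h₁ 0)) (≤⇒≤ᵇ (h₂ 0))) (≤⇒≤ᵇ (h₃ 0)))
    (∧-intro (≤⇒≤ᵇ (subst (_≤ r) (sym (hd0≡at rs)) (d 0)))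
             (inner-intro qs ps rs (d ∘ suc) (h₁ ∘ suc) (h₂ ∘ suc) (h₃ ∘ suc)))

-- Tableau counts as matrix entries.

module Bridge (m : ℕ) (j₀ : ℕ) {n : ℕ} where
  open Boxes j₀
  open Matrix m n
  open Tableaux m j₀ {n}

  ssyt≡Γ : ∀ ds (q p : Vec ℕ n) → q ∈ vecs m n → T (dec q) → T (dec p) → p ≤ᵛ q →
           Fill (range1 (length ds)) (bx 1 q p) (λ z → ⟦ isSSYT z ⟧ · ⟦ hasC ds (map proj₂ z) ⟧) ≡ Γ ds q p
  ssyt≡Γ []       q p q∈ dq dp p≤q = trans (Fill-none q p _ p≤q)
      (trans (cong (⟦ eqV q p ⟧ ·_) (·-identityʳ 1ℤ)) (·-identityʳ _))
  ssyt≡Γ (d ∷ ds) q p q∈ dq dp p≤q =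
    trans (ssyt-step (length ds) q p (λ z → ⟦ hasC (d ∷ ds) (map proj₂ z) ⟧)
                     (λ e → cong ⟦_⟧ (hasC-↭ (d ∷ ds) (Permₚ.map⁺ proj₂ e))) q∈ dq dp p≤q)
          (∑-cong∈ (vecs m n) term)
    where
    step : ∀ r → r ∈ vecs m n → T (outer q p r) →
      Fill (range1 (length ds)) (bx 1 r p) (λ z → ⟦ isSSYT z ⟧ ·
          ⟦ hasC (d ∷ ds) (map proj₂ (z ++ label (suc (length ds)) (bx 1 q r))) ⟧)
      ≡ ⟦ size q r ≡ᵇ d ⟧ · Γ ds r p
    step r r∈ o =
      trans (Fill-cong (range1 (length ds)) (bx 1 r p) (λ z bz l →
               trans (cong (⟦ isSSYT z ⟧ ·_) (trans (cong ⟦_⟧ (hasC-label d ds z (bx 1 q r) l))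
                        (trans (⟦∧⟧ (hasC ds (map proj₂ z)) _) (·-comm _ _))))
                     (·-swap ⟦ isSSYT z ⟧ ⟦ length (bx 1 q r) ≡ᵇ d ⟧ _)))
      (trans (Fill-· (range1 (length ds)) (bx 1 r p) ⟦ length (bx 1 q r) ≡ᵇ d ⟧ _)
             (cong₂ (λ x y → ⟦ x ≡ᵇ d ⟧ · y) (length-bx j₀ 1 q r)
                    (ssyt≡Γ ds r p r∈ (Dec⇒dec r (outer-Dec q p r o)) dp (λ i → proj₁ (outer-elim q p r o i)))))
    term : ∀ r → r ∈ vecs m n → ⟦ outer q p r ⟧ ·
      Fill (range1 (length ds)) (bx 1 r p) (λ z → ⟦ isSSYT z ⟧ ·
          ⟦ hasC (d ∷ ds) (map proj₂ (z ++ label (suc (length ds)) (bx 1 q r))) ⟧)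
      ≡ g (coef d) 0 q r 0 0 · Γ ds r p
    term r r∈ =
      trans (⟦⟧-cond (outer q p r) (step r r∈))
      (trans (sym (·-assoc _ _ _))
             -- `outer` and `il` differ only by the condition `p ≤ᵛ r`, which holds wherever
             -- `Γ ds r p` is nonzero.
             (⊎-congʳ (Γ-supp ds r p) (λ h →
               trans (cong (λ b → ⟦ b ⟧ · ⟦ size q r ≡ᵇ d ⟧) (outer≡il q p r (λ i → proj₁ (h i))))
                     (sym (g₀-eval (coef d) q r 0 0)))))

  private
    both-cases : ∀ b {x y} → (T b → x ≡ y) → (y ≡ 0ℤ) ⊎ T b → ⟦ b ⟧ · x ≡ y
    both-cases true  h _        = trans (·-identityˡ _) (h tt)
    both-cases false h (inj₁ z) = trans (·-zeroˡ _) (sym z)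

  -- The label `k + 1` is banned from the first `k` rows, so the outer strip that carries it must
  -- leave these rows unchanged. For such a strip the bound and `hs k` are the same condition.
  rwb≡E : ∀ k (p p′ : Vec ℕ n) → p ∈ vecs m n → T (dec p) → T (dec p′) → p′ ≤ᵛ p →
          Fill (range1 k) (bx 1 p p′) (λ z → ⟦ isSSYT z ⟧ · ⟦ isRowWeaklyBounded z ⟧) ≡ E k p′ p
  rwb≡E zero    p p′ p∈ dp dp′ p′≤p =
    trans (Fill-none p p′ _ p′≤p) (trans (cong (⟦ eqV p p′ ⟧ ·_) (·-identityʳ 1ℤ)) (trans (·-identityʳ _)
      (cong ⟦_⟧ (T⇔⇒≡ (λ t → ≡⇒T (trans (cong (eqV p′) (eqV⇒≡ p p′ t)) (eqV-refl p′)))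
                      (λ t → ≡⇒T (trans (cong (eqV p) (eqV⇒≡ p′ p t)) (eqV-refl p)))))))
  rwb≡E (suc k) p p′ p∈ dp dp′ p′≤p =
    trans (ssyt-step k p p′ (λ z → ⟦ isRowWeaklyBounded z ⟧) (λ e → cong ⟦_⟧ (all-↭ _ e)) p∈ dp dp′ p′≤p)
          (∑-cong∈ (vecs m n) (λ r r∈ → both-cases (outer p p′ r) (step r r∈)
            (map-⊎ (λ { (e , h) → outer-intro p p′ r e (λ i → proj₁ (hs⇒HStrip k r p h i)) (below r h) })
                   (·-⊎ (E-supp k p′ r) (⟦⟧-⊎ (hs k r p))))))
    where
    low : List Box → Bool
    low = all (λ b → suc k ≤ᵇ row b)
    below : ∀ r → T (hs k r p) → ∀ i → at p (suc i) ≤ at r i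
    below r h i with ≤-<-connex k i
    ... | inj₁ k≤i = proj₂ (proj₂ (hs⇒HStrip k r p h i)) k≤i
    ... | inj₂ i<k = ≤-trans (dec⇒Dec p dp i) (≤-reflexive (sym (proj₁ (proj₂ (hs⇒HStrip k r p h i)) i<k)))
    low≡hs : ∀ r → T (outer p p′ r) → low (bx 1 p r) ≡ hs k r p
    low≡hs r o = T⇔⇒≡
      (λ t → HStrip⇒hs k r p (λ i → proj₁ (proj₂ (outer-elim p p′ r o i)) , fixed t i , λ _ → proj₂
          (proj₂ (outer-elim p p′ r o i))))
      (λ h → T-all-intro _ (bx 1 p r) (λ b b∈ → deep h b (bx-∈⁻ 1 p r b∈)))
      where
      fixed : T (low (bx 1 p r)) → ∀ i → i < k → at r i ≡ at p i
      fixed t i i<k with m≤n⇒m<n∨m≡n (proj₁ (proj₂ (outer-elim p p′ r o i)))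
      ... | inj₂ e = e
      ... | inj₁ l = ⊥-elim (n≮n k (≤-trans (≤ᵇ⇒≤ (suc k) (1 + i)
                       (T-all-elim _ (bx 1 p r) t (cell (1 + i) (at p i)) (bx-∈⁺ 1 p r i l ≤-refl))) i<k))
      deep : T (hs k r p) → ∀ b → ∃[ i ] ∃[ j ] (b ≡ cell (1 + i) j × at r i < j × j ≤ at p i) → T
          (suc k ≤ᵇ row b)
      deep h _ (i , j , refl , l , u) with ≤-<-connex k i
      ... | inj₁ k≤i = ≤⇒≤ᵇ (s≤s k≤i)
      ... | inj₂ i<k = ⊥-elim (n≮n (at r i) (<-≤-trans l
          (≤-trans u (≤-reflexive (sym (proj₁ (proj₂ (hs⇒HStrip k r p h i)) i<k))))))
    step : ∀ r → r ∈ vecs m n → T (outer p p′ r) →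
      Fill (range1 k) (bx 1 r p′) (λ z → ⟦ isSSYT z ⟧ · ⟦ isRowWeaklyBounded (z ++ label (suc k) (bx 1 p r)) ⟧)
      ≡ E k p′ r · ⟦ hs k r p ⟧
    step r r∈ o =
      trans (Fill-cong (range1 k) (bx 1 r p′) (λ z _ _ →
               trans (cong (⟦ isSSYT z ⟧ ·_) (trans (cong ⟦_⟧ (isRowWeaklyBounded-label (suc k) z (bx 1 p r)))
                        (trans (⟦∧⟧ (isRowWeaklyBounded z) _) (·-comm _ _))))
                     (·-swap ⟦ isSSYT z ⟧ ⟦ low (bx 1 p r) ⟧ _)))
      (trans (Fill-· (range1 k) (bx 1 r p′) ⟦ low (bx 1 p r) ⟧ _)
      (trans (·-comm _ _)
             (cong₂ (λ x y → x · ⟦ y ⟧)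
                    (rwb≡E k r p′ r∈ (Dec⇒dec r (outer-Dec p p′ r o)) dp′ (λ i → proj₁ (outer-elim p p′ r o i)))
                    (low≡hs r o))))

  -- The largest label is removed at the inner boundary, so the induction moves `q` and keeps `q′`.
  -- The sign of the whole shape is the product of the sign of the strip, supplied by `V`, and that
  -- of the rest.
  rrs≡C : ∀ k (q q′ : Vec ℕ n) → q′ ∈ vecs m n → T (dec q) → T (dec q′) → q ≤ᵛ q′ →
          sign (size q′ q) · Fill (range1 k) (bx 1 q′ q)
              (λ z → ⟦ isReverseRowStrict z ⟧ · ⟦ isRowBounded z ⟧) ≡ C k q q′
  rrs≡C zero    q q′ q∈ dq dq′ q≤q′ =
    trans (cong (sign (size q′ q) ·_) (trans (Fill-none q′ q _ q≤q′)
        (trans (cong (⟦ eqV q′ q ⟧ ·_) (·-identityʳ 1ℤ)) (·-identityʳ _))))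
          (byEq (∧-case (eqV q q′)))
    where
    byEq : T (eqV q q′) ⊎ eqV q q′ ≡ false → sign (size q′ q) · ⟦ eqV q′ q ⟧ ≡ ⟦ eqV q q′ ⟧
    byEq (inj₁ t) with eqV⇒≡ q q′ t
    ... | refl = trans (cong (λ z → sign z · ⟦ eqV q q ⟧) (size-self q)) (·-identityˡ _)
    byEq (inj₂ f) = trans (0·′ (sign (size q′ q))
        (⟦¬T⟧ (λ t → subst T f (≡⇒T (trans (cong (eqV q) (eqV⇒≡ q′ q t)) (eqV-refl q))))))
                          (sym (cong ⟦_⟧ f))
  rrs≡C (suc k) q q′ q∈ dq dq′ q≤q′ =
    trans (cong (sign (size q′ q) ·_)
                (rrs-step k q′ q (λ z → ⟦ isRowBounded z ⟧) (λ e → cong ⟦_⟧ (all-↭ _ e)) q∈ dq′ dq q≤q′))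
    (trans (sym (∑-*ˡ (vecs m n) (sign (size q′ q)) _))
           (∑-cong∈ (vecs m n) term))
    where
    low : List Box → Bool
    low = all (λ b → suc k <ᵇ row b)
    module _ (r : Vec ℕ n) where
      c = inner q′ q r ∧ low (bx 1 r q)
      strip : T c → VStrip (suc k) q r
      strip t i = proj₁ (inner-elim q′ q r (∧-left t) i) , proj₂ (proj₂ (inner-elim q′ q r (∧-left t) i)) ,
          fixed
        where
        fixed : i < suc k → at q i ≡ at r i
        fixed i≤k with m≤n⇒m<n∨m≡n (proj₁ (inner-elim q′ q r (∧-left t) i))
        ... | inj₂ e = e
        ... | inj₁ l = ⊥-elim (n≮n (suc k) (≤-trans (<ᵇ⇒< (suc k) (1 + i)
                         (T-all-elim _ (bx 1 r q) (∧-right {inner q′ q r} t) (cell (1 + i) (at r i))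
                             (bx-∈⁺ 1 r q i l ≤-refl))) i≤k))
      strip⁻ : T (dec q ∧ dec r) → VStrip (suc k) q r → r ≤ᵛ q′ → T c
      strip⁻ d v r≤q′ = ∧-intro
        (inner-intro q′ q r (dec⇒Dec r (∧-right {dec q} d)) (λ i → proj₁ (v i)) r≤q′
            (λ i → proj₁ (proj₂ (v i))))
        (T-all-intro _ (bx 1 r q) (λ b b∈ → deep b (bx-∈⁻ 1 r q b∈)))
        where
        deep : ∀ b → ∃[ i ] ∃[ j ] (b ≡ cell (1 + i) j × at q i < j × j ≤ at r i) → T (suc k <ᵇ row b)
        deep _ (i , j , refl , l , u) with ≤-<-connex (suc k) i
        ... | inj₁ k<i = <⇒<ᵇ (s≤s k<i)
        ... | inj₂ i≤k = ⊥-elim (n≮n (at q i) (<-≤-trans l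
            (≤-trans u (≤-reflexive (sym (proj₂ (proj₂ (v i)) i≤k))))))
      value : r ∈ vecs m n → T c →
        sign (size q′ q) · Fill (range1 k) (bx 1 q′ r) (λ z → ⟦ isReverseRowStrict z ⟧ · ⟦ isRowBounded z ⟧)
            ≡ V (suc k) q r · C k r q′
      value r∈ t =
        trans (cong (_· Fill (range1 k) (bx 1 q′ r) _)
                    (trans (cong sign (size-+ q′ r q (λ i → proj₁ (in-r i)) (λ i → proj₁ (proj₂ (in-r i)))))
                           (trans (sign-+ (size q′ r) (size r q)) (·-comm _ _))))
        (trans (·-assoc (sign (size r q)) _ _)
               (cong₂ _·_ (sym (trans (⟦true⟧· _ (T⇒≡ (∧-intro dq dr))) (vsgn-eval (suc k) q r (strip t))))
                          (rrs≡C k r q′ q∈ dr dq′ (λ i → proj₁ (proj₂ (in-r i))))))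
        where
        in-r = inner-elim q′ q r (∧-left t)
        dr = inner-dec q′ q r (∧-left t)
      term : r ∈ vecs m n → sign (size q′ q) · (⟦ inner q′ q r ⟧ ·
        Fill (range1 k) (bx 1 q′ r) (λ z → ⟦ isReverseRowStrict z ⟧ ·
            ⟦ isRowBounded (z ++ label (suc k) (bx 1 r q)) ⟧))
        ≡ V (suc k) q r · C k r q′
      term r∈ =
        trans (cong (λ x → sign (size q′ q) · (⟦ inner q′ q r ⟧ · x))
          (trans (Fill-cong (range1 k) (bx 1 q′ r) (λ z _ _ →
                    trans (cong (⟦ isReverseRowStrict z ⟧ ·_)
                        (trans (cong ⟦_⟧ (isRowBounded-label (suc k) z (bx 1 r q)))
                              (trans (⟦∧⟧ (isRowBounded z) _) (·-comm _ _))))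
                          (·-swap ⟦ isReverseRowStrict z ⟧ ⟦ low (bx 1 r q) ⟧ _)))
                 (Fill-· (range1 k) (bx 1 q′ r) ⟦ low (bx 1 r q) ⟧ _)))
        (trans (cong (sign (size q′ q) ·_) (trans (sym (·-assoc _ _ _))
            (cong (_· Fill (range1 k) (bx 1 q′ r) _) (sym (⟦∧⟧ (inner q′ q r) (low (bx 1 r q)))))))
        (trans (·-swap (sign (size q′ q)) ⟦ c ⟧ _)
               (both-cases c (value r∈) (map-⊎ (λ { ((d , v) , s) → strip⁻ d v s })
                   (·-⊎ (V-supp (suc k) q r) (C-supp k r q′))))))

-- Set-valued tableaux: adding the largest label.

extend : ℕ → List ℕ → List ℕ
extend y S = S ++ y ∷ []

∑-sublists-∷ʳ : ∀ xs y (f : List ℕ → ℤ) →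
                ∑ (sublists (xs ++ y ∷ [])) f ≡ ∑ (sublists xs) f ⊕ ∑ (sublists xs) (f ∘ extend y)
∑-sublists-∷ʳ []       y f =
  trans (∑-++ ((y ∷ []) ∷ []) ([] ∷ []) f) (trans (⊕-comm _ _)
      (cong (∑ ([] ∷ []) f ⊕_) (trans (∑-[ _ ] f) (sym (∑-[ _ ] _)))))
∑-sublists-∷ʳ (x ∷ xs) y f =
  trans (∑-++ (map (x ∷_) (sublists (xs ++ y ∷ []))) _ f)
  (trans (cong₂ _⊕_ (trans (∑-map (sublists (xs ++ y ∷ [])) (x ∷_) f) (∑-sublists-∷ʳ xs y (f ∘ (x ∷_))))
      (∑-sublists-∷ʳ xs y f))
  (trans (⊕-interchange _ _ _ _)
         (cong₂ _⊕_ (sym (trans (∑-++ (map (x ∷_) (sublists xs)) (sublists xs) f)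
             (cong (_⊕ ∑ (sublists xs) f) (∑-map (sublists xs) (x ∷_) f))))
                    (sym (trans (∑-++ (map (x ∷_) (sublists xs)) (sublists xs) _)
                        (cong (_⊕ ∑ (sublists xs) (f ∘ extend y)) (∑-map (sublists xs) (x ∷_) _)))))))

∑-sublists-nonempty : ∀ xs (f : List ℕ → ℤ) → ∑ (sublists xs) f ≡ ∑ (sublists xs)
    (λ S → ⟦ nonempty S ⟧ · f S) ⊕ f []
∑-sublists-nonempty []       f = trans (∑-[ [] ] f)
    (sym (trans (cong (_⊕ f []) (trans (∑-[ _ ] _) (·-zeroˡ _))) (⊕-identityˡ _)))
∑-sublists-nonempty (x ∷ xs) f =
  trans (∑-++ (map (x ∷_) (sublists xs)) (sublists xs) f)
  (trans (cong (∑ (map (x ∷_) (sublists xs)) f ⊕_) (∑-sublists-nonempty xs f))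
  (trans (sym (⊕-assoc _ _ _))
         (cong (_⊕ f []) (sym (trans (∑-++ (map (x ∷_) (sublists xs)) (sublists xs) _)
           (cong (_⊕ ∑ (sublists xs) (λ S → ⟦ nonempty S ⟧ · f S))
             (trans (∑-map (sublists xs) (x ∷_) _)
                 (trans (∑-cong (sublists xs) (λ S → ·-identityˡ _))
                 (sym (∑-map (sublists xs) (x ∷_) f))))))))))

nonempty-extend : ∀ S y → nonempty (extend y S) ≡ true
nonempty-extend []      y = refl
nonempty-extend (_ ∷ _) y = refl

-- The form that `Fill-∷ʳ-ad` expects: the set without the new label, the set enlarged by it, and
-- the new label alone.
∑-nonemptySubsets-suc : ∀ N (f : List ℕ → ℤ) →
  ∑ (nonemptySubsets (suc N)) f ≡ ∑ (nonemptySubsets N) (λ S → f S ⊕ f (extend (suc N) S)) ⊕ f (suc N ∷ [])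
∑-nonemptySubsets-suc N f =
  trans (∑-filter nonempty (sublists (range1 (suc N))) f)
  (trans (cong (λ r → ∑ (sublists r) (λ S → ⟦ nonempty S ⟧ · f S)) (range1-suc N))
  (trans (∑-sublists-∷ʳ (range1 N) (suc N) (λ S → ⟦ nonempty S ⟧ · f S))
  (trans (cong (∑ (sublists (range1 N)) (λ S → ⟦ nonempty S ⟧ · f S) ⊕_)
           (trans (∑-cong (sublists (range1 N)) (λ S → ⟦true⟧· _ (nonempty-extend S (suc N))))
                  (∑-sublists-nonempty (range1 N) (f ∘ extend (suc N)))))
  (trans (sym (⊕-assoc _ _ _))
         (cong (_⊕ f (suc N ∷ []))
           (trans (sym (∑-+ (sublists (range1 N)) _ _))
           (trans (∑-cong (sublists (range1 N))
               (λ S → sym (·-distribˡ ⟦ nonempty S ⟧ (f S) (f (extend (suc N) S)))))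
                  (sym (∑-filter nonempty (sublists (range1 N)) _)))))))))

sublists-⊆ : ∀ xs {S} → S ∈ sublists xs → ∀ {u} → u ∈ S → u ∈ xs
sublists-⊆ []       (here refl) ()
sublists-⊆ (x ∷ xs) S∈ u∈ with ∈-++⁻ (map (x ∷_) (sublists xs)) S∈
... | inj₂ h = there (sublists-⊆ xs h u∈)
... | inj₁ h with ∈-map⁻ _ h
sublists-⊆ (x ∷ xs) S∈ (here refl) | inj₁ h | S′ , S′∈ , refl = here refl
sublists-⊆ (x ∷ xs) S∈ (there u∈)  | inj₁ h | S′ , S′∈ , refl = there (sublists-⊆ xs S′∈ u∈)

maxL-≤ : ∀ S {y} → (∀ u → u ∈ S → u ≤ y) → maxL S ≤ y
maxL-≤ []      h = z≤n
maxL-≤ (x ∷ S) h = ⊔-lub (h x (here refl)) (maxL-≤ S (λ u u∈ → h u (there u∈)))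

maxL-extend : ∀ S {y} → (∀ u → u ∈ S → u ≤ y) → maxL (extend y S) ≡ y
maxL-extend []      {y} h = ⊔-identityʳ y
maxL-extend (x ∷ S) {y} h = trans (cong (x ⊔_) (maxL-extend S (λ u u∈ → h u (there u∈))))
    (m≤n⇒m⊔n≡n (h x (here refl)))

foldr-⊓-≤ : ∀ x xs → foldr _⊓_ x xs ≤ x
foldr-⊓-≤ x []       = ≤-refl
foldr-⊓-≤ x (z ∷ xs) = ≤-trans (m⊓n≤n z _) (foldr-⊓-≤ x xs)

-- The facts about a set of old labels on which comparisons depend: appending `suc N` leaves the
-- minimum alone and makes `suc N` the maximum.
record Bounded (N : ℕ) (S : List ℕ) : Set where
  field
    lo≤ : minL S ≤ N
    hi≤ : maxL S ≤ N
    lo-extend : minL (extend (suc N) S) ≡ minL S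
    hi-extend : maxL (extend (suc N) S) ≡ suc N
    no-new : ∀ u → u ∈ S → u ≤ N
    size≥1 : 1 ≤ length S

bounded : ∀ {N S} → S ∈ nonemptySubsets N → Bounded N S
bounded {N} {S} S∈ with ∈-filter⁻ (λ S → T? (nonempty S)) {xs = sublists (range1 N)} S∈
bounded {N} {[]}    S∈ | _ , ()
bounded {N} {x ∷ S} S∈ | S∈′ , _ = record
  { lo≤ = ≤-trans (foldr-⊓-≤ x S) (le x (here refl))
  ; hi≤ = maxL-≤ (x ∷ S) le
  ; lo-extend = trans (foldr-++ _⊓_ x S (suc N ∷ []))
      (cong (λ e → foldr _⊓_ e S) (m≥n⇒m⊓n≡n (≤-trans (le x (here refl)) (n≤1+n N))))
  ; hi-extend = maxL-extend (x ∷ S) (λ u u∈ → ≤-trans (le u u∈) (n≤1+n N))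
  ; no-new = le
  ; size≥1 = s≤s z≤n }
  where
  le : ∀ u → u ∈ x ∷ S → u ≤ N
  le u u∈ = ∈-range1⁻ (sublists-⊆ (range1 N) S∈′ u∈)
open Bounded

-- The box a of s may receive the largest label in addition to the labels it has, when t is occupied by that label.
corner : List Box → List Box → Box → Bool
corner s t a = all (λ b → not (sameRowLeft a b)) s ∧ all (λ b → not (sameColAbove a b)) (s ++ t)

svRow svCol : List ℕ → List ℕ → Bool
svRow S U = maxL S ≤ᵇ minL U
svCol S U = maxL S <ᵇ minL U

isSV-cond : ∀ z → isSetValuedSSYT z ≡ allPairs (Conditions.cond svRow svCol) z
isSV-cond z = allPairs-cong z (λ { (a , u) (b , v) → refl })

module SetValuedLabel (N : ℕ) (z : List (Box × List ℕ)) (s t : List Box) (bz : map proj₁ z ≡ s)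
                      (bd : ∀ {x} → x ∈ z → Bounded N (proj₂ x))
                      (o u : List (Box × List ℕ)) (so : SplitOf z o u) where
  open Conditions svRow svCol

  private
    y : List ℕ
    y = suc N ∷ []
    ad : List ℕ → List ℕ
    ad = extend (suc N)
    Y : List (Box × List ℕ)
    Y = o ++ (relabel ad u ++ label y t)

    data View (x : Box × List ℕ) : Set where
      plain : x ∈ z → View x
      both  : ∀ x₀ → x₀ ∈ u → x ≡ (proj₁ x₀ , ad (proj₂ x₀)) → View x
      new   : proj₁ x ∈ t → proj₂ x ≡ y → View x

    view : ∀ {x} → x ∈ Y → View x
    view x∈ with ∈-++⁻ o x∈
    ... | inj₁ h = plain (left so h)
    ... | inj₂ h with ∈-++⁻ (relabel ad u) h
    ... | inj₁ h′ with ∈-map⁻ _ h′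
    ... | x₀ , x₀∈ , e = both x₀ x₀∈ e
    view x∈ | inj₂ h | inj₂ h′ = new (proj₁ (∈-label⁻ t h′)) (proj₂ (∈-label⁻ t h′))

    hi-y : maxL y ≡ suc N
    hi-y = ⊔-identityʳ (suc N)

    -- Each old box reappears in `Y` with the same minimum and no smaller maximum, so conditions
    -- that hold in `Y` also hold in `z`.
    lift : ∀ {x} → x ∈ z → ∃[ S ] ((proj₁ x , S) ∈ Y × minL S ≡ minL (proj₂ x) × maxL (proj₂ x) ≤ maxL S)
    lift {x} x∈ with cover so x∈
    ... | inj₁ h = proj₂ x , ∈-++⁺ˡ h , refl , ≤-refl
    ... | inj₂ h = ad (proj₂ x) , ∈-++⁺ʳ o (∈-++⁺ˡ (∈-map⁺ _ h)) , lo-extend (bd x∈) ,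
                   ≤-trans (hi≤ (bd x∈)) (≤-trans (n≤1+n N) (≤-reflexive (sym (hi-extend (bd x∈)))))

    new∈ : ∀ {b} → b ∈ t → (b , y) ∈ Y
    new∈ b∈ = ∈-++⁺ʳ o (∈-++⁺ʳ (relabel ad u) (∈-label⁺ y t b∈))

    cornerᵘ : (Box × List ℕ) → Bool
    cornerᵘ x = corner s t (proj₁ x)

    row≤ : ∀ S U {k l} → maxL S ≡ k → minL U ≡ l → T (svRow S U) → k ≤ l
    row≤ S U refl refl c = ≤ᵇ⇒≤ (maxL S) (minL U) c

    col< : ∀ S U {k l} → maxL S ≡ k → minL U ≡ l → T (svCol S U) → k < l
    col< S U refl refl c = <ᵇ⇒< (maxL S) (minL U) c

  -- Towards the left and above, an enlarged set compares as the old one, because its minimum is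
  -- unchanged. Towards the right it tolerates only boxes of `t`, as rows increase weakly, and below
  -- it tolerates nothing; this is `corner`.
  isSV-label : isSetValuedSSYT Y ≡ (isSetValuedSSYT z ∧ HS s t) ∧ all cornerᵘ u
  isSV-label = trans (isSV-cond Y) (trans (T⇔⇒≡ fwd bwd)
      (cong (λ b → (b ∧ HS s t) ∧ all cornerᵘ u) (sym (isSV-cond z))))
    where
    fwd : T (allPairs cond Y) → T ((allPairs cond z ∧ HS s t) ∧ all cornerᵘ u)
    fwd c = ∧-intro (∧-intro (T-pairs-intro cond z old)
                             (∧-intro (none-intro sameRowLeft t s
                                 (λ a b a∈ b∈ → high-row (suc N ∷ []) hi-y (new∈ a∈) b∈))
                             (∧-intro (none-intro sameColAbove t s
                                 (λ a b a∈ b∈ → high-col (suc N ∷ []) hi-y (new∈ a∈) b∈))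
                                      (none-intro sameColAbove t t
                                          (λ a b a∈ b∈ → high-new (suc N ∷ []) hi-y (new∈ a∈) b∈)))))
                    (T-all-intro cornerᵘ u (λ x x∈ →
                      let x∈Y = ∈-++⁺ʳ o (∈-++⁺ˡ (∈-map⁺ _ x∈)) ; hi = hi-extend (bd (right so x∈)) in
                      ∧-intro (T-all-intro _ s (λ b b∈ → T-not (high-row _ hi x∈Y b∈)))
                              (T-all-intro _ (s ++ t) (λ b b∈ → T-not (below x∈Y hi (∈-++⁻ s b∈))))))
      where
      P : ∀ a b → a ∈ Y → b ∈ Y → T (cond a b)
      P = T-pairs-elim cond Y c
      old : ∀ a b → a ∈ z → b ∈ z → T (cond a b)
      old a b a∈ b∈ with lift a∈ | lift b∈
      ... | S , S∈ , _ , hS | U , U∈ , lU , _ = cond-intro a b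
        (λ r → ≤⇒≤ᵇ (≤-trans hS (row≤ S U refl lU (cond-row (proj₁ a , S) (proj₁ b , U) (P _ _ S∈ U∈) r))))
        (λ r → <⇒<ᵇ (≤-<-trans hS (col< S U refl lU (cond-col (proj₁ a , S) (proj₁ b , U) (P _ _ S∈ U∈) r))))
      high-row : ∀ {a b} S → maxL S ≡ suc N → (a , S) ∈ Y → b ∈ s → ¬ T (sameRowLeft a b)
      high-row {a} {b} S hS a∈ b∈ r with ∈-boxes bz b∈
      ... | V , b∈z with lift b∈z
      ... | U , U∈ , lU , _ = n≮n N (≤-trans (row≤ S U hS lU (cond-row (a , S) (b , U) (P _ _ a∈ U∈) r))
          (lo≤ (bd b∈z)))
      high-col : ∀ {a b} S → maxL S ≡ suc N → (a , S) ∈ Y → b ∈ s → ¬ T (sameColAbove a b)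
      high-col {a} {b} S hS a∈ b∈ r with ∈-boxes bz b∈
      ... | V , b∈z with lift b∈z
      ... | U , U∈ , lU , _ = n≮n N (≤-trans (<⇒≤
          (col< S U hS lU (cond-col (a , S) (b , U) (P _ _ a∈ U∈) r))) (lo≤ (bd b∈z)))
      high-new : ∀ {a b} S → maxL S ≡ suc N → (a , S) ∈ Y → b ∈ t → ¬ T (sameColAbove a b)
      high-new {a} {b} S hS a∈ b∈ r = n≮n (suc N)
          (col< S y hS refl (cond-col (a , S) (b , y) (P _ _ a∈ (new∈ b∈)) r))
      below : ∀ {a b S} → (a , S) ∈ Y → maxL S ≡ suc N → b ∈ s ⊎ b ∈ t → ¬ T (sameColAbove a b)
      below a∈ hS (inj₁ b∈) = high-col _ hS a∈ b∈
      below a∈ hS (inj₂ b∈) = high-new _ hS a∈ b∈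

    bwd : T ((allPairs cond z ∧ HS s t) ∧ all cornerᵘ u) → T (allPairs cond Y)
    bwd c = T-pairs-intro cond Y (λ a b a∈ b∈ → pick a b (view a∈) (view b∈))
      where
      Az : ∀ a b → a ∈ z → b ∈ z → T (cond a b)
      Az = T-pairs-elim cond z (∧-left (∧-left c))
      hs′ : T (HS s t)
      hs′ = ∧-right {allPairs cond z} (∧-left c)
      L = none-elim sameRowLeft t s (∧-left hs′)
      M = none-elim sameColAbove t s (∧-left (∧-right {none sameRowLeft t s} hs′))
      NN = none-elim sameColAbove t t (∧-right {none sameColAbove t s} (∧-right {none sameRowLeft t s} hs′))
      K : ∀ x → x ∈ u → T (corner s t (proj₁ x))
      K = T-all-elim cornerᵘ u (∧-right {allPairs cond z ∧ HS s t} c)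
      K-row : ∀ x → x ∈ u → ∀ b → b ∈ s → ¬ T (sameRowLeft (proj₁ x) b)
      K-row x x∈ b b∈ = T-not⁻ (T-all-elim _ s (∧-left (K x x∈)) b b∈)
      K-col : ∀ x → x ∈ u → ∀ b → b ∈ s ++ t → ¬ T (sameColAbove (proj₁ x) b)
      K-col x x∈ b b∈ = T-not⁻ (T-all-elim _ (s ++ t)
          (∧-right {all (λ b → not (sameRowLeft (proj₁ x) b)) s} (K x x∈)) b b∈)
      toRow : ∀ S U {k l} → maxL S ≡ k → minL U ≡ l → k ≤ l → T (svRow S U)
      toRow S U refl refl h = ≤⇒≤ᵇ h
      toCol : ∀ S U {k l} → maxL S ≡ k → minL U ≡ l → k < l → T (svCol S U)
      toCol S U refl refl h = <⇒<ᵇ h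
      pick : ∀ a b → View a → View b → T (cond a b)
      pick a b (plain p) (plain q) = Az a b p q
      pick a b (plain p) (both x x∈ refl) = cond-intro a b
        (λ r → toRow (proj₂ a) (ad (proj₂ x)) refl (lo-extend (bd (right so x∈)))
            (≤ᵇ⇒≤ (maxL (proj₂ a)) (minL (proj₂ x)) (cond-row a x (Az a x p (right so x∈)) r)))
        (λ r → toCol (proj₂ a) (ad (proj₂ x)) refl (lo-extend (bd (right so x∈)))
            (<ᵇ⇒< (maxL (proj₂ a)) (minL (proj₂ x)) (cond-col a x (Az a x p (right so x∈)) r)))
      pick a b (plain p) (new q refl) = cond-intro a b
        (λ _ → ≤⇒≤ᵇ (≤-trans (hi≤ (bd p)) (n≤1+n N))) (λ _ → <⇒<ᵇ (s≤s (hi≤ (bd p))))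
      pick a b (both x x∈ refl) (plain q) = cond-intro a b
        (λ r → ⊥-elim (K-row x x∈ (proj₁ b) (boxes-∈ bz q) r))
            (λ r → ⊥-elim (K-col x x∈ (proj₁ b) (∈-++⁺ˡ (boxes-∈ bz q)) r))
      pick a b (both x x∈ refl) (both x′ x′∈ refl) = cond-intro a b
        (λ r → ⊥-elim (K-row x x∈ (proj₁ b) (boxes-∈ bz (right so x′∈)) r))
        (λ r → ⊥-elim (K-col x x∈ (proj₁ b) (∈-++⁺ˡ (boxes-∈ bz (right so x′∈))) r))
      pick a b (both x x∈ refl) (new q refl) = cond-intro a b
        (λ _ → toRow (ad (proj₂ x)) y (hi-extend (bd (right so x∈))) refl ≤-refl)
        (λ r → ⊥-elim (K-col x x∈ (proj₁ b) (∈-++⁺ʳ s q) r))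
      pick a b (new p refl) (plain q) = cond-intro a b
        (λ r → ⊥-elim (L _ _ p (boxes-∈ bz q) r)) (λ r → ⊥-elim (M _ _ p (boxes-∈ bz q) r))
      pick a b (new p refl) (both x x∈ refl) = cond-intro a b
        (λ r → ⊥-elim (L _ _ p (boxes-∈ bz (right so x∈)) r))
            (λ r → ⊥-elim (M _ _ p (boxes-∈ bz (right so x∈)) r))
      pick a b (new p refl) (new q refl) = cond-intro a b
        (λ _ → toRow y y hi-y refl ≤-refl) (λ r → ⊥-elim (NN _ _ p q r))

-- Signs, contents and corner factors.

opaque
  unfolding _·_

  ·-arrange : ∀ v h a c e x l → ((v · h) · a) · ((c · e) · (x · l)) ≡ (h · (v · (c · x))) · (a · (l · e))
  ·-arrange = arrange
    where
    arrange : ∀ v h a c e x l → ((v *ℤ h) *ℤ a) *ℤ ((c *ℤ e) *ℤ (x *ℤ l)) ≡ (h *ℤ (v *ℤ (c *ℤ x))) *ℤ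
        (a *ℤ (l *ℤ e))
    arrange = solve-∀

splits-↭ : ∀ (xs : List A) {s t} → (s , t) ∈ splits xs → xs ↭ s ++ t
splits-↭ []       (here refl) = ↭-refl
splits-↭ (x ∷ xs) h with ∈-++⁻ (map _ (splits xs)) h
... | inj₁ h′ with ∈-map⁻ _ h′
... | (s , t) , st∈ , refl = ↭-prep x (splits-↭ xs st∈)
splits-↭ (x ∷ xs) h | inj₂ h′ with ∈-map⁻ _ h′
... | (s , t) , st∈ , refl = ↭-trans (↭-prep x (splits-↭ xs st∈)) (↭-sym (Permₚ.shift x s t))

wsum : (A → ℕ) → List A → ℕ
wsum h []       = 0
wsum h (x ∷ xs) = h x + wsum h xs

wsum-++ : ∀ (h : A → ℕ) xs ys → wsum h (xs ++ ys) ≡ wsum h xs + wsum h ys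
wsum-++ h []       ys = refl
wsum-++ h (x ∷ xs) ys = trans (cong (λ z → h x + z) (wsum-++ h xs ys)) (sym (+-assoc (h x) _ _))

wsum-↭ : ∀ (h : A → ℕ) {xs ys} → xs ↭ ys → wsum h xs ≡ wsum h ys
wsum-↭ h Perm.refl         = refl
wsum-↭ h (Perm.prep x e)   = cong (λ z → h x + z) (wsum-↭ h e)
wsum-↭ h {ys = _ ∷ _ ∷ ys} (Perm.swap x y e) =
  trans (cong (λ z → h x + (h y + z)) (wsum-↭ h e))
  (trans (sym (+-assoc (h x) (h y) _)) (trans (cong (λ z → z + wsum h ys) (+-comm (h x) (h y)))
      (+-assoc (h y) (h x) _)))
wsum-↭ h (Perm.trans e f)  = trans (wsum-↭ h e) (wsum-↭ h f)

wsum-map : ∀ (h : B → ℕ) (f : A → B) xs → wsum h (map f xs) ≡ wsum (h ∘ f) xs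
wsum-map h f []       = refl
wsum-map h f (x ∷ xs) = cong (λ z → h (f x) + z) (wsum-map h f xs)

wsum-const : ∀ (h : A → ℕ) k xs → (∀ x → x ∈ xs → h x ≡ k) → wsum h xs ≡ length xs * k
wsum-const h k []       e = refl
wsum-const h k (x ∷ xs) e = cong₂ _+_ (e x (here refl)) (wsum-const h k xs (λ y y∈ → e y (there y∈)))

wsum-cong : ∀ {h k : A → ℕ} xs → (∀ x → x ∈ xs → h x ≡ k x) → wsum h xs ≡ wsum k xs
wsum-cong []       e = refl
wsum-cong (x ∷ xs) e = cong₂ _+_ (e x (here refl)) (wsum-cong xs (λ y y∈ → e y (there y∈)))

SV : Set
SV = List (Box × List ℕ)

labels : SV → List ℕ
labels z = concat (map proj₂ z)

occ-labels : ∀ i z → occurrences i (labels z) ≡ wsum (occurrences i ∘ proj₂) z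
occ-labels i []      = refl
occ-labels i (x ∷ z) = trans (count-++ (i ≡ᵇ_) (proj₂ x) (labels z))
    (cong (λ c → occurrences i (proj₂ x) + c) (occ-labels i z))

hasC-labels-↭ : ∀ ds {xs ys : SV} → xs ↭ ys → hasC ds (labels xs) ≡ hasC ds (labels ys)
hasC-labels-↭ ds {xs} {ys} e = hasC-cong ds (λ i _ → trans (occ-labels i xs)
    (trans (wsum-↭ _ e) (sym (occ-labels i ys))))

-- Each box counts one more than its number of labels, so a box with a single label contributes an even number.
tot : SV → ℕ
tot = wsum (λ x → suc (length (proj₂ x)))

sign-² : ∀ k → sign k · sign k ≡ 1ℤ
sign-² zero    = ·-identityʳ 1ℤ
sign-² (suc k) =
  trans (cong₂ _·_ (sign-suc k) (sign-suc k))
  (trans (·-interchange -1ℤ (sign k) -1ℤ (sign k))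
      (trans (cong (-1ℤ · -1ℤ ·_) (sign-² k)) (trans (·-identityʳ _) (sym (sign-+ 1 1)))))

-- Every eligible box either keeps its set or takes the label with a minus sign, so it contributes a
-- factor `1 - x`; the sum is the expansion of the product of these factors.
∑-corners : ∀ (c : A → Bool) d z a →
  ∑ (splits z) (λ (o , u) → ⟦ all c u ⟧ · (sign (length u) · ⟦ a + length u ≡ᵇ d ⟧)) ≡ coef d a (count c z)
∑-corners c d []      a = trans (∑-[ _ ] _) (trans (·-identityˡ _)
    (trans (·-identityˡ _) (cong (λ e → ⟦ e ≡ᵇ d ⟧) (+-identityʳ a))))
∑-corners c d (x ∷ z) a =
  trans (∑-splits-∷ x z (λ o u → ⟦ all c u ⟧ · (sign (length u) · ⟦ a + length u ≡ᵇ d ⟧)))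
  (trans (cong₂ _⊕_ (∑-corners c d z a)
    (trans (∑-cong (splits z) (λ (o , u) → trans (cong₂ _·_ (⟦∧⟧ (c x) (all c u))
              (trans (cong₂ (λ x y → x · ⟦ y ≡ᵇ d ⟧) (sign-suc (length u)) (+-suc a (length u)))
                  (·-assoc -1ℤ _ _)))
            (trans (·-assoc ⟦ c x ⟧ _ _) (cong (⟦ c x ⟧ ·_) (·-swap ⟦ all c u ⟧ -1ℤ _)))))
    (trans (∑-·ˡ² (splits z) ⟦ c x ⟧ -1ℤ _) (cong (λ y → ⟦ c x ⟧ · (-1ℤ · y)) (∑-corners c d z (suc a))))))
    (trans (byC (c x)) (cong (coef d a) (sym (count-∷ c x z)))))
  where
  byC : ∀ b → coef d a (count c z) ⊕ ⟦ b ⟧ · (-1ℤ · coef d (suc a) (count c z)) ≡ coef d a (b2n b + count c z)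
  byC true  = cong (coef d a (count c z) ⊕_) (·-identityˡ _)
  byC false = trans (cong (coef d a (count c z) ⊕_) (·-zeroˡ _)) (⊕-identityʳ _)

-- The summand of the Grothendieck coefficient. The sign uses `tot` in place of the truncated
-- difference of sizes: it has the same parity, is additive over boxes and is visibly invariant
-- under permutations.
W : List ℕ → SV → ℤ
W ds z = ⟦ isSetValuedSSYT z ⟧ · (⟦ hasC ds (labels z) ⟧ · sign (tot z))

W-inv : ∀ ds → Invariant (W ds)
W-inv ds e = cong₂ _·_ (cong ⟦_⟧ (allPairs-↭ _ e))
    (cong₂ _·_ (cong ⟦_⟧ (hasC-labels-↭ ds e)) (cong sign (wsum-↭ _ e)))

count-map : ∀ (p : B → Bool) (f : A → B) xs → count p (map f xs) ≡ count (p ∘ f) xs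
count-map p f []       = refl
count-map p f (x ∷ xs) = trans (count-∷ p (f x) (map f xs))
    (trans (cong (λ z → b2n (p (f x)) + z) (count-map p f xs)) (sym (count-∷ (p ∘ f) x xs)))

module _ (d : ℕ) (ds : List ℕ) (z : SV) (s t : List Box) (bz : map proj₁ z ≡ s)
         (bd : ∀ {x} → x ∈ z → Bounded (length ds) (proj₂ x)) where
  private
    N : ℕ
    N = length ds
    y : List ℕ
    y = suc N ∷ []
    ad : List ℕ → List ℕ
    ad = extend (suc N)

  module _ {o u : SV} (ou∈ : (o , u) ∈ splits z) where
    private
      so = splitOf z ou∈
      Y : SV
      Y = o ++ (relabel ad u ++ label y t)
      wsum-Y : ∀ (h : Box × List ℕ → ℕ) → wsum h Y ≡ wsum h o + (wsum h (relabel ad u) + wsum h (label y t))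
      wsum-Y h = trans (wsum-++ h o _) (cong (λ c → wsum h o + c) (wsum-++ h (relabel ad u) (label y t)))
      wsum-z : ∀ (h : Box × List ℕ → ℕ) → wsum h z ≡ wsum h o + wsum h u
      wsum-z h = trans (wsum-↭ h (splits-↭ z ou∈)) (wsum-++ h o u)
      occ-old : ∀ i → i ≤ N → occurrences i (labels Y) ≡ occurrences i (labels z)
      occ-old i i≤N =
        trans (occ-labels i Y) (trans (wsum-Y occ)
        (trans (cong (λ c → wsum occ o + c)
          (trans (cong₂ _+_
                    (trans (wsum-map occ _ u) (wsum-cong u (λ x _ →
                      trans (count-++ (i ≡ᵇ_) (proj₂ x) y)
                          (trans (cong (λ c → occurrences i (proj₂ x) + c) not-new) (+-identityʳ _)))))
                    (trans (wsum-map occ _ t) (trans (wsum-const _ 0 t (λ _ _ → not-new))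
                        (*-zeroʳ (length t)))))
                 (+-identityʳ _)))
        (sym (trans (occ-labels i z) (wsum-z occ)))))
        where
        occ = occurrences i ∘ proj₂
        not-new : occurrences i y ≡ 0
        not-new = count-none (i ≡ᵇ_) y (λ { v (here refl) → ≡ᵇ-false
            (λ e → n≮n N (≤-trans (≤-reflexive (sym e)) i≤N)) })
      occ-new : occurrences (suc N) (labels Y) ≡ length t + length u
      occ-new =
        trans (occ-labels (suc N) Y) (trans (wsum-Y occ)
        (trans (cong₂ _+_ (trans (wsum-const occ 0 o (λ x x∈ → absent (left so x∈))) (*-zeroʳ (length o)))
          (cong₂ _+_
            (trans (wsum-map occ _ u) (trans (wsum-const _ 1 u (λ x x∈ →
               trans (count-++ (suc N ≡ᵇ_) (proj₂ x) y) (cong₂ _+_ (absent (right so x∈)) present)))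
                   (*-identityʳ (length u))))
            (trans (wsum-map occ _ t) (trans (wsum-const _ 1 t (λ _ _ → present)) (*-identityʳ (length t))))))
          (+-comm (length u) (length t))))
        where
        occ = occurrences (suc N) ∘ proj₂
        present : occurrences (suc N) y ≡ 1
        present = count-all (suc N ≡ᵇ_) y (λ { v (here refl) → ≡ᵇ-refl (suc N) })
        absent : ∀ {x} → x ∈ z → occurrences (suc N) (proj₂ x) ≡ 0
        absent {x} x∈ = count-none (suc N ≡ᵇ_) (proj₂ x)
          (λ v v∈ → ≡ᵇ-false (λ e → n≮n N (≤-trans (≤-reflexive e) (no-new (bd x∈) v v∈))))
      hasC-Y : hasC (d ∷ ds) (labels Y) ≡ hasC ds (labels z) ∧ (length t + length u ≡ᵇ d)
      hasC-Y = cong₂ (λ b c → b ∧ (c ≡ᵇ d)) (hasC-cong ds occ-old) occ-new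
      -- A box holding only the new label counts `2` and so drops out of the sign; an enlarged set
      -- counts one more than before.
      tot-Y : tot Y ≡ tot z + (length u + (length t + length t))
      tot-Y = trans (wsum-Y h) (trans (cong (λ c → wsum h o + c) (cong₂ _+_ tot-u tot-t))
              (trans (sym (+-assoc (wsum h o) _ _)) (trans (cong (λ c → c + (length t + length t))
                 (trans (sym (+-assoc (wsum h o) (wsum h u) (length u)))
                     (cong (λ c → c + length u) (sym (wsum-z h)))))
                 (+-assoc (tot z) (length u) _))))
        where
        h : Box × List ℕ → ℕ
        h x = suc (length (proj₂ x))
        tot-u : wsum h (relabel ad u) ≡ wsum h u + length u
        tot-u = trans (wsum-map h _ u) (go u)
          where
          go : ∀ u → wsum (λ x → h (proj₁ x , ad (proj₂ x))) u ≡ wsum h u + length u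
          go []      = refl
          go (x ∷ u) = trans (cong₂ (λ b c → suc b + c)
              (trans (length-++ (proj₂ x)) (+-comm (length (proj₂ x)) 1)) (go u))
                             (cong suc (trans (sym (+-suc (length (proj₂ x)) _))
                                 (trans (cong (λ c → length (proj₂ x) + c) (sym (+-suc (wsum h u) (length u))))
                                  (sym (+-assoc (length (proj₂ x)) (wsum h u) _)))))
        tot-t : wsum h (label y t) ≡ length t + length t
        tot-t = trans (wsum-map h _ t) (trans (wsum-const _ 2 t (λ _ _ → refl))
            (trans (*-comm (length t) 2) (cong (λ c → length t + c) (+-identityʳ (length t)))))
      sign-Y : sign (tot Y) ≡ sign (tot z) · sign (length u)
      sign-Y = trans (cong sign tot-Y) (trans (sign-+ (tot z) _) (cong (sign (tot z) ·_)
        (trans (sign-+ (length u) _) (trans (cong (sign (length u) ·_)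
            (trans (sign-+ (length t) (length t)) (sign-² (length t)))) (·-identityʳ _)))))

    W-split : W (d ∷ ds) Y ≡ (⟦ HS s t ⟧ · W ds z) ·
              (⟦ all (λ x → corner s t (proj₁ x)) u ⟧ · (sign (length u) · ⟦ length t + length u ≡ᵇ d ⟧))
    W-split =
      trans (cong₂ _·_ (trans (cong ⟦_⟧ (SetValuedLabel.isSV-label N z s t bz bd o u so))
                              (trans (⟦∧⟧ (isSetValuedSSYT z ∧ HS s t) _)
                                  (cong (_· _) (⟦∧⟧ (isSetValuedSSYT z) (HS s t)))))
                       (cong₂ _·_ (trans (cong ⟦_⟧ hasC-Y) (⟦∧⟧ (hasC ds (labels z)) _)) sign-Y))
            (·-arrange ⟦ isSetValuedSSYT z ⟧ ⟦ HS s t ⟧ _ ⟦ hasC ds (labels z) ⟧ _ (sign (tot z))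
                (sign (length u)))

  ∑-W-split : ∑ (splits z) (λ (o , u) → W (d ∷ ds) (o ++ (relabel ad u ++ label y t)))
              ≡ (⟦ HS s t ⟧ · coef d (length t) (count (corner s t) s)) · W ds z
  ∑-W-split =
    trans (∑-cong∈ (splits z) (λ (o , u) ou∈ → W-split ou∈))
    (trans (∑-*ˡ (splits z) (⟦ HS s t ⟧ · W ds z) _)
    (trans (cong ((⟦ HS s t ⟧ · W ds z) ·_)
              (trans (∑-corners (λ x → corner s t (proj₁ x)) d z (length t))
                     (cong (coef d (length t)) (trans (sym (count-map (corner s t) proj₁ z))
                         (cong (count (corner s t)) bz)))))
    (trans (·-assoc _ _ _) (trans (cong (⟦ HS s t ⟧ ·_) (·-comm _ _)) (sym (·-assoc _ _ _))))))

-- Set-valued tableaux as entries of the Grothendieck matrix.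

Dec-mono : ∀ {n} (q : Vec ℕ n) → Dec q → ∀ i k → at q (i + k) ≤ at q i
Dec-mono q dq i zero    = ≤-reflexive (cong (at q) (+-identityʳ i))
Dec-mono q dq i (suc k) = ≤-trans (≤-reflexive (cong (at q) (+-suc i k)))
    (≤-trans (dq (i + k)) (Dec-mono q dq i k))

module GrothBridge (m : ℕ) (j₀ : ℕ) {n : ℕ} where
  open Boxes j₀
  open Tableaux m j₀ {n}

  -- Along a row only the last cell can satisfy `c`, so the count is `0` or `1`; in an empty row the
  -- test `p < p + 0` fails.
  count-row : ∀ (c : Box → Bool) i p k (B : ℕ → Bool) →
    (∀ j → p < j → j ≤ p + k → c (cell i j) ≡ (j ≡ᵇ p + k) ∧ B j) →
    count c (cells i (seg p k)) ≡ b2n ((p <ᵇ p + k) ∧ B (p + k))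
  count-row c i p zero          B e = sym (cong (λ b → b2n (b ∧ B (p + 0)))
      (<ᵇ-false {p} {p + 0} (≤-reflexive (+-identityʳ p))))
  count-row c i p (suc zero)    B e =
    trans (count-∷ c (cell i (suc p)) []) (trans (+-identityʳ _) (cong b2n
      (trans (e (suc p) ≤-refl (≤-reflexive (sym p1)))
             (cong₂ _∧_ (trans (T⇒≡ (≡⇒≡ᵇ (suc p) (p + 1) (sym p1)))
                 (sym (<ᵇ-true {p} {p + 1} (≤-reflexive (sym p1))))) (cong B (sym p1))))))
    where
    p1 : p + 1 ≡ suc p
    p1 = +-comm p 1
  count-row c i p (suc (suc k)) B e =
    trans (count-∷ c (cell i (suc p)) (cells i (seg (suc p) (suc k))))
    (trans (cong₂ _+_ (cong b2n (trans (e (suc p) ≤-refl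
        (≤-trans (s≤s (m≤m+n p (suc k))) (≤-reflexive (sym p2))))
                                       (cong (_∧ B (suc p)) (≡ᵇ-false
                                           (λ h → n≮n (suc p) (≤-trans
                                           (s≤s (≤-trans (m≤m+n (suc p) k) (≤-reflexive (sym (+-suc p k)))))
                                           (≤-reflexive (trans (sym p2) (sym h)))))))))
                      (count-row c i (suc p) (suc k) B
                          (λ j l u → trans (e j (<⇒≤ l) (≤-trans u (≤-reflexive (sym p2))))
                          (cong (λ z → (j ≡ᵇ z) ∧ B j) p2))))
           (trans (cong (λ z → b2n ((suc p <ᵇ z) ∧ B z)) (sym p2))
                  (cong (λ b → b2n (b ∧ B (p + suc (suc k))))
                    (trans (<ᵇ-true {suc p} (≤-trans (s≤s (s≤s (m≤m+n p k)))
                        (≤-reflexive (trans (cong suc (sym (+-suc p k))) (sym p2)))))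
                           (sym (<ᵇ-true {p} (≤-trans (s≤s (m≤m+n p (suc k))) (≤-reflexive (sym p2)))))))))
    where
    p2 : p + suc (suc k) ≡ suc p + suc k
    p2 = +-suc p (suc k)

  count-bx : ∀ {n} (c : Box → Bool) i (q p r : Vec ℕ n) → p ≤ᵛ r →
    (∀ k j → at p k < j → j ≤ at r k → c (cell (i + k) j) ≡ (j ≡ᵇ at r k) ∧ (at q (suc k) <ᵇ j)) →
    count c (bx i r p) ≡ corners q p r
  count-bx c i []       []       []       p≤r e = refl
  count-bx c i (q ∷ qs) (p ∷ ps) (r ∷ rs) p≤r e =
    trans (count-++ c (cells i (seg p (r ∸ p))) (bx (suc i) rs ps))
    (cong₂ _+_
      (trans (count-row c i p (r ∸ p) (hd0 qs <ᵇ_) (λ j l u →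
                trans (cong (λ z → c (cell z j)) (sym (+-identityʳ i)))
                (trans (e 0 j l (≤-trans u (≤-reflexive r≡)))
                       (cong₂ (λ x y → (j ≡ᵇ x) ∧ (y <ᵇ j)) (sym r≡) (sym (hd0≡at qs))))))
             (cong (λ z → b2n ((p <ᵇ z) ∧ (hd0 qs <ᵇ z))) r≡))
      (count-bx c (suc i) qs ps rs (p≤r ∘ suc)
          (λ k j l u → trans (cong (λ z → c (cell z j)) (sym (+-suc i k))) (e (suc k) j l u))))
    where r≡ = m+[n∸m]≡n (p≤r 0)

  count-corners : ∀ (q p r : Vec ℕ n) → Dec q → Dec p → T (outer q p r) →
                  count (corner (bx 1 r p) (bx 1 q r)) (bx 1 r p) ≡ corners q p r
  count-corners q p r dq dp o = count-bx _ 1 q p r (λ i → proj₁ (outer-elim q p r o i)) char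
    where
    s = bx 1 r p
    t = bx 1 q r
    char : ∀ k j → at p k < j → j ≤ at r k → corner s t (cell (1 + k) j) ≡ (j ≡ᵇ at r k) ∧ (at q (suc k) <ᵇ j)
    char k j l u = T⇔⇒≡ fwd bwd
      where
      a = cell (1 + k) j
      fwd : T (corner s t a) → T ((j ≡ᵇ at r k) ∧ (at q (suc k) <ᵇ j))
      fwd c = ∧-intro (≡⇒≡ᵇ j (at r k) (last (m≤n⇒m<n∨m≡n u))) (<⇒<ᵇ (free (≤-<-connex j (at q (suc k)))))
        where
        noRight : ∀ b → b ∈ s → ¬ T (sameRowLeft a b)
        noRight b b∈ = T-not⁻ (T-all-elim _ s (∧-left c) b b∈)
        noBelow : ∀ b → b ∈ s ++ t → ¬ T (sameColAbove a b)
        noBelow b b∈ = T-not⁻ (T-all-elim _ (s ++ t) (∧-right {all (λ b → not (sameRowLeft a b)) s} c) b b∈)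
        last : j < at r k ⊎ j ≡ at r k → j ≡ at r k
        last (inj₂ e) = e
        last (inj₁ h) = ⊥-elim (noRight (cell (1 + k) (at r k)) (bx-∈⁺ 1 r p k (<-≤-trans l u) ≤-refl)
          (∧-intro (≡⇒≡ᵇ (1 + k) (1 + k) refl) (<⇒<ᵇ (+-monoʳ-< j₀ h))))
        isBelow : T (sameColAbove a (cell (1 + suc k) j))
        isBelow = ∧-intro (≡⇒≡ᵇ (j₀ + j) (j₀ + j) refl) (<⇒<ᵇ (n<1+n (1 + k)))
        free : j ≤ at q (suc k) ⊎ at q (suc k) < j → at q (suc k) < j
        free (inj₂ h) = h
        -- If the cell below were within `q`, it would belong to `s` or to `t`, since `Dec p` keeps
        -- it out of `p`; both contradict `noBelow`.
        free (inj₁ h) with ≤-<-connex j (at r (suc k))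
        ... | inj₁ h′ = ⊥-elim (noBelow (cell (1 + suc k) j)
            (∈-++⁺ˡ (bx-∈⁺ 1 r p (suc k) (≤-<-trans (dp k) l) h′)) isBelow)
        ... | inj₂ h′ = ⊥-elim (noBelow (cell (1 + suc k) j) (∈-++⁺ʳ s (bx-∈⁺ 1 q r (suc k) h′ h)) isBelow)
      bwd : T ((j ≡ᵇ at r k) ∧ (at q (suc k) <ᵇ j)) → T (corner s t a)
      bwd c = ∧-intro (T-all-intro _ s (λ b b∈ → T-not (λ x → right′ b (bx-∈⁻ 1 r p b∈) x)))
                      (T-all-intro _ (s ++ t) (λ b b∈ → T-not (λ x → below′ b (inQ b (∈-++⁻ s b∈)) x)))
        where
        j≡ : j ≡ at r k
        j≡ = ≡ᵇ⇒≡ j (at r k) (∧-left c)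
        q<j : at q (suc k) < j
        q<j = <ᵇ⇒< (at q (suc k)) j (∧-right {j ≡ᵇ at r k} c)
        right′ : ∀ b → ∃[ k′ ] ∃[ j′ ] (b ≡ cell (1 + k′) j′ × at p k′ < j′ × j′ ≤ at r k′) → ¬ T
            (sameRowLeft a b)
        right′ _ (k′ , j′ , refl , _ , u′) x with suc-injective (srl-row a (cell (1 + k′) j′) x)
        ... | refl = n≮n j (<-≤-trans (+-cancelˡ-< j₀ j j′ (srl-col a (cell (1 + k′) j′) x))
            (≤-trans u′ (≤-reflexive (sym j≡))))
        inQ : ∀ b → b ∈ s ⊎ b ∈ t → ∃[ k′ ] ∃[ j′ ] (b ≡ cell (1 + k′) j′ × j′ ≤ at q k′)
        inQ b (inj₁ b∈) with bx-∈⁻ 1 r p b∈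
        ... | k′ , j′ , e , _ , u′ = k′ , j′ , e , ≤-trans u′ (proj₁ (proj₂ (outer-elim q p r o k′)))
        inQ b (inj₂ b∈) with bx-∈⁻ 1 q r b∈
        ... | k′ , j′ , e , _ , u′ = k′ , j′ , e , u′
        below′ : ∀ b → ∃[ k′ ] ∃[ j′ ] (b ≡ cell (1 + k′) j′ × j′ ≤ at q k′) → ¬ T (sameColAbove a b)
        below′ _ (k′ , j′ , refl , u′) x =
          n≮n j (≤-<-trans (≤-trans (≤-reflexive (+-cancelˡ-≡ j₀ j j′ (sca-col a (cell (1 + k′) j′) x)))
                   (≤-trans u′ (≤-trans (≤-reflexive (cong (at q) (sym (m+[n∸m]≡n k<k′))))
                       (Dec-mono q dq (suc k) (k′ ∸ suc k))))) q<j)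
          where
          k<k′ : k < k′
          k<k′ = ≤-pred (sca-row a (cell (1 + k′) j′) x)

  sv≡Groth : ∀ ds (q p : Vec ℕ n) → q ∈ vecs m n → T (dec q) → T (dec p) → p ≤ᵛ q →
             Fill (nonemptySubsets (length ds)) (bx 1 q p) (W ds) ≡ Groth m n ds q p
  sv≡Groth []       q p q∈ dq dp p≤q =
    trans (Fill-none q p (W []) p≤q)
    (trans (cong (⟦ eqV q p ⟧ ·_) (trans (·-identityˡ _) (·-identityˡ _))) (·-identityʳ _))
  sv≡Groth (d ∷ ds) q p q∈ dq dp p≤q =
    trans (Fill-∷ʳ-ad (extend (suc N)) (nonemptySubsets N) (nonemptySubsets (suc N)) (suc N ∷ [])
                      (∑-nonemptySubsets-suc N) (bx 1 q p) (W (d ∷ ds)) (W-inv (d ∷ ds)))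
    (trans (∑-cong (splits (bx 1 q p)) (λ (s , t) →
              trans (Fill-cong (nonemptySubsets N) s
                  (λ z bz l → ∑-W-split d ds z s t bz (λ x∈ → bounded (All.lookup l x∈))))
              (trans (Fill-· (nonemptySubsets N) s _ (W ds)) (·-assoc _ _ _))))
    (trans (∑-outer 1 q p (λ s t → coef d (length t) (count (corner s t) s) · Fill (nonemptySubsets N) s
        (W ds)) q∈ dq dp p≤q)
           (∑-cong∈ (vecs m n) (λ r r∈ →
             trans (⟦⟧-cond (outer q p r) (λ o → cong₂ _·_
                      (cong₂ (coef d) (length-bx j₀ 1 q r)
                          (count-corners q p r (dec⇒Dec q dq) (dec⇒Dec p dp) o))
                      (sv≡Groth ds r p r∈ (Dec⇒dec r (outer-Dec q p r o)) dp
                          (λ i → proj₁ (outer-elim q p r o i)))))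
             (trans (sym (·-assoc _ _ _)) (cong (_· Groth m n ds r p) (sym (gp-eval (coef d) p q r 0 0))))))))
    where N = length ds

-- Reading the row ends off a shape.

<ᴸ-trans : ∀ {a b c} → a <ᴸ b → b <ᴸ c → a <ᴸ c
<ᴸ-trans (inj₁ p)       (inj₁ q)       = inj₁ (<-trans p q)
<ᴸ-trans (inj₁ p)       (inj₂ (e , _)) = inj₁ (subst (_ <_) e p)
<ᴸ-trans (inj₂ (e , _)) (inj₁ q)       = inj₁ (subst (_< _) (sym e) q)
<ᴸ-trans (inj₂ (e , p)) (inj₂ (f , q)) = inj₂ (trans e f , <-trans p q)

<ᴸ-irrefl : ∀ {a} → ¬ (a <ᴸ a)
<ᴸ-irrefl (inj₁ p)       = n≮n _ p
<ᴸ-irrefl (inj₂ (_ , p)) = n≮n _ p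

sorted-ext : ∀ {xs ys} → AllPairs _<ᴸ_ xs → AllPairs _<ᴸ_ ys →
             (∀ {b} → b ∈ xs → b ∈ ys) → (∀ {b} → b ∈ ys → b ∈ xs) → xs ≡ ys
sorted-ext {[]}     {[]}     _        _        f g = refl
sorted-ext {[]}     {y ∷ ys} _        _        f g with g (here refl)
... | ()
sorted-ext {x ∷ xs} {[]}     _        _        f g with f (here refl)
... | ()
sorted-ext {x ∷ xs} {y ∷ ys} (px ∷ sx) (py ∷ sy) f g = cong₂ _∷_ x≡y (sorted-ext sx sy f′ g′)
  where
  x≡y : x ≡ y
  x≡y with f (here refl) | g (here refl)
  ... | here e  | _       = e
  ... | there _ | here e  = sym e
  ... | there p | there q = ⊥-elim (<ᴸ-irrefl (<ᴸ-trans (All.lookup py p) (All.lookup px q)))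
  f′ : ∀ {b} → b ∈ xs → b ∈ ys
  f′ b∈ with f (there b∈)
  ... | there h = h
  ... | here e  = ⊥-elim (<ᴸ-irrefl (subst (x <ᴸ_) (trans e (sym x≡y)) (All.lookup px b∈)))
  g′ : ∀ {b} → b ∈ ys → b ∈ xs
  g′ b∈ with g (there b∈)
  ... | there h = h
  ... | here e  = ⊥-elim (<ᴸ-irrefl (subst (y <ᴸ_) (trans e x≡y) (All.lookup py b∈)))

seg-sorted : ∀ p k → AllPairs _<_ (seg p k)
seg-sorted p zero    = []
seg-sorted p (suc k) = All.tabulate (λ j∈ → proj₁ (seg-∈⁻ (suc p) k j∈)) ∷ seg-sorted (suc p) k

maximum : (Box → ℕ) → Shape → ℕ
maximum f = foldr (λ b m → f b ⊔ m) 0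

minimum : ℕ → (Box → ℕ) → Shape → ℕ
minimum m f = foldr (λ b k → f b ⊓ k) m

≤-maximum : ∀ f μ {b} → b ∈ μ → f b ≤ maximum f μ
≤-maximum f (x ∷ μ) (here refl) = m≤m⊔n (f x) _
≤-maximum f (x ∷ μ) (there b∈)  = ≤-trans (≤-maximum f μ b∈) (m≤n⊔m (f x) _)

maximum-attained : ∀ f μ → maximum f μ ≡ 0 ⊎ ∃[ b ] (b ∈ μ × maximum f μ ≡ f b)
maximum-attained f []      = inj₁ refl
maximum-attained f (x ∷ μ) with ⊔-sel (f x) (maximum f μ)
... | inj₁ e = inj₂ (x , here refl , e)
... | inj₂ e with maximum-attained f μ
... | inj₁ z = inj₁ (trans e z)
... | inj₂ (b , b∈ , h) = inj₂ (b , there b∈ , trans e h)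

minimum-≤ : ∀ m f μ {b} → b ∈ μ → minimum m f μ ≤ f b
minimum-≤ m f (x ∷ μ) (here refl) = m⊓n≤m (f x) _
minimum-≤ m f (x ∷ μ) (there b∈)  = ≤-trans (m⊓n≤n (f x) _) (minimum-≤ m f μ b∈)

minimum-≤-default : ∀ m f μ → minimum m f μ ≤ m
minimum-≤-default m f []      = ≤-refl
minimum-≤-default m f (x ∷ μ) = ≤-trans (m⊓n≤n (f x) _) (minimum-≤-default m f μ)

minimum-attained : ∀ m f μ → minimum m f μ ≡ m ⊎ ∃[ b ] (b ∈ μ × minimum m f μ ≡ f b)
minimum-attained m f []      = inj₁ refl
minimum-attained m f (x ∷ μ) with ⊓-sel (f x) (minimum m f μ)
... | inj₁ e = inj₂ (x , here refl , e)
... | inj₂ e with minimum-attained m f μ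
... | inj₁ z = inj₁ (trans e z)
... | inj₂ (b , b∈ , h) = inj₂ (b , there b∈ , trans e h)

tab : (ℕ → ℕ) → ∀ n → Vec ℕ n
tab f zero    = []
tab f (suc n) = f 0 ∷ tab (f ∘ suc) n

at-tab : ∀ f n k → k < n → at (tab f n) k ≡ f k
at-tab f (suc n) zero    h       = refl
at-tab f (suc n) (suc k) (s≤s h) = at-tab (f ∘ suc) n k h

at-tab-out : ∀ f n k → n ≤ k → at (tab f n) k ≡ 0
at-tab-out f zero    k       h       = refl
at-tab-out f (suc n) (suc k) (s≤s h) = at-tab-out (f ∘ suc) n k h

tab-∈ : ∀ {m} f n → (∀ k → f k ≤ m) → tab f n ∈ vecs m n
tab-∈ f zero    h = here refl
tab-∈ f (suc n) h = ∈-vecs⁺ (h 0) (tab-∈ (f ∘ suc) n (h ∘ suc))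

tab-mono : ∀ f h n → (∀ k → f k ≤ h k) → tab f n ≤ᵛ tab h n
tab-mono f h n l k with <-≤-connex k n
... | inj₁ k<n = subst₂ _≤_ (sym (at-tab f n k k<n)) (sym (at-tab h n k k<n)) (l k)
... | inj₂ n≤k = subst (_≤ _) (sym (at-tab-out f n k n≤k)) z≤n

tab-Dec : ∀ f n → (∀ k → f (suc k) ≤ f k) → Dec (tab f n)
tab-Dec f n d k with <-≤-connex (suc k) n
... | inj₁ l = subst₂ _≤_ (sym (at-tab f n (suc k) l)) (sym (at-tab f n k (<⇒≤ l))) (d k)
... | inj₂ l = subst (_≤ at (tab f n) k) (sym (at-tab-out f n (suc k) l)) z≤n

Dec-≤ : ∀ {n} (q : Vec ℕ n) → Dec q → ∀ {i k} → i ≤ k → at q k ≤ at q i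
Dec-≤ q d {i} {k} h = subst (λ z → at q z ≤ at q i) (m+[n∸m]≡n h) (Dec-mono q d i (k ∸ i))

module Shapes (m j₀ : ℕ) where
  open Boxes j₀

  bx-sorted : ∀ {n} i (q p : Vec ℕ n) → AllPairs _<ᴸ_ (bx i q p)
  bx-sorted i []       []       = []
  bx-sorted i (q ∷ qs) (p ∷ ps) =
    AllPairsₚ.++⁺ (AllPairsₚ.map⁺ (AllPairs.map (λ h → inj₂ (refl , +-monoʳ-< j₀ h)) (seg-sorted p (q ∸ p))))
      (bx-sorted (suc i) qs ps)
      (All.tabulate (λ {a} a∈ → All.tabulate (λ {b} b∈ →
        inj₁ (≤-trans (s≤s (≤-reflexive (cells-row i _ a∈))) (bx-row (suc i) qs ps b∈)))))

  -- Index `k` stands for row `k + 1`. The extrema run over all rows from that one downwards,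
  -- respectively upwards, and not over the row alone: this makes them decreasing by construction
  -- and assigns ends to empty rows. Above the first box `leftEnd` takes the default `m`, the full
  -- width.
  rightEnd leftEnd : Shape → ℕ → ℕ
  rightEnd μ k = maximum (λ b → if k <ᵇ row b then col b ∸ j₀ else 0) μ
  leftEnd  μ k = minimum m (λ b → if row b ≤ᵇ suc k then col b ∸ suc j₀ else m) μ

  ≤-rightEnd : ∀ μ {b} k → b ∈ μ → k < row b → col b ∸ j₀ ≤ rightEnd μ k
  ≤-rightEnd μ {b} k b∈ h = subst (_≤ rightEnd μ k) (if-cong {x = col b ∸ j₀} {0} (<ᵇ-true h))
      (≤-maximum _ μ b∈)

  leftEnd-≤ : ∀ μ {b} k → b ∈ μ → row b ≤ suc k → leftEnd μ k ≤ col b ∸ suc j₀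
  leftEnd-≤ μ {b} k b∈ h = subst (leftEnd μ k ≤_) (if-cong {x = col b ∸ suc j₀} {m} (≤ᵇ-true h))
      (minimum-≤ m _ μ b∈)

  rightEnd-attained : ∀ μ k → rightEnd μ k ≡ 0 ⊎ ∃[ b ] (b ∈ μ × k < row b × rightEnd μ k ≡ col b ∸ j₀)
  rightEnd-attained μ k with maximum-attained (λ b → if k <ᵇ row b then col b ∸ j₀ else 0) μ
  ... | inj₁ z = inj₁ z
  ... | inj₂ (b , b∈ , e) with ≤-<-connex (row b) k
  ... | inj₁ h = inj₁ (trans e (if-cong {x = col b ∸ j₀} {0} (<ᵇ-false h)))
  ... | inj₂ h = inj₂ (b , b∈ , h , trans e (if-cong {x = col b ∸ j₀} {0} (<ᵇ-true h)))

  leftEnd-attained : ∀ μ k → leftEnd μ k ≡ m ⊎ ∃[ b ] (b ∈ μ × row b ≤ suc k × leftEnd μ k ≡ col b ∸ suc j₀)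
  leftEnd-attained μ k with minimum-attained m (λ b → if row b ≤ᵇ suc k then col b ∸ suc j₀ else m) μ
  ... | inj₁ z = inj₁ z
  ... | inj₂ (b , b∈ , e) with ≤-<-connex (row b) (suc k)
  ... | inj₁ h = inj₂ (b , b∈ , h , trans e (if-cong {x = col b ∸ suc j₀} {m} (≤ᵇ-true h)))
  ... | inj₂ h = inj₁ (trans e (if-cong {x = col b ∸ suc j₀} {m} (≤ᵇ-false h)))

  rightEnd-mono : ∀ {σ μ} → (∀ {b} → b ∈ σ → b ∈ μ) → ∀ k → rightEnd σ k ≤ rightEnd μ k
  rightEnd-mono {σ} {μ} s k with rightEnd-attained σ k
  ... | inj₁ z = subst (_≤ rightEnd μ k) (sym z) z≤n
  ... | inj₂ (b , b∈ , h , e) = subst (_≤ rightEnd μ k) (sym e) (≤-rightEnd μ k (s b∈) h)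

  leftEnd-mono : ∀ {σ μ} → (∀ {b} → b ∈ σ → b ∈ μ) → ∀ k → leftEnd μ k ≤ leftEnd σ k
  leftEnd-mono {σ} {μ} s k with leftEnd-attained σ k
  ... | inj₁ z = subst (leftEnd μ k ≤_) (sym z) (minimum-≤-default m _ μ)
  ... | inj₂ (b , b∈ , h , e) = subst (leftEnd μ k ≤_) (sym e) (leftEnd-≤ μ k (s b∈) h)

  rightEnd-dec : ∀ μ k → rightEnd μ (suc k) ≤ rightEnd μ k
  rightEnd-dec μ k with rightEnd-attained μ (suc k)
  ... | inj₁ z = subst (_≤ rightEnd μ k) (sym z) z≤n
  ... | inj₂ (b , b∈ , h , e) = subst (_≤ rightEnd μ k) (sym e) (≤-rightEnd μ k b∈ (<⇒≤ h))

  leftEnd-dec : ∀ μ k → leftEnd μ (suc k) ≤ leftEnd μ k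
  leftEnd-dec μ k with leftEnd-attained μ k
  ... | inj₁ z = subst (leftEnd μ (suc k) ≤_) (sym z) (minimum-≤-default m _ μ)
  ... | inj₂ (b , b∈ , h , e) = subst (leftEnd μ (suc k) ≤_) (sym e)
      (leftEnd-≤ μ (suc k) b∈ (≤-trans h (n≤1+n _)))

  rightEnd-≤m : ∀ μ → (∀ {b} → b ∈ μ → col b ≤ j₀ + m) → ∀ k → rightEnd μ k ≤ m
  rightEnd-≤m μ h k with rightEnd-attained μ k
  ... | inj₁ z = subst (_≤ m) (sym z) z≤n
  ... | inj₂ (b , b∈ , _ , e) = subst (_≤ m) (sym e) (m≤n+o⇒m∸n≤o (col b) j₀ (h b∈))

  bx-skew : ∀ {n} (q p : Vec ℕ n) → Dec q → Dec p → IsSkewShape (bx 1 q p)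
  bx-skew q p dq dp = AllPairs⇒Linked (bx-sorted 1 q p) , positive , closed
    where
    positive : ∀ b → b ∈ bx 1 q p → (1 ≤ row b) × (1 ≤ col b)
    positive b b∈ with bx-∈⁻ 1 q p b∈
    ... | k , j , refl , l , _ = s≤s z≤n , ≤-trans (≤-trans (s≤s z≤n) l) (m≤n+m j j₀)
    closed : ∀ a b c → a ∈ bx 1 q p → c ∈ bx 1 q p → a ≼ b → b ≼ c → b ∈ bx 1 q p
    closed a (zero , y) c a∈ c∈ (r , _) _ with bx-row 1 q p a∈
    ... | h = ⊥-elim (n≮n 0 (≤-trans h r))
    closed a (suc k , y) c a∈ c∈ (r₁ , c₁) (r₂ , c₂) with bx-∈⁻ 1 q p a∈ | bx-∈⁻ 1 q p c∈
    ... | k₁ , j₁ , refl , l₁ , _ | k₂ , j₂ , refl , _ , u₂ =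
      subst (λ z → (suc k , z) ∈ bx 1 q p) y≡ (bx-∈⁺ 1 q p k
        (≤-<-trans (Dec-≤ p dp (≤-pred r₁)) (<-≤-trans l₁
            (+-cancelˡ-≤ j₀ j₁ (y ∸ j₀) (≤-trans c₁ (≤-reflexive (sym y≡))))))
        (≤-trans (+-cancelˡ-≤ j₀ (y ∸ j₀) j₂ (≤-trans (≤-reflexive y≡) c₂))
            (≤-trans u₂ (Dec-≤ q dq (≤-pred r₂)))))
      where
      y≡ : j₀ + (y ∸ j₀) ≡ y
      y≡ = m+[n∸m]≡n (≤-trans (m≤m+n j₀ j₁) c₁)

  bx-ends : ∀ μ n → IsSkewShape μ → (∀ {b} → b ∈ μ → row b ≤ n) →
            (∀ {b} → b ∈ μ → j₀ < col b × col b ≤ j₀ + m) → μ ≡ bx 1 (tab (rightEnd μ) n) (tab (leftEnd μ) n)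
  bx-ends μ n (sorted , pos , closed) rows cols =
    sorted-ext (Linked⇒AllPairs <ᴸ-trans sorted) (bx-sorted 1 (tab (rightEnd μ) n) (tab (leftEnd μ) n))
        (λ {b} → fwd b) (λ {b} → bwd b)
    where
    q = tab (rightEnd μ) n
    p = tab (leftEnd μ) n
    fwd : ∀ b → b ∈ μ → b ∈ bx 1 q p
    fwd (zero , y)  b∈ = ⊥-elim (n≮n 0 (proj₁ (pos _ b∈)))
    fwd (suc k , y) b∈ = subst (λ z → (suc k , z) ∈ bx 1 q p) y≡ (bx-∈⁺ 1 q p k
      (≤-trans (s≤s (≤-trans (≤-reflexive (at-tab _ n k (rows b∈))) (leftEnd-≤ μ k b∈ ≤-refl)))
          (≤-reflexive (sym (+-∸-assoc 1 (proj₁ (cols b∈))))))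
      (≤-trans (≤-rightEnd μ k b∈ ≤-refl) (≤-reflexive (sym (at-tab _ n k (rows b∈))))))
      where
      y≡ : j₀ + (y ∸ j₀) ≡ y
      y≡ = m+[n∸m]≡n (<⇒≤ (proj₁ (cols b∈)))
    bwd : ∀ b → b ∈ bx 1 q p → b ∈ μ
    bwd b b∈ with bx-∈⁻ 1 q p b∈
    ... | k , j , refl , l , u with <-≤-connex k n
    ... | inj₂ n≤k = ⊥-elim (n≮n 0 (≤-trans (≤-trans (s≤s z≤n) l)
        (≤-trans u (≤-reflexive (at-tab-out _ n k n≤k)))))
    ... | inj₁ k<n with rightEnd-attained μ k | leftEnd-attained μ k
    ... | inj₁ z | _ = ⊥-elim (n≮n 0 (≤-trans (≤-trans (s≤s z≤n) l)
        (≤-trans u (≤-reflexive (trans (at-tab _ n k k<n) z)))))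
    ... | inj₂ _ | inj₁ z = ⊥-elim (n≮n m (<-≤-trans (subst (_< j) (trans (at-tab _ n k k<n) z) l)
            (≤-trans u (≤-trans (≤-reflexive (at-tab _ n k k<n)) (rightEnd-≤m μ (λ b∈ → proj₂ (cols b∈)) k)))))
    -- The extrema are attained at `b₂`, weakly above and to the left of the cell, and at `b₁`,
    -- weakly below and to its right; closure under intervals puts the cell in `μ`, even though
    -- neither box need lie in its row.
    ... | inj₂ (b₁ , b₁∈ , h₁ , e₁) | inj₂ (b₂ , b₂∈ , h₂ , e₂) =
      closed b₂ (cell (1 + k) j) b₁ b₂∈ b₁∈ (h₂ , left≤) (h₁ , right≤)
      where
      left≤ : col b₂ ≤ j₀ + j
      left≤ = ≤-trans (≤-reflexive (sym (m+[n∸m]≡n (proj₁ (cols b₂∈)))))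
        (≤-trans (≤-reflexive (sym (+-suc j₀ _))) (+-monoʳ-≤ j₀ (subst (_< j) (trans (at-tab _ n k k<n) e₂) l)))
      right≤ : j₀ + j ≤ col b₁
      right≤ = ≤-trans (+-monoʳ-≤ j₀ (≤-trans u (≤-reflexive (trans (at-tab _ n k k<n) e₁))))
          (≤-reflexive (m+[n∸m]≡n (<⇒≤ (proj₁ (cols b₁∈)))))

-- Connectedness enters only through the fact that the columns met by σ form an interval.
module Columns {σ : Shape} (skew : IsSkewShape σ) where

  -- If `b` were two or more columns to the right, the box right of `a` in its row would lie
  -- strictly between them, and in `σ` by closure under intervals.
  covers-col : ∀ {a b} → Covers σ a b → col b ≤ suc (col a)
  covers-col {a} {b} (a∈ , b∈ , (r , c) , _ , between) with ≤-<-connex (col b) (suc (col a))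
  ... | inj₁ h = h
  ... | inj₂ h with between mid (proj₂ (proj₂ skew) a mid b a∈ b∈ a≼mid mid≼b) a≼mid mid≼b
    where
    mid : Box
    mid = row a , suc (col a)
    a≼mid : a ≼ mid
    a≼mid = ≤-refl , n≤1+n _
    mid≼b : mid ≼ b
    mid≼b = r , <⇒≤ h
  ... | inj₁ e = ⊥-elim (n≮n (col a) (≤-reflexive (cong col e)))
  ... | inj₂ e = ⊥-elim (n≮n _ (<-≤-trans h (≤-reflexive (cong col (sym e)))))

  -- A discrete intermediate value argument: an upward step advances by at most one column, so it
  -- cannot jump over `y`, and a downward step never moves to the right.
  path-col : ∀ {a b} → HassePath σ a b → a ∈ σ → ∀ y → col a ≤ y → y ≤ col b → ∃[ x ] (x ∈ σ × col x ≡ y)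
  path-col {a} here a∈ y h₁ h₂ = a , a∈ , ≤-antisym h₁ h₂
  path-col {a} (up cov path) a∈ y h₁ h₂ with m≤n⇒m<n∨m≡n h₁
  ... | inj₂ e = a , a∈ , e
  ... | inj₁ h = path-col path (proj₁ (proj₂ cov)) y (≤-trans (covers-col cov) h) h₂
  path-col (down cov path) a∈ y h₁ h₂ = path-col path (proj₁ cov) y
      (≤-trans (proj₂ (proj₁ (proj₂ (proj₂ cov)))) h₁) h₂

-- Double counting with the indicator `δ` of `x ≡ e y`. Injectivity of `e` is asked for only on `P`,
-- which holds wherever `h` is not known to vanish.
∑-reindex : DecidableEquality A → (xs : List A) (ys : List B) (f : A → ℤ) (h : B → ℤ) (e : B → A)
    (P : B → Set) →
            Unique xs → Unique ys →
            (∀ y → y ∈ ys → (h y ≡ 0ℤ) ⊎ (P y × e y ∈ xs × h y ≡ f (e y))) →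
            (∀ x → x ∈ xs → ∃[ y ] (y ∈ ys × P y × e y ≡ x × h y ≡ f x)) →
            (∀ y y′ → P y → P y′ → e y ≡ e y′ → y ≡ y′) →
            ∑ ys h ≡ ∑ xs f
∑-reindex _≟ᴬ_ xs ys f h e P uxs uys val sur inj =
  trans (∑-cong∈ ys spread) (trans (∑-swap ys xs _) (∑-cong∈ xs collect))
  where
  δ : _ → _ → ℤ
  δ x y = ⟦ does (x ≟ᴬ e y) ⟧
  δ-eq : ∀ x y → x ≡ e y → δ x y ≡ 1ℤ
  δ-eq x y p with x ≟ᴬ e y
  ... | yes _ = refl
  ... | no ¬p = ⊥-elim (¬p p)
  δ-ne : ∀ x y → x ≢ e y → δ x y ≡ 0ℤ
  δ-ne x y ¬p with x ≟ᴬ e y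
  ... | yes p = ⊥-elim (¬p p)
  ... | no _  = refl
  spread : ∀ y → y ∈ ys → h y ≡ ∑ xs (λ x → δ x y · h y)
  spread y y∈ with val y y∈
  ... | inj₁ z = trans z (sym (∑-zero xs (λ x _ → 0·′ (δ x y) z)))
  ... | inj₂ (_ , ey∈ , _) =
    sym (trans (∑-single (λ x → δ x y · h y) uxs ey∈ (λ x _ x≢ → 0· (h y) (δ-ne x y x≢)))
               (trans (cong (_· h y) (δ-eq (e y) y refl)) (·-identityˡ _)))
  collect : ∀ x → x ∈ xs → ∑ ys (λ y → δ x y · h y) ≡ f x
  collect x x∈ with sur x x∈
  ... | y₀ , y₀∈ , py₀ , ey₀ , hy₀ =
    trans (∑-single (λ y → δ x y · h y) uys y₀∈ other)
          (trans (cong (_· h y₀) (δ-eq x y₀ (sym ey₀))) (trans (·-identityˡ _) hy₀))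
    where
    other : ∀ y → y ∈ ys → y ≢ y₀ → δ x y · h y ≡ 0ℤ
    other y y∈ y≢ with val y y∈
    ... | inj₁ z = 0·′ (δ x y) z
    ... | inj₂ (py , _ , _) = 0· (h y) (δ-ne x y (λ x≡ → y≢ (inj y y₀ py py₀ (trans (sym x≡) (sym ey₀)))))

-- Passing from lists of entries to lists of boxes with entries

fillings-∈ : ∀ {U : Set} (vs : List U) bs {t} → t ∈ fillingsFrom vs bs → map proj₂ (zip bs t) ≡ t
fillings-∈ vs []       (here refl) = refl
fillings-∈ vs (b ∷ bs) t∈ with ∈-concat⁻′ (map (λ v → map (v ∷_) (fillingsFrom vs bs)) vs) t∈
... | _ , t∈′ , l∈ with ∈-map⁻ _ l∈
... | v , _ , refl with ∈-map⁻ _ t∈′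
... | t′ , t′∈ , refl = cong (v ∷_) (fillings-∈ vs bs t′∈)

∑-fillings : ∀ {U : Set} (vs : List U) bs (f : List (Box × U) → List U → ℤ) →
             ∑ (fillingsFrom vs bs) (λ t → f (zip bs t) t) ≡ Fill vs bs (λ z → f z (map proj₂ z))
∑-fillings vs bs f =
  trans (∑-cong∈ (fillingsFrom vs bs) (λ t t∈ → cong (f (zip bs t)) (sym (fillings-∈ vs bs t∈))))
        (sym (Fill-def vs bs (λ z → f z (map proj₂ z))))

schurCoeff≡ : ∀ μ c → + schurCoeff μ c ≡ Fill (range1 (length c)) μ
    (λ z → ⟦ isSSYT z ⟧ · ⟦ hasContent c (map proj₂ z) ⟧)
schurCoeff≡ μ c =
  trans (length-filter _ (fillingsFrom (range1 (length c)) μ))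
  (trans (∑-cong (fillingsFrom (range1 (length c)) μ) (λ t → ⟦∧⟧ (isSSYT (zip μ t)) (hasContent c t)))
         (∑-fillings (range1 (length c)) μ (λ z t → ⟦ isSSYT z ⟧ · ⟦ hasContent c t ⟧)))

Fill-zero : ∀ {U : Set} (vs : List U) bs {f} → (∀ z → map proj₁ z ≡ bs → f z ≡ 0ℤ) → Fill vs bs f ≡ 0ℤ
Fill-zero vs bs {f} h =
  trans (Fill-cong vs bs {h = λ _ → 0ℤ} (λ z e _ → h z e)) (trans (Fill-def vs bs _) (∑-0 (fillingsFrom vs bs)))

Fill-drop : ∀ {U : Set} (vs : List U) y bs f → (∀ z b → map proj₁ z ≡ bs → (b , y) ∈ z → f z ≡ 0ℤ) →
            Fill (vs ++ y ∷ []) bs f ≡ Fill vs bs f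
Fill-drop vs y []       f h = trans (Fill-[] _ f) (sym (Fill-[] vs f))
Fill-drop vs y (b ∷ bs) f h =
  trans (Fill-∷ (vs ++ y ∷ []) b bs f)
  (trans (∑-++ vs (y ∷ []) _)
  (trans (cong₂ _⊕_
     (∑-cong vs (λ v → Fill-drop vs y bs (λ z → f ((b , v) ∷ z))
         (λ z b′ e b∈ → h ((b , v) ∷ z) b′ (cong (b ∷_) e) (there b∈))))
     (trans (∑-[ y ] _) (Fill-zero (vs ++ y ∷ []) bs (λ z e → h ((b , y) ∷ z) b (cong (b ∷_) e) (here refl)))))
  (trans (⊕-identityʳ _) (sym (Fill-∷ vs b bs f)))))

-- The row-bounded counts use an alphabet ending at the `maxRow` of their own shape, while the
-- matrices use the common bound `n`; labels beyond the former contribute nothing.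
Fill-stable : ∀ M k bs f → (∀ K → M ≤ K → ∀ z b → map proj₁ z ≡ bs → (b , suc K) ∈ z → f z ≡ 0ℤ) →
              Fill (range1 (M + k)) bs f ≡ Fill (range1 M) bs f
Fill-stable M zero    bs f h = cong (λ K → Fill (range1 K) bs f) (+-identityʳ M)
Fill-stable M (suc k) bs f h =
  trans (cong (λ K → Fill (range1 K) bs f) (+-suc M k))
  (trans (cong (λ vs → Fill vs bs f) (range1-suc (M + k)))
  (trans (Fill-drop (range1 (M + k)) (suc (M + k)) bs f (h (M + k) (m≤m+n M k))) (Fill-stable M k bs f h)))

≤-maxRow : ∀ μ {b} → b ∈ μ → row b ≤ maxRow μ
≤-maxRow (x ∷ μ) (here refl) = m≤m⊔n (row x) _
≤-maxRow (x ∷ μ) (there b∈)  = ≤-trans (≤-maxRow μ b∈) (m≤n⊔m (row x) _)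

maxRow-≤ : ∀ μ {n} → (∀ {b} → b ∈ μ → row b ≤ n) → maxRow μ ≤ n
maxRow-≤ []      h = z≤n
maxRow-≤ (x ∷ μ) h = ⊔-lub (h (here refl)) (maxRow-≤ μ (λ b∈ → h (there b∈)))

#rwbSSYT≡ : ∀ μ n → maxRow μ ≤ n → + #rwbSSYT μ ≡ Fill (range1 n) μ
    (λ z → ⟦ isSSYT z ⟧ · ⟦ isRowWeaklyBounded z ⟧)
#rwbSSYT≡ μ n h =
  trans (length-filter _ (fillingsFrom (range1 M) μ))
  (trans (∑-cong (fillingsFrom (range1 M) μ) (λ t → ⟦∧⟧ (isSSYT (zip μ t)) _))
  (trans (sym (Fill-def (range1 M) μ (λ z → ⟦ isSSYT z ⟧ · ⟦ isRowWeaklyBounded z ⟧)))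
  (trans (sym (Fill-stable M (n ∸ M) μ _ (λ K M≤K z b e b∈ → 0·′ ⟦ isSSYT z ⟧ (⟦¬T⟧ (λ t →
             n≮n K (≤-trans (≤-trans (≤ᵇ⇒≤ (suc K) (row b) (T-all-elim _ z t _ b∈))
                 (≤-maxRow μ (boxes-∈ e b∈))) M≤K))))))
         (cong (λ K → Fill (range1 K) μ _) (m+[n∸m]≡n h)))))
  where M = maxRow μ

#rbRRS≡ : ∀ μ n → maxRow μ ≤ n → + #rbRRS μ ≡ Fill (range1 n) μ
    (λ z → ⟦ isReverseRowStrict z ⟧ · ⟦ isRowBounded z ⟧)
#rbRRS≡ μ n h =
  trans (length-filter _ (fillingsFrom (range1 M) μ))
  (trans (∑-cong (fillingsFrom (range1 M) μ) (λ t → ⟦∧⟧ (isReverseRowStrict (zip μ t)) _))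
  (trans (sym (Fill-def (range1 M) μ (λ z → ⟦ isReverseRowStrict z ⟧ · ⟦ isRowBounded z ⟧)))
  (trans (sym (Fill-stable M (n ∸ M) μ _ (λ K M≤K z b e b∈ → 0·′ ⟦ isReverseRowStrict z ⟧ (⟦¬T⟧ (λ t →
             n≮n K (≤-trans (<⇒≤ (≤-trans (<ᵇ⇒< (suc K) (row b) (T-all-elim _ z t _ b∈))
                 (≤-maxRow μ (boxes-∈ e b∈)))) M≤K))))))
         (cong (λ K → Fill (range1 K) μ _) (m+[n∸m]≡n h)))))
  where M = maxRow μ

sign-tot : ∀ (z : SV) → (∀ {x} → x ∈ z → 1 ≤ length (proj₂ x)) →
           sign (sizeSV (map proj₂ z) ∸ length (map proj₁ z)) ≡ sign (tot z)
sign-tot z h = sym (trans (cong sign tot≡) (trans (sign-+ (l + l) e)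
    (trans (cong (_· sign e) (trans (sign-+ l l) (sign-² l))) (·-identityˡ _))))
  where
  l = length (map proj₁ z)
  e = sizeSV (map proj₂ z) ∸ l
  split : ∀ z → tot z ≡ length (map proj₁ z) + sizeSV (map proj₂ z)
  split []      = refl
  split (x ∷ z) = cong suc (trans (cong (λ c → length (proj₂ x) + c) (split z))
    (trans (sym (+-assoc (length (proj₂ x)) _ _))
        (trans (cong (λ c → c + sizeSV (map proj₂ z)) (+-comm (length (proj₂ x)) _))
        (+-assoc (length (map proj₁ z)) _ _))))
  enough : ∀ z → (∀ {x} → x ∈ z → 1 ≤ length (proj₂ x)) → length (map proj₁ z) ≤ sizeSV (map proj₂ z)
  enough []      h = z≤n
  enough (x ∷ z) h = +-mono-≤ (h (here refl)) (enough z (λ x∈ → h (there x∈)))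
  tot≡ : tot z ≡ (l + l) + e
  tot≡ = trans (split z) (trans (cong (λ c → l + c) (sym (m+[n∸m]≡n (enough z h)))) (sym (+-assoc l l e)))

grothCoeff≡ : ∀ σ ds → grothCoeff σ (reverse ds) ≡ Fill (nonemptySubsets (length ds)) σ (W ds)
grothCoeff≡ σ ds =
  trans (sym (∑-def _ _))
  (trans (∑-filter _ (fillingsFrom (nonemptySubsets (length (reverse ds))) σ) _)
  (trans (cong (λ k → ∑ (fillingsFrom (nonemptySubsets k) σ) (λ t →
            ⟦ isSetValuedSSYT (zip σ t) ∧ hasContent (reverse ds) (concat t) ⟧ · sign
                (sizeSV t ∸ length σ))) (length-reverse ds))
  (trans (∑-fillings (nonemptySubsets (length ds)) σ (λ z t →
            ⟦ isSetValuedSSYT z ∧ hasContent (reverse ds) (concat t) ⟧ · sign (sizeSV t ∸ length σ)))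
         (Fill-cong (nonemptySubsets (length ds)) σ (λ z bz l →
            trans (cong₂ _·_ (trans (⟦∧⟧ (isSetValuedSSYT z) _)
                (cong (λ b → ⟦ isSetValuedSSYT z ⟧ · ⟦ b ⟧) (hasContent-reverse ds (labels z))))
                             (trans (cong (λ bs → sign (sizeSV (map proj₂ z) ∸ length bs)) (sym bz))
                                    (sign-tot z (λ x∈ → size≥1 (bounded {length ds} (All.lookup l x∈))))))
                  (·-assoc _ _ _))))))

-- Further supports: monotonicity and degree.

module _ (m : ℕ) {n : ℕ} where
  open Matrix m n

  -- `C 0` is the identity on all vectors, so at least one factor `V` is needed to force the outer
  -- vector to be decreasing.
  C-dec : ∀ k q r → (C (suc k) q r ≡ 0ℤ) ⊎ T (dec r)
  C-dec zero    q r = ∑-⊎ (vecs m n) (λ s → map-⊎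
      (λ { ((d , _) , e) → subst (λ v → T (dec v)) (eqV⇒≡ s r e) (∧-right {dec q} d) })
                        (·-⊎ (V-supp 1 q s) (⟦⟧-⊎ (eqV s r))))
  C-dec (suc k) q r = ∑-⊎ (vecs m n) (λ s → map-⊎ proj₂ (·-⊎ (V-supp (suc (suc k)) q s) (C-dec k s r)))

  E-dec : ∀ k t p → Dec p → (E k t p ≡ 0ℤ) ⊎ Dec t
  E-dec zero    t p d = map-⊎ (λ e → subst Dec (sym (eqV⇒≡ t p e)) d) (⟦⟧-⊎ (eqV t p))
  E-dec (suc k) t p d = ∑-⊎ (vecs m n) (λ s → chain s (⟦⟧-⊎ (hs k s p)))
    where
    chain : ∀ s → (⟦ hs k s p ⟧ ≡ 0ℤ) ⊎ T (hs k s p) → (E k t s · ⟦ hs k s p ⟧ ≡ 0ℤ) ⊎ Dec t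
    chain s (inj₁ z) = inj₁ (0·′ (E k t s) z)
    chain s (inj₂ h) with E-dec k t s (HStrip⇒Dec k s p d (hs⇒HStrip k s p h))
    ... | inj₁ z = inj₁ (0· ⟦ hs k s p ⟧ z)
    ... | inj₂ x = inj₂ x

  Γ-size : ∀ ds q p → (Γ ds q p ≡ 0ℤ) ⊎ (size q p ≡ sum ds)
  Γ-size []       q p = map-⊎ (λ e → trans (cong (λ v → size v p) (eqV⇒≡ q p e)) (size-self p)) (⟦⟧-⊎ (eqV q p))
  Γ-size (d ∷ ds) q p = ∑-⊎ (vecs m n) (λ r → map-⊎ (λ { ((h , s) , i , e) →
      trans (size-+ q r p (λ k → proj₁ (s k)) (λ k → proj₂ (i k))) (cong₂ _+_ e h) })
    (both r (Γ-size ds r p) (Γ-supp ds r p)))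
    where
    both : ∀ r → (Γ ds r p ≡ 0ℤ) ⊎ (size r p ≡ sum ds) →
           (Γ ds r p ≡ 0ℤ) ⊎ (∀ i → at p i ≤ at r i × at r (length ds + i) ≤ at p i) →
           (g (coef d) 0 q r 0 0 · Γ ds r p ≡ 0ℤ) ⊎
           ((size r p ≡ sum ds × (∀ i → at p i ≤ at r i × at r (length ds + i) ≤ at p i)) × Interlaced q r ×
               size q r ≡ d)
    both r (inj₁ z) _        = inj₁ (0·′ _ z)
    both r (inj₂ _) (inj₁ z) = inj₁ (0·′ _ z)
    both r (inj₂ h) (inj₂ s) with ·-⊎ (⟦⟧-⊎ (il q r)) (⟦⟧-⊎ (size q r ≡ᵇ d))
    ... | inj₁ z       = inj₁ (0· _ (trans (g₀-eval (coef d) q r 0 0) z))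
    ... | inj₂ (i , e) = inj₂ ((h , s) , il-elim q r i , ≡ᵇ⇒≡ (size q r) d e)

-- The parts above and below, and the sum over all shapes around the given one.

elemᴮ-elim : ∀ b bs → T (elemᴮ b bs) → b ∈ bs
elemᴮ-elim b bs t with find (any⁻ (b ==ᴮ_) bs t)
... | b′ , b′∈ , e = subst (_∈ bs) (sym (cong₂ _,_ (≡ᵇ⇒≡ (row b) (row b′) (∧-left e))
                                              (≡ᵇ⇒≡ (col b) (col b′) (∧-right {row b ≡ᵇ row b′} e)))) b′∈

elemᴮ-intro : ∀ b bs → b ∈ bs → T (elemᴮ b bs)
elemᴮ-intro b bs b∈ = any⁺ (b ==ᴮ_) (lose b∈ (∧-intro (≡⇒≡ᵇ (row b) (row b) refl) (≡⇒≡ᵇ (col b) (col b) refl)))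

Outside : (Box → Box → Bool) → Shape → Shape → Box → Set
Outside R μ σ b = b ∈ μ × ¬ (b ∈ σ) × ∃[ b′ ] (b′ ∈ σ × col b′ ≡ col b × T (R b b′))

module _ (R : Box → Box → Bool) (μ σ : Shape) where
  private
    test : Box → Bool
    test b = not (elemᴮ b σ) ∧ any (λ b′ → (col b′ ≡ᵇ col b) ∧ R b b′) σ

  ∈-outside⁻ : ∀ {b} → b ∈ filterᵇ test μ → Outside R μ σ b
  ∈-outside⁻ {b} b∈ with ∈-filter⁻ (λ b → T? (test b)) {xs = μ} b∈
  ... | b∈μ , t with find (any⁻ (λ b′ → (col b′ ≡ᵇ col b) ∧ R b b′) σ (∧-right {not (elemᴮ b σ)} t))
  ... | b′ , b′∈ , c = b∈μ , (λ h → T-not⁻ (∧-left t) (elemᴮ-intro b σ h)) , b′ , b′∈ ,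
                       ≡ᵇ⇒≡ (col b′) (col b) (∧-left c) , ∧-right {col b′ ≡ᵇ col b} c

  ∈-outside⁺ : ∀ {b} → Outside R μ σ b → b ∈ filterᵇ test μ
  ∈-outside⁺ {b} (b∈μ , b∉ , b′ , b′∈ , e , r) = ∈-filter⁺ (λ b → T? (test b)) b∈μ
    (∧-intro (T-not (λ t → b∉ (elemᴮ-elim b σ t)))
             (any⁺ (λ b′ → (col b′ ≡ᵇ col b) ∧ R b b′) (lose b′∈ (∧-intro (≡⇒≡ᵇ (col b′) (col b) e) r))))

vecs-≤ : ∀ {m n} (q : Vec ℕ n) → q ∈ vecs m n → ∀ k → at q k ≤ m
vecs-≤ []       q∈ k       = z≤n
vecs-≤ (x ∷ xs) q∈ zero    = proj₁ (∈-vecs⁻ q∈)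
vecs-≤ (x ∷ xs) q∈ (suc k) = vecs-≤ xs (proj₂ (∈-vecs⁻ q∈)) k

module Expansion (m j₀ : ℕ) {n : ℕ} (q p : Vec ℕ n) (q∈ : q ∈ vecs m n) (p∈ : p ∈ vecs m n)
                 (dq : Dec q) (dp : Dec p) (p≤q : p ≤ᵛ q) (p₀<m : at p 0 < m)
                 (columns : ∀ j → 1 ≤ j → j ≤ m → ∃[ a ] (at p a < j × j ≤ at q a)) where
  open Boxes j₀
  open Shapes m j₀
  open Matrix m n

  σ : Shape
  σ = bx 1 q p

  Pair : Set
  Pair = Vec ℕ n × Vec ℕ n

  shape : Pair → Shape
  shape (q′ , p′) = bx 1 q′ p′

  Around : Pair → Set
  Around (q′ , p′) = q′ ∈ vecs m n × p′ ∈ vecs m n × Dec q′ × Dec p′ × q ≤ᵛ q′ × p′ ≤ᵛ p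

  -- A column `j` within row `k` of the first shape meets `σ` in some row `a`. If `k ≤ a`,
  -- monotonicity of `q₂` gives the bound. If `a < k`, the cell in row `k` is to the right of `p₁`,
  -- hence a genuine box, and it belongs to the second shape as well.
  right-⊆ : ∀ y y′ → Around y → Around y′ → shape y ≡ shape y′ → proj₁ y ≤ᵛ proj₁ y′
  right-⊆ (q₁ , p₁) (q₂ , p₂) (q₁∈ , _ , _ , dp₁ , _ , p₁≤) (_ , _ , dq₂ , _ , q≤₂ , _) e k = bound
      (at q₁ k) refl
    where
    bound : ∀ j → at q₁ k ≡ j → j ≤ at q₂ k
    bound zero    _ = z≤n
    bound (suc j) j≡ with columns (suc j) (s≤s z≤n) (≤-trans (≤-reflexive (sym j≡)) (vecs-≤ q₁ q₁∈ k))
    ... | a , l , u with ≤-<-connex k a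
    ... | inj₁ k≤a = ≤-trans u (≤-trans (q≤₂ a) (Dec-≤ q₂ dq₂ k≤a))
    ... | inj₂ a<k with bx-∈⁻ 1 q₂ p₂ (subst (cell (1 + k) (suc j) ∈_) e
                          (bx-∈⁺ 1 q₁ p₁ k (≤-<-trans (≤-trans (Dec-≤ p₁ dp₁ (<⇒≤ a<k)) (p₁≤ a)) l)
                              (≤-reflexive (sym j≡))))
    ... | k′ , j′ , e′ , _ , u′ with suc-injective (cong row e′) | +-cancelˡ-≡ j₀ (suc j) j′ (cong col e′)
    ... | refl | refl = u′

  -- The same argument for the column just after the left end of row `k`; `p₀<m` ensures that this
  -- column is among those met by `σ`.
  left-⊆ : ∀ y y′ → Around y → Around y′ → shape y ≡ shape y′ → proj₂ y′ ≤ᵛ proj₂ y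
  left-⊆ (q₁ , p₁) (q₂ , p₂) (_ , _ , dq₁ , _ , q≤₁ , p₁≤) (_ , _ , _ , dp₂ , _ , p₂≤) e k
    with columns (suc (at p₁ k)) (s≤s z≤n) (≤-trans (s≤s (≤-trans (p₁≤ k) (Dec-≤ p dp (z≤n {k})))) p₀<m)
  ... | a , l , u with ≤-<-connex a k
  ... | inj₁ a≤k = ≤-trans (Dec-≤ p₂ dp₂ a≤k) (≤-trans (p₂≤ a) (≤-pred l))
  ... | inj₂ k<a with bx-∈⁻ 1 q₂ p₂ (subst (cell (1 + k) (suc (at p₁ k)) ∈_) e
                        (bx-∈⁺ 1 q₁ p₁ k ≤-refl (≤-trans u (≤-trans (q≤₁ a) (Dec-≤ q₁ dq₁ (<⇒≤ k<a))))))
  ... | k′ , j′ , e′ , l′ , _ with suc-injective (cong row e′) | +-cancelˡ-≡ j₀ (suc (at p₁ k)) j′ (cong col e′)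
  ... | refl | refl = ≤-pred l′

  shape-injective : ∀ y y′ → Around y → Around y′ → shape y ≡ shape y′ → y ≡ y′
  shape-injective y y′ a a′ e = cong₂ _,_
    (at-ext _ _ (λ k → ≤-antisym (right-⊆ y y′ a a′ e k) (right-⊆ y′ y a′ a (sym e) k)))
    (at-ext _ _ (λ k → ≤-antisym (left-⊆ y′ y a′ a (sym e) k) (left-⊆ y y′ a a′ e k)))

  shape-⊇ : ∀ y → Around y → shape y ⊇ˢ σ
  shape-⊇ (q′ , p′) (q′∈ , _ , _ , _ , q≤ , ≤p) = contains , sameColumn
    where
    contains : ∀ b → b ∈ σ → b ∈ bx 1 q′ p′
    contains b b∈ with bx-∈⁻ 1 q p b∈
    ... | k , j , refl , l , u = bx-∈⁺ 1 q′ p′ k (≤-<-trans (≤p k) l) (≤-trans u (q≤ k))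
    sameColumn : ∀ b → b ∈ bx 1 q′ p′ → ∃[ b′ ] (b′ ∈ σ × col b′ ≡ col b)
    sameColumn b b∈ with bx-∈⁻ 1 q′ p′ b∈
    ... | k , j , refl , l , u with columns j (≤-trans (s≤s z≤n) l) (≤-trans u (vecs-≤ q′ q′∈ k))
    ... | a , l′ , u′ = cell (1 + a) j , bx-∈⁺ 1 q p a l′ u′ , refl

  ∉-σ : ∀ k j → cell (1 + k) j ∈ σ → at p k < j × j ≤ at q k
  ∉-σ k j b∈ with bx-∈⁻ 1 q p b∈
  ... | k′ , j′ , e , l , u with suc-injective (cong row e) | +-cancelˡ-≡ j₀ j j′ (cong col e)
  ... | refl | refl = l , u

  -- A box left of the end `p` of its row has a box of `σ` in its column, because `σ` meets every
  -- column. As `p` is decreasing, that box can only be in a lower row.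
  Apart-shape : ∀ y → Around y → Apart (shape y) σ ≡ bx 1 p (proj₂ y)
  Apart-shape (q′ , p′) (q′∈ , _ , _ , _ , q≤ , ≤p) =
    sorted-ext (AllPairsₚ.filter⁺ _ (bx-sorted 1 q′ p′)) (bx-sorted 1 p p′)
      (λ {b} b∈ → fwd b (∈-outside⁻ above (bx 1 q′ p′) σ b∈))
          (λ {b} b∈ → ∈-outside⁺ above (bx 1 q′ p′) σ (bwd b (bx-∈⁻ 1 p p′ b∈)))
    where
    above : Box → Box → Bool
    above b b′ = row b <ᵇ row b′
    fwd : ∀ b → Outside above (bx 1 q′ p′) σ b → b ∈ bx 1 p p′
    fwd b (b∈ , b∉ , b′ , b′∈ , e , r) with bx-∈⁻ 1 q′ p′ b∈ | bx-∈⁻ 1 q p b′∈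
    ... | k , j , refl , l , u | a , j′ , refl , l′ , u′ with +-cancelˡ-≡ j₀ j′ j e
    ... | refl with ≤-<-connex j (at p k)
    ... | inj₁ h = bx-∈⁺ 1 p p′ k l h
    ... | inj₂ h = ⊥-elim (b∉ (bx-∈⁺ 1 q p k h
        (≤-trans u′ (Dec-≤ q dq (<⇒≤ (≤-pred (<ᵇ⇒< (1 + k) (1 + a) r)))))))
    bwd : ∀ b → ∃[ k ] ∃[ j ] (b ≡ cell (1 + k) j × at p′ k < j × j ≤ at p k) → Outside above (bx 1 q′ p′) σ b
    bwd _ (k , j , refl , l , u) with columns j (≤-trans (s≤s z≤n) l) (≤-trans u (vecs-≤ p p∈ k))
    ... | a , l′ , u′ = bx-∈⁺ 1 q′ p′ k l (≤-trans u (≤-trans (p≤q k) (q≤ k))) ,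
        (λ h → n≮n j (≤-<-trans u (proj₁ (∉-σ k j h)))) ,
                        cell (1 + a) j , bx-∈⁺ 1 q p a l′ u′ , refl , <⇒<ᵇ (s≤s (later (≤-<-connex a k)))
      where
      later : a ≤ k ⊎ k < a → k < a
      later (inj₂ h) = h
      later (inj₁ h) = ⊥-elim (n≮n j (≤-<-trans (≤-trans u (Dec-≤ p dp h)) l′))

  Bpart-shape : ∀ y → Around y → Bpart (shape y) σ ≡ bx 1 (proj₁ y) q
  Bpart-shape (q′ , p′) (q′∈ , _ , _ , _ , q≤ , ≤p) =
    sorted-ext (AllPairsₚ.filter⁺ _ (bx-sorted 1 q′ p′)) (bx-sorted 1 q′ q)
      (λ {b} b∈ → fwd b (∈-outside⁻ below (bx 1 q′ p′) σ b∈))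
          (λ {b} b∈ → ∈-outside⁺ below (bx 1 q′ p′) σ (bwd b (bx-∈⁻ 1 q′ q b∈)))
    where
    below : Box → Box → Bool
    below b b′ = row b′ <ᵇ row b
    fwd : ∀ b → Outside below (bx 1 q′ p′) σ b → b ∈ bx 1 q′ q
    fwd b (b∈ , b∉ , b′ , b′∈ , e , r) with bx-∈⁻ 1 q′ p′ b∈ | bx-∈⁻ 1 q p b′∈
    ... | k , j , refl , l , u | a , j′ , refl , l′ , u′ with +-cancelˡ-≡ j₀ j′ j e
    ... | refl with ≤-<-connex j (at q k)
    ... | inj₂ h = bx-∈⁺ 1 q′ q k h u
    ... | inj₁ h = ⊥-elim (b∉ (bx-∈⁺ 1 q p k (≤-<-trans (Dec-≤ p dp (<⇒≤ (≤-pred (<ᵇ⇒< (1 + a) (1 + k) r))))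
        l′) h))
    bwd : ∀ b → ∃[ k ] ∃[ j ] (b ≡ cell (1 + k) j × at q k < j × j ≤ at q′ k) → Outside below (bx 1 q′ p′) σ b
    bwd _ (k , j , refl , l , u) with columns j (≤-trans (s≤s z≤n) l) (≤-trans u (vecs-≤ q′ q′∈ k))
    ... | a , l′ , u′ = bx-∈⁺ 1 q′ p′ k (≤-<-trans (≤-trans (≤p k) (p≤q k)) l) u ,
        (λ h → n≮n j (≤-<-trans (proj₂ (∉-σ k j h)) l)) ,
                        cell (1 + a) j , bx-∈⁺ 1 q p a l′ u′ , refl , <⇒<ᵇ (s≤s (earlier (≤-<-connex k a)))
      where
      earlier : k ≤ a ⊎ a < k → a < k
      earlier (inj₂ h) = h
      earlier (inj₁ h) = ⊥-elim (n≮n j (≤-<-trans (≤-trans u′ (Dec-≤ q dq h)) l))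

  maxRow-bx : ∀ (x y : Vec ℕ n) → maxRow (bx 1 x y) ≤ n
  maxRow-bx x y = maxRow-≤ (bx 1 x y) (λ b∈ → row≤ (bx-∈⁻ 1 x y b∈))
    where
    row≤ : ∀ {b} → ∃[ k ] ∃[ j ] (b ≡ cell (1 + k) j × at y k < j × j ≤ at x k) → row b ≤ n
    row≤ (k , j , refl , l , u) with <-≤-connex k n
    ... | inj₁ h = h
    ... | inj₂ h = ⊥-elim (n≮n 0 (≤-trans (≤-trans (s≤s z≤n) l) (≤-trans u (≤-reflexive (at-out x k h)))))
      where
      at-out : ∀ {n} (x : Vec ℕ n) k → n ≤ k → at x k ≡ 0
      at-out []       k       _       = refl
      at-out (x ∷ xs) (suc k) (s≤s h) = at-out xs k h

  summand : List ℕ → Shape → ℤ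
  summand c μ = sign (length (Bpart μ σ)) *ℤ (+ (aCoef σ μ * schurCoeff μ c))

  pairTerm : List ℕ → Pair → ℤ
  pairTerm ds (q′ , p′) = C n q q′ · (Γ ds q′ p′ · E n p′ p)

  summand-shape : ∀ ds y → Around y → summand (reverse ds) (shape y) ≡ pairTerm ds y
  summand-shape ds (q′ , p′) ar@(q′∈ , p′∈ , dq′ , dp′ , q≤ , ≤p) =
    trans (cong₂ (λ b a → sign (length b) *ℤ (+
        ((#rwbSSYT a * #rbRRS b) * schurCoeff (bx 1 q′ p′) (reverse ds))))
                 (Bpart-shape (q′ , p′) ar) (Apart-shape (q′ , p′) ar))
    (trans (unfold (sign (length (bx 1 q′ q))) (#rwbSSYT (bx 1 p p′)) (#rbRRS (bx 1 q′ q))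
        (schurCoeff (bx 1 q′ p′) (reverse ds)))
           (cong₂ _·_ below (cong₂ _·_ middle above)))
    where
    open Bridge m j₀ {n}
    opaque
      unfolding _·_
      unfold : ∀ s a b c → s *ℤ (+ ((a * b) * c)) ≡ (s · (+ b)) · ((+ c) · (+ a))
      unfold s a b c = trans (cong (s *ℤ_) (trans (ℤₚ.pos-* (a * b) c) (cong (_*ℤ (+ c)) (ℤₚ.pos-* a b))))
          (rearrange s (+ a) (+ b) (+ c))
        where
        rearrange : ∀ s a b c → s *ℤ ((a *ℤ b) *ℤ c) ≡ (s *ℤ b) *ℤ (c *ℤ a)
        rearrange = solve-∀
    below : sign (length (bx 1 q′ q)) · (+ #rbRRS (bx 1 q′ q)) ≡ C n q q′
    below = trans (cong₂ (λ l x → sign l · x) (length-bx j₀ 1 q′ q) (#rbRRS≡ (bx 1 q′ q) n (maxRow-bx q′ q)))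
                  (rrs≡C n q q′ q′∈ (Dec⇒dec q dq) (Dec⇒dec q′ dq′) q≤)
    above : + #rwbSSYT (bx 1 p p′) ≡ E n p′ p
    above = trans (#rwbSSYT≡ (bx 1 p p′) n (maxRow-bx p p′))
        (rwb≡E n p p′ p∈ (Dec⇒dec p dp) (Dec⇒dec p′ dp′) ≤p)
    middle : + schurCoeff (bx 1 q′ p′) (reverse ds) ≡ Γ ds q′ p′
    middle = trans (schurCoeff≡ (bx 1 q′ p′) (reverse ds))
      (trans (cong (λ k → Fill (range1 k) (bx 1 q′ p′)
          (λ z → ⟦ isSSYT z ⟧ · ⟦ hasContent (reverse ds) (map proj₂ z) ⟧)) (length-reverse ds))
      (trans (Fill-cong (range1 (length ds)) (bx 1 q′ p′)
          (λ z _ _ → cong (λ b → ⟦ isSSYT z ⟧ · ⟦ b ⟧) (hasContent-reverse ds (map proj₂ z))))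
             (ssyt≡Γ ds q′ p′ q′∈ (Dec⇒dec q′ dq′) (Dec⇒dec p′ dp′)
                 (λ k → ≤-trans (≤p k) (≤-trans (p≤q k) (q≤ k))))))

  pairTerm-supp : ∀ {n′} → n ≡ suc n′ → ∀ ds y → proj₁ y ∈ vecs m n → proj₂ y ∈ vecs m n →
                  (pairTerm ds y ≡ 0ℤ) ⊎ (Around y × length (shape y) ≡ sum ds)
  pairTerm-supp refl ds (q′ , p′) q′∈ p′∈ with C-supp n q q′ | C-dec m _ q q′ | Γ-size m ds q′ p′ | E-supp n
      p′ p | E-dec m n p′ p dp
  ... | inj₁ z | _      | _      | _      | _      = inj₁ (0· _ z)
  ... | inj₂ _ | inj₁ z | _      | _      | _      = inj₁ (0· _ z)
  ... | inj₂ _ | inj₂ _ | inj₁ z | _      | _      = inj₁ (0·′ (C n q q′) (0· (E n p′ p) z))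
  ... | inj₂ _ | inj₂ _ | inj₂ _ | inj₁ z | _      = inj₁ (0·′ (C n q q′) (0·′ (Γ ds q′ p′) z))
  ... | inj₂ _ | inj₂ _ | inj₂ _ | inj₂ _ | inj₁ z = inj₁ (0·′ (C n q q′) (0·′ (Γ ds q′ p′) z))
  ... | inj₂ a | inj₂ b | inj₂ c | inj₂ d | inj₂ e =
    inj₂ ((q′∈ , p′∈ , dec⇒Dec q′ b , e , a , d) , trans (length-bx j₀ 1 q′ p′) c)

  _≟ˢ_ : DecidableEquality Shape
  _≟ˢ_ = Listₚ.≡-dec (Productₚ.≡-dec _≟_ _≟_)

  -- The matrix product is a sum over all pairs of vectors. A pair contributes only if it lies
  -- around `(q , p)` and, by `Γ-size`, its shape has exactly `sum ds` boxes, hence at most `N`. So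
  -- `Ms` contains every contributing shape, and `shape-injective` ensures that none is counted
  -- twice.
  expansion : ∀ {n′} → n ≡ suc n′ → ∀ ds R N Ms → (∀ i → R ≤ i → at p i ≡ 0) → R + length ds ≤ pred n → sum
      ds ≤ N →
              Unique Ms → (∀ μ → (μ ∈ Ms) ⇔ (IsSkewShape μ × μ ⊇ˢ σ × length μ ≤ N)) →
              (∀ μ → μ ∈ Ms → ∃[ y ] (Around y × shape y ≡ μ)) →
              grothCoeff σ (reverse ds) ≡ rhsCoeff σ Ms (reverse ds)
  expansion n≡ ds R N Ms pz l s≤N uMs Ms⇔ pairs =
    trans (grothCoeff≡ σ ds)
    (trans (GrothBridge.sv≡Groth m j₀ ds q p q∈ (Dec⇒dec q dq) (Dec⇒dec p dp) p≤q)
    (trans (sym (Φ≡Groth m n ds R q p pz l q∈ p∈ (Dec⇒dec q dq) (Dec⇒dec p dp) p≤q))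
    (trans (∑-cong (vecs m n) (λ q′ → sym (∑-*ˡ (vecs m n) (C n q q′) _)))
    (trans (sym (∑-cartesian (vecs m n) (vecs m n) _,_ (pairTerm ds)))
    (trans (∑-reindex _≟ˢ_ Ms (cartesianProduct (vecs m n) (vecs m n)) (summand (reverse ds)) (pairTerm ds)
        shape Around
              uMs (Uniqueₚ.cartesianProduct⁺ (vecs-unique m n) (vecs-unique m n)) value preimage
                  shape-injective)
           (∑-def Ms _))))))
    where
    value : ∀ y → y ∈ cartesianProduct (vecs m n) (vecs m n) →
            (pairTerm ds y ≡ 0ℤ) ⊎ (Around y × shape y ∈ Ms × pairTerm ds y ≡ summand (reverse ds) (shape y))
    value y y∈ with ∈-cartesianProductWith⁻ _,_ (vecs m n) (vecs m n) y∈
    ... | q′ , p′ , q′∈ , p′∈ , refl with pairTerm-supp n≡ ds (q′ , p′) q′∈ p′∈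
    ... | inj₁ z = inj₁ z
    ... | inj₂ (ar@(_ , _ , dq′ , dp′ , _) , e) = inj₂ (ar ,
            from (Ms⇔ (bx 1 q′ p′)) (bx-skew q′ p′ dq′ dp′ , shape-⊇ (q′ , p′) ar , ≤-trans (≤-reflexive e)
                s≤N) ,
            sym (summand-shape ds (q′ , p′) ar))
    preimage : ∀ μ → μ ∈ Ms → ∃[ y ] (y ∈ cartesianProduct (vecs m n) (vecs m n) × Around y × shape y ≡ μ ×
        pairTerm ds y ≡ summand (reverse ds) μ)
    preimage μ μ∈ with pairs μ μ∈
    ... | y@(q′ , p′) , ar@(q′∈ , p′∈ , _) , e = y , ∈-cartesianProduct⁺ q′∈ p′∈ , ar , e ,
            trans (sym (summand-shape ds y ar)) (cong (summand (reverse ds)) e)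

-- Choice of the frame and conclusion.

maxRows : List Shape → ℕ
maxRows = foldr (λ μ k → maxRow μ ⊔ k) 0

≤-maxRows : ∀ Ms {μ} → μ ∈ Ms → maxRow μ ≤ maxRows Ms
≤-maxRows (x ∷ Ms) (here refl) = m≤m⊔n (maxRow x) _
≤-maxRows (x ∷ Ms) (there μ∈)  = ≤-trans (≤-maxRows Ms μ∈) (m≤n⊔m (maxRow x) _)

leftmost : ∀ σ {b} → b ∈ σ → ∃[ x ] (x ∈ σ × (∀ {y} → y ∈ σ → col x ≤ col y))
leftmost σ {b} b∈ with minimum-attained (col b) col σ
... | inj₁ e = b , b∈ , λ y∈ → subst (_≤ _) e (minimum-≤ (col b) col σ y∈)
... | inj₂ (x , x∈ , e) = x , x∈ , λ y∈ → subst (_≤ _) e (minimum-≤ (col b) col σ y∈)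

rightmost : ∀ σ {b} → b ∈ σ → ∃[ x ] (x ∈ σ × (∀ {y} → y ∈ σ → col y ≤ col x))
rightmost σ {b} b∈ with maximum-attained col σ
... | inj₂ (x , x∈ , e) = x , x∈ , λ y∈ → ≤-trans (≤-maximum col σ y∈) (≤-reflexive e)
... | inj₁ e = b , b∈ , λ y∈ → ≤-trans (≤-maximum col σ y∈) (subst (_≤ col b) (sym e) z≤n)

theorem1p1 : (σ : Shape) → IsSkewShape σ → Connected σ → TopRowIsOne σ →
    (c : List ℕ) → (N : ℕ) → sum c ≤ N →
    (Ms : List Shape) → Unique Ms →
    (∀ μ → (μ ∈ Ms) ⇔ (IsSkewShape μ × μ ⊇ˢ σ × length μ ≤ N)) →
    grothCoeff σ c ≡ rhsCoeff σ Ms c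
theorem1p1 σ skew conn (b₀ , b₀∈ , row-b₀) c N sum≤N Ms uMs Ms⇔ =
  -- The matrices list exponents from the largest variable down, so the expansion is applied to
  -- `reverse c`.
  subst₂ (λ s c → grothCoeff s c ≡ rhsCoeff s Ms c) (sym σ≡) (reverse-involutive c)
    (expansion refl (reverse c) (maxRow σ) N Ms p-zero enough
      (≤-trans (≤-reflexive (sum-↭ (Permₚ.↭-reverse c))) sum≤N) uMs
      (subst (λ s → ∀ μ → (μ ∈ Ms) ⇔ (IsSkewShape μ × μ ⊇ˢ s × length μ ≤ N)) σ≡ Ms⇔) pairs)
  where
  xl = proj₁ (leftmost σ b₀∈)
  xl∈ = proj₁ (proj₂ (leftmost σ b₀∈))
  xl-min : ∀ {y} → y ∈ σ → col xl ≤ col y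
  xl-min = proj₂ (proj₂ (leftmost σ b₀∈))
  xr = proj₁ (rightmost σ b₀∈)
  xr∈ = proj₁ (proj₂ (rightmost σ b₀∈))
  xr-max : ∀ {y} → y ∈ σ → col y ≤ col xr
  xr-max = proj₂ (proj₂ (rightmost σ b₀∈))
  -- Columns are counted from the one just before the leftmost box, so offsets run from `1` to the
  -- width `m`.
  j₀ = pred (col xl)
  suc-j₀ : suc j₀ ≡ col xl
  suc-j₀ = suc-pred (col xl) ⦃ >-nonZero (proj₂ (proj₁ (proj₂ skew) xl xl∈)) ⦄
  m = col xr ∸ j₀
  j₀+m : j₀ + m ≡ col xr
  j₀+m = m+[n∸m]≡n (≤-trans (n≤1+n j₀) (≤-trans (≤-reflexive suc-j₀) (xl-min xr∈)))
  -- One spare row for each variable below the last row of `σ`, room for every shape in `Ms`, and a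
  -- final row that stays empty; the `suc` also supplies the factor `V` needed by `C-dec`.
  n = suc (maxRow σ + (length c + maxRows Ms))
  open Boxes j₀
  open Shapes m j₀
  σ-cols : ∀ {b} → b ∈ σ → j₀ < col b × col b ≤ j₀ + m
  σ-cols b∈ = ≤-trans (≤-reflexive suc-j₀) (xl-min b∈) , ≤-trans (xr-max b∈) (≤-reflexive (sym j₀+m))
  q p : Vec ℕ n
  q = tab (rightEnd σ) n
  p = tab (leftEnd σ) n
  σ≡ : σ ≡ bx 1 q p
  σ≡ = bx-ends σ n skew (λ b∈ → ≤-trans (≤-maxRow σ b∈) (≤-trans (m≤m+n (maxRow σ) _) (n≤1+n _))) σ-cols
  column : ∀ j → 1 ≤ j → j ≤ m → ∃[ x ] (x ∈ σ × col x ≡ j₀ + j)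
  column j l u = Columns.path-col skew (conn xl xr xl∈ xr∈) xl∈ (j₀ + j)
    (≤-trans (≤-reflexive (sym suc-j₀)) (≤-trans (≤-reflexive (+-comm 1 j₀)) (+-monoʳ-≤ j₀ l)))
    (≤-trans (+-monoʳ-≤ j₀ u) (≤-reflexive j₀+m))
  columns : ∀ j → 1 ≤ j → j ≤ m → ∃[ a ] (at p a < j × j ≤ at q a)
  columns j l u with column j l u
  ... | x , x∈ , e with bx-∈⁻ 1 q p (subst (x ∈_) σ≡ x∈)
  ... | a , j′ , refl , l′ , u′ with +-cancelˡ-≡ j₀ j′ j e
  ... | refl = a , l′ , u′
  -- Were the ends to cross, the column after `rightEnd σ k` would still contain a box of `σ`. In a
  -- row up to `k` it pushes `leftEnd` down to `rightEnd`; in a later row it exceeds the maximum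
  -- `rightEnd`.
  left≤right : ∀ k → leftEnd σ k ≤ rightEnd σ k
  left≤right k with ≤-<-connex (leftEnd σ k) (rightEnd σ k)
  ... | inj₁ h = h
  ... | inj₂ h with column (suc (rightEnd σ k)) (s≤s z≤n) (≤-trans h (minimum-≤-default m _ σ))
  ... | x , x∈ , e with ≤-<-connex (row x) k
  ... | inj₁ x≤k = ⊥-elim (n≮n _ (<-≤-trans h (≤-trans (leftEnd-≤ σ k x∈ (≤-trans x≤k (n≤1+n k)))
                      (≤-reflexive (trans (cong (_∸ suc j₀) (trans e (+-suc j₀ _))) (m+n∸m≡n (suc j₀) _))))))
  ... | inj₂ k<x = ⊥-elim (n≮n _ (≤-trans (≤-reflexive (sym (trans (cong (_∸ j₀) e) (m+n∸m≡n j₀ _))))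
      (≤-rightEnd σ k x∈ k<x)))
  -- The box `b₀` in row 1 takes part in the minimum for the first row, which thus stays below the
  -- default `m`.
  p₀<m : at p 0 < m
  p₀<m = ≤-trans (s≤s (leftEnd-≤ σ 0 b₀∈ (≤-reflexive row-b₀)))
           (≤-trans (≤-reflexive (sym (+-∸-assoc 1 (proj₁ (σ-cols b₀∈)))))
               (m≤n+o⇒m∸n≤o (col b₀) j₀ (proj₂ (σ-cols b₀∈))))
  -- From the last row of `σ` on, the minimum includes the leftmost box `xl`, whose offset is `0`.
  p-zero : ∀ i → maxRow σ ≤ i → at p i ≡ 0
  p-zero i h with <-≤-connex i n
  ... | inj₂ n≤i = at-tab-out (leftEnd σ) n i n≤i
  ... | inj₁ i<n = trans (at-tab (leftEnd σ) n i i<n)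
      (n≤0⇒n≡0 (≤-trans (leftEnd-≤ σ i xl∈ (≤-trans (≤-maxRow σ xl∈) (≤-trans h (n≤1+n i))))
                     (≤-reflexive (trans (cong (_∸ suc j₀) (sym suc-j₀)) (n∸n≡0 j₀)))))
  enough : maxRow σ + length (reverse c) ≤ pred n
  enough = +-monoʳ-≤ (maxRow σ) (≤-trans (≤-reflexive (length-reverse c)) (m≤m+n (length c) _))
  open Expansion m j₀ q p (tab-∈ (rightEnd σ) n (rightEnd-≤m σ (λ b∈ → proj₂ (σ-cols b∈))))
    (tab-∈ (leftEnd σ) n (λ k → minimum-≤-default m _ σ)) (tab-Dec (rightEnd σ) n (rightEnd-dec σ))
        (tab-Dec (leftEnd σ) n (leftEnd-dec σ))
    (tab-mono (leftEnd σ) (rightEnd σ) n left≤right) p₀<m columns hiding (σ)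
  pairs : ∀ μ → μ ∈ Ms → ∃[ y ] (Around y × shape y ≡ μ)
  pairs μ μ∈ = (tab (rightEnd μ) n , tab (leftEnd μ) n) ,
    (tab-∈ (rightEnd μ) n (rightEnd-≤m μ (λ b∈ → proj₂ (μ-cols b∈))) , tab-∈ (leftEnd μ) n
        (λ k → minimum-≤-default m _ μ) ,
     tab-Dec (rightEnd μ) n (rightEnd-dec μ) , tab-Dec (leftEnd μ) n (leftEnd-dec μ) ,
     tab-mono (rightEnd σ) (rightEnd μ) n (rightEnd-mono (λ b∈ → proj₁ μ⊇σ _ b∈)) ,
     tab-mono (leftEnd μ) (leftEnd σ) n (leftEnd-mono (λ b∈ → proj₁ μ⊇σ _ b∈))) ,
    sym (bx-ends μ n (proj₁ μ-props) (λ b∈ → ≤-trans (≤-maxRow μ b∈) (≤-trans (≤-maxRows Ms μ∈)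
           (≤-trans (m≤n+m (maxRows Ms) (length c)) (≤-trans (m≤n+m _ (maxRow σ)) (n≤1+n _))))) μ-cols)
    where
    μ-props = to (Ms⇔ μ) μ∈
    μ⊇σ = proj₁ (proj₂ μ-props)
    μ-cols : ∀ {b} → b ∈ μ → j₀ < col b × col b ≤ j₀ + m
    μ-cols {b} b∈ with proj₂ μ⊇σ b b∈
    ... | b′ , b′∈ , e = subst (λ y → j₀ < y × y ≤ j₀ + m) e (σ-cols b′∈)
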